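{- $\mathsf{ATR} \leq_W \mathsf{WCWO}$.
   Context: Problems are (possibly partial) multivalued functions $P:\subseteq X \rightrightarrows Y$ between represented spaces (spaces $X$ with a surjective partial map $\delta:\subseteq\mathbb{N}^\mathbb{N}\to X$; $p$ is a name of $\delta(p)$). $P \leq_W Q$ (Weihrauch reducibility) means there are computable partial functions $\Phi,\Psi:\subseteq \mathbb{N}^\mathbb{N}\to\mathbb{N}^\mathbb{N}$ such that for every name $p$ of a $P$-instance, $\Phi(p)$ is a name of a $Q$-instance, and for every name $q$ of a $Q$-solution of that instance, $\Psi(p\oplus q)$ is a name of a $P$-solution of the instance named by $p$. A linear ordering $L$ with domain a subset of $\mathbb{N}$ is represented by the set $\{\langle a,b\rangle : a\leq_L b\}$. Jump hierarchy: if $L$ is a linear ordering with first element $0_L$ and $A\subseteq\mathbb{N}$, a jump hierarchy on $L$ starting with $A$ is a sequence $\langle X_a\rangle_{a\in L}$ with $X_{0_L}=A$ and $X_b = (\bigoplus_{a<_L b} X_a)'$ for all $b>_L 0_L$ (where $'$ is the Turing jump). For well-orderings it exists and is unique. $\mathsf{ATR}$: instances are pairs $(L,A)$ with $L$ a countable well-ordering and $A\subseteq\mathbb{N}$; the unique solution is the jump hierarchy on $L$ starting with $A$. $\mathsf{WCWO}$: given a pair of countable well-orderings, produce an (order-preserving) embedding from one of them into the other. -}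

module Defs where

open import Data.Nat using (ℕ; zero; suc; _+_; _<_; _≡ᵇ_)
open import Data.Bool using (Bool; true; false; if_then_else_; _∧_; not)
open import Data.Fin using (Fin; toℕ)
open import Data.Vec using (Vec; []; _∷_; lookup)
open import Data.Product using (Σ; _×_; _,_; proj₁; proj₂)
open import Data.Sum using (_⊎_)
open import Relation.Binary.PropositionalEquality using (_≡_)
open import Relation.Nullary using (¬_)
open import Induction.WellFounded using (WellFounded)
open import Function using (_∘_)

Baire : Set
Baire = ℕ → ℕ

tri : ℕ → ℕ
tri zero    = zero
tri (suc n) = suc n + tri n

pair : ℕ → ℕ → ℕ
pair a b = tri (a + b) + b

unpair : ℕ → ℕ × ℕ
unpair zero = zero , zero
unpair (suc m) with unpair m
... | zero  , b = suc b , zero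
... | suc a , b = a , suc b

join : Baire → Baire → Baire
join p q zero          = p zero
join p q (suc zero)    = q zero
join p q (suc (suc n)) = join (p ∘ suc) (q ∘ suc) n

left : Baire → Baire
left p n = p (n + n)

right : Baire → Baire
right p n = p (suc (n + n))

data PR : ℕ → Set where
  zeroF  : ∀ {n} → PR n
  succF  : PR 1
  proj   : ∀ {n} → Fin n → PR n
  oracle : PR 1
  comp   : ∀ {n m} → PR m → Vec (PR n) m → PR n
  prec   : ∀ {n} → PR n → PR (suc (suc n)) → PR (suc n)
  mu     : ∀ {n} → PR (suc n) → PR n

mutual
  data Eval (f : Baire) : ∀ {n} → PR n → Vec ℕ n → ℕ → Set where
    ev-zero : ∀ {n} {xs : Vec ℕ n} → Eval f zeroF xs zero
    ev-succ : ∀ {x} → Eval f succF (x ∷ []) (suc x)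
    ev-proj : ∀ {n} {i : Fin n} {xs} → Eval f (proj i) xs (lookup xs i)
    ev-orac : ∀ {x} → Eval f oracle (x ∷ []) (f x)
    ev-comp : ∀ {n m} {g : PR m} {hs : Vec (PR n) m} {xs ys v} →
              EvalVec f hs xs ys → Eval f g ys v → Eval f (comp g hs) xs v
    ev-prec0 : ∀ {n} {g : PR n} {h} {xs v} →
               Eval f g xs v → Eval f (prec g h) (zero ∷ xs) v
    ev-precS : ∀ {n} {g : PR n} {h} {k xs u v} →
               Eval f (prec g h) (k ∷ xs) u → Eval f h (k ∷ u ∷ xs) v →
               Eval f (prec g h) (suc k ∷ xs) v
    ev-mu   : ∀ {n} {g : PR (suc n)} {xs y} →
              Eval f g (y ∷ xs) zero →
              (∀ z → z < y → Σ ℕ λ k → Eval f g (z ∷ xs) (suc k)) →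
              Eval f (mu g) xs y

  data EvalVec (f : Baire) {n : ℕ} : ∀ {m} → Vec (PR n) m → Vec ℕ n → Vec ℕ m → Set where
    evv-[] : ∀ {xs} → EvalVec f [] xs []
    evv-∷  : ∀ {m} {h} {hs : Vec (PR n) m} {xs y ys} →
             Eval f h xs y → EvalVec f hs xs ys → EvalVec f (h ∷ hs) xs (y ∷ ys)

mutual
  encode : ∀ {n} → PR n → ℕ
  encode zeroF          = pair 0 0
  encode succF          = pair 1 0
  encode (proj i)       = pair 2 (toℕ i)
  encode oracle         = pair 3 0
  encode (comp {m = m} g hs) = pair 4 (pair m (pair (encode g) (encodeVec hs)))
  encode (prec g h)     = pair 5 (pair (encode g) (encode h))
  encode (mu g)         = pair 6 (encode g)

  encodeVec : ∀ {n m} → Vec (PR n) m → ℕ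
  encodeVec []       = zero
  encodeVec (h ∷ hs) = suc (pair (encode h) (encodeVec hs))

Computes : PR 1 → Baire → Baire → Set
Computes e p g = ∀ n → Eval p e (n ∷ []) (g n)

Jump : Baire → ℕ → Set
Jump f e = Σ (PR 1) λ c → encode c ≡ e × Σ ℕ λ v → Eval f c (e ∷ []) v

IsSet : Baire → Set
IsSet χ = ∀ n → χ n ≡ 0 ⊎ χ n ≡ 1

_≤[_]_ : ℕ → Baire → ℕ → Set
a ≤[ r ] b = r (pair a b) ≡ 1

_<[_]_ : ℕ → Baire → ℕ → Set
a <[ r ] b = a ≤[ r ] b × ¬ (a ≡ b)

Field : Baire → ℕ → Set
Field r a = a ≤[ r ] a

record IsLinOrder (r : Baire) : Set where
  field
    char    : IsSet r
    inField : ∀ a b → a ≤[ r ] b → Field r a × Field r b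
    antisym : ∀ a b → a ≤[ r ] b → b ≤[ r ] a → a ≡ b
    trans   : ∀ a b c → a ≤[ r ] b → b ≤[ r ] c → a ≤[ r ] c
    total   : ∀ a b → Field r a → Field r b → a ≤[ r ] b ⊎ b ≤[ r ] a

IsWellOrder : Baire → Set
IsWellOrder r = IsLinOrder r × WellFounded (λ a b → a <[ r ] b)

IsLeast : Baire → ℕ → Set
IsLeast r b = Field r b × (∀ a → Field r a → b ≤[ r ] a)

IsEmbedding : Baire → Baire → Baire → Set
IsEmbedding r₁ r₂ f =
  (∀ a → Field r₁ a → Field r₂ (f a)) ×
  (∀ a b → a <[ r₁ ] b → f a <[ r₂ ] f b)

-- Jump hierarchies. A sequence ⟨X_a⟩_{a ∈ L} is named by the characteristic
-- function t of {⟨a,n⟩ : a ∈ L, n ∈ X_a}.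

strictBelowᵇ : Baire → ℕ → ℕ → Bool
strictBelowᵇ r a b = (r (pair a b) ≡ᵇ 1) ∧ not (a ≡ᵇ b)

-- characteristic function of ⊕_{a <_L b} X_a = {⟨a,n⟩ : a <_L b, n ∈ X_a}
below : Baire → Baire → ℕ → Baire
below r t b m = if strictBelowᵇ r (proj₁ (unpair m)) b then t m else 0

IsJumpHierarchy : Baire → Baire → Baire → Set
IsJumpHierarchy r χ t =
  IsSet t ×
  (∀ a n → ¬ Field r a → t (pair a n) ≡ 0) ×
  (∀ b → IsLeast r b → ∀ n → t (pair b n) ≡ χ n) ×
  (∀ z b → IsLeast r z → z <[ r ] b → ∀ n →
     (t (pair b n) ≡ 1 → Jump (below r t b) n) × (Jump (below r t b) n → t (pair b n) ≡ 1))

record Problem : Set₁ where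
  field
    Inst : Baire → Set
    Sol  : Baire → Baire → Set

open Problem

_≤W_ : Problem → Problem → Set
P ≤W Q = Σ (PR 1) λ Φ → Σ (PR 1) λ Ψ →
  ∀ p → Inst P p →
    Σ Baire λ p' → Computes Φ p p' × Inst Q p' ×
      (∀ q → Sol Q p' q → Σ Baire λ s → Computes Ψ (join p q) s × Sol P p s)

ATR : Problem
ATR = record
  { Inst = λ p → IsWellOrder (left p) × IsSet (right p)
  ; Sol  = λ p t → IsJumpHierarchy (left p) (right p) t }

WCWO : Problem
WCWO = record
  { Inst = λ p → IsWellOrder (left p) × IsWellOrder (right p)
  ; Sol  = λ p s → (s 0 ≡ 0 × IsEmbedding (left p) (right p) (s ∘ suc))
                 ⊎ (s 0 ≡ 1 × IsEmbedding (right p) (left p) (s ∘ suc)) }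

{-# OPTIONS --safe #-}
-- The jump hierarchy on L is read off the kernel of a decidable well-founded digraph ⊳ computed from (L, A):
-- its vertices deny facts "n ∈ X_b" and "c evaluates to v with oracle ⊕_{a <_L b} X_a", or assert the premises
-- of a rule instance proving such a fact, and each vertex is attacked by what contradicts it. So it
-- suffices that an embedding bounds, for every y outside the kernel, the least attacker x of y inside it.
--
-- Let M be the lexicographic sum, over all y and all x ⊳ y, of the trees of attempts to defend "x is the
-- least attacker of y in the kernel": every refutation d of an earlier claim must be answered by some s ⊳ d
-- claimed to be in the kernel, while exponents descend from a bound (∞, x). If the claim is true, the
-- attempts have order type ω^(∞, x); if it is false, then some false claim must drop in L again and again
-- and the type is below ω^∞. As y has at most one least attacker, M ≤ N for N the finite descending
-- sequences of all exponents, so N + 1 does not embed into M, whereas an embedding of M into N + 1 has to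
-- send the block of y below some ω^(∞, x) with x bounded by the code of the image.
--
-- The comparison of order types is done by a pigeonhole argument with negative statements only, since the
-- kernel is not decidable before an embedding is given.
module Submission where

open import Defs
open import Data.Nat hiding (_/_; _≰_)
open import Data.Nat.Properties
open import Data.Bool using (Bool; true; false; T; if_then_else_; _∧_; _∨_; not)
open import Data.Product hiding (map)
open import Data.Sum using (_⊎_; inj₁; inj₂)
open import Data.Empty using (⊥; ⊥-elim)
open import Data.Unit using (⊤; tt)
open import Relation.Nullary using (¬_)
open import Relation.Binary.PropositionalEquality

-- The block of an attacker `x` is made larger the larger `x` is, so that an embedding is forced to
-- reveal a bound on `x`. The claim speaks of the least attacker, and not of any attacker in the
-- kernel, to keep the sum small: a vertex with infinitely many true claims would have blocks of
-- types ω^(∞, x) for unbounded `x`, their sum would reach the type of `𝓝`, and `𝓝` could be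
-- embedded the wrong way. A false claim is cheap because exponents are pairs of a level and a
-- number. The number counts the turns until a given refutation has to be answered. If that
-- refutation lies in the kernel, its answer does not, so the answer is refuted in turn, at a
-- smaller level. The ranking therefore has to drop over two consecutive attacks only, and a single
-- attack may keep the level: a rule instance that attacks the denial of its own conclusion is about
-- the same fact. The way back from an ordinal bound to a number rests on the fact that the code of
-- an exponent is at most the code of the letter carrying it.

-- Cantor pairing, and its inverse by primitive recursion

module Pairing where


  fst snd : ℕ → ℕ
  fst m = proj₁ (unpair m)
  snd m = proj₂ (unpair m)

  pair-step : ∀ a b → pair a (suc b) ≡ suc (pair (suc a) b)
  pair-step a b rewrite +-suc a b = +-suc (suc (a + b) + tri (a + b)) b

  pair-row : ∀ a → pair (suc a) 0 ≡ suc (pair 0 a)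
  pair-row a rewrite +-identityʳ a | +-identityʳ (suc a + tri a) = cong suc (+-comm a (tri a))

  unpair-pair′ : ∀ m a b → pair a b ≡ m → unpair m ≡ (a , b)
  unpair-pair′ zero zero zero e = refl
  unpair-pair′ zero (suc a) b ()
  unpair-pair′ zero zero (suc b) e with trans (sym (pair-step 0 b)) e
  ... | ()
  unpair-pair′ (suc m) zero zero ()
  unpair-pair′ (suc m) (suc a) zero e
    rewrite unpair-pair′ m 0 a (suc-injective (trans (sym (pair-row a)) e)) = refl
  unpair-pair′ (suc m) a (suc b) e
    rewrite unpair-pair′ m (suc a) b (suc-injective (trans (sym (pair-step a b)) e)) = refl

  unpair-pair : ∀ a b → unpair (pair a b) ≡ (a , b)
  unpair-pair a b = unpair-pair′ (pair a b) a b refl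

  fst-pair : ∀ a b → fst (pair a b) ≡ a
  fst-pair a b = cong proj₁ (unpair-pair a b)

  snd-pair : ∀ a b → snd (pair a b) ≡ b
  snd-pair a b = cong proj₂ (unpair-pair a b)

  pair-unpair : ∀ m → pair (fst m) (snd m) ≡ m
  pair-unpair zero = refl
  pair-unpair (suc m) with unpair m | pair-unpair m
  ... | zero , b  | e = trans (pair-row b) (cong suc e)
  ... | suc a , b | e = trans (pair-step a b) (cong suc e)

  pair-inj₁ : ∀ {a b c d} → pair a b ≡ pair c d → a ≡ c
  pair-inj₁ {a} {b} {c} {d} e = trans (sym (fst-pair a b)) (trans (cong fst e) (fst-pair c d))

  pair-inj₂ : ∀ {a b c d} → pair a b ≡ pair c d → b ≡ d
  pair-inj₂ {a} {b} {c} {d} e = trans (sym (snd-pair a b)) (trans (cong snd e) (snd-pair c d))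

  n≤tri : ∀ n → n ≤ tri n
  n≤tri zero = z≤n
  n≤tri (suc n) = m≤m+n (suc n) (tri n)

  tri-mono : ∀ {m n} → m ≤ n → tri m ≤ tri n
  tri-mono {n = n} z≤n = z≤n
  tri-mono (s≤s p) = +-mono-≤ (s≤s p) (tri-mono p)

  a≤pair : ∀ a b → a ≤ pair a b
  a≤pair a b = ≤-trans (m≤m+n a b) (≤-trans (n≤tri (a + b)) (m≤m+n _ b))

  b≤pair : ∀ a b → b ≤ pair a b
  b≤pair a b = m≤n+m b (tri (a + b))

  b<pair : ∀ a b → b < pair (suc a) b
  b<pair a b = m<n+m b z<s

  fst≤ : ∀ m → fst m ≤ m
  fst≤ m = subst (fst m ≤_) (pair-unpair m) (a≤pair (fst m) (snd m))

  snd≤ : ∀ m → snd m ≤ m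
  snd≤ m = subst (snd m ≤_) (pair-unpair m) (b≤pair (fst m) (snd m))

  pair-monoʳ-< : ∀ a {b c} → b < c → pair a b < pair a c
  pair-monoʳ-< a {b} {c} lt = +-mono-≤-< (tri-mono (+-monoʳ-≤ a (<⇒≤ lt))) lt

  -- The antidiagonal on which a code lies. A new one starts exactly at the next triangular number,
  -- so a recursion carrying a single number computes it, and both components can be recovered from
  -- it.
  diag : ℕ → ℕ
  diag zero = 0
  diag (suc m) = if suc m ≡ᵇ tri (suc (diag m)) then suc (diag m) else diag m

  if-true : ∀ {A : Set} {b} {x y : A} → T b → (if b then x else y) ≡ x
  if-true {b = true} _ = refl

  if-false : ∀ {A : Set} {b} {x y : A} → (T b → ⊥) → (if b then x else y) ≡ y
  if-false {b = true} h = ⊥-elim (h tt)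
  if-false {b = false} _ = refl

  diag-spec : ∀ m → diag m ≡ fst m + snd m
  diag-spec zero = refl
  diag-spec (suc m) with unpair m | pair-unpair m | diag-spec m
  ... | zero , b | e | d = trans (if-true (≡⇒≡ᵇ (suc m) _ eq)) (trans (cong suc d) (cong suc (sym (+-identityʳ b))))
    where eq : suc m ≡ tri (suc (diag m))
          eq = trans (cong suc (sym e)) (trans (sym (pair-row b))
                 (trans (+-identityʳ _) (cong tri (trans (+-identityʳ (suc b)) (cong suc (sym d))))))
  ... | suc a , b | e | d = trans (if-false ne) (trans d (sym (+-suc a b)))
    where ne : T (suc m ≡ᵇ tri (suc (diag m))) → ⊥
          ne h = <-irrefl eq lt
            where eq : suc m ≡ suc (suc a + b) + tri (suc a + b)
                  eq = trans (≡ᵇ⇒≡ (suc m) _ h) (cong (λ s → tri (suc s)) d)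
                  lt : suc m < suc (suc a + b) + tri (suc a + b)
                  lt = subst (λ x → suc x < suc (suc a + b) + tri (suc a + b)) e
                         (subst (suc (tri (suc a + b) + b) <_) (+-comm (tri (suc a + b)) (suc (suc a + b)))
                           (subst (_< tri (suc a + b) + suc (suc a + b)) (+-suc (tri (suc a + b)) b)
                             (+-monoʳ-< (tri (suc a + b)) (s<s (s≤s (m≤n+m b a))))))

  snd-spec : ∀ m → m ∸ tri (diag m) ≡ snd m
  snd-spec m = trans (cong₂ (λ x s → x ∸ tri s) (sym (pair-unpair m)) (diag-spec m)) (m+n∸m≡n (tri (fst m + snd m)) (snd m))

  fst-spec : ∀ m → diag m ∸ snd m ≡ fst m
  fst-spec m = trans (cong (_∸ snd m) (diag-spec m)) (m+n∸n≡m (fst m) (snd m))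

-- A term language with oracle, compiled to `PR`

module Prog where

  open Pairing
  open import Data.Fin using (Fin; zero; suc)
  open import Data.Vec using (Vec; []; _∷_; lookup; tabulate)
  open import Data.Vec.Properties using (tabulate∘lookup; tabulate-cong)
  open import Function using (_∘_; id)

  data Sort : Set where
    nat bool : Sort

  Val : Sort → Set
  Val nat = ℕ
  Val bool = Bool

  bit : Bool → ℕ
  bit b = if b then 1 else 0

  num : ∀ {s} → Val s → ℕ
  num {nat} n = n
  num {bool} b = bit b

  -- Packs a program with the function it computes, so that the meaning of a term using it reduces
  -- to that function. For this reason many later identities between a term and the test it
  -- implements hold by `refl`.
  record Prim (m : ℕ) (s : Sort) : Set where
    field
      fun  : Vec ℕ m → Val s
      prog : PR m
      correct : ∀ f xs → Eval f prog xs (num (fun xs))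
  open Prim

  natrec : ℕ → (ℕ → ℕ → ℕ) → ℕ → ℕ
  natrec z s zero = z
  natrec z s (suc n) = s n (natrec z s n)

  allᵇ anyᵇ : ℕ → (ℕ → Bool) → Bool
  allᵇ zero p = true
  allᵇ (suc n) p = allᵇ n p ∧ p n
  anyᵇ zero p = false
  anyᵇ (suc n) p = anyᵇ n p ∨ p n

  -- `app` evaluates its body in the environment of its arguments alone, which gives closed
  -- subroutines without any weakening or substitution.
  data Tm (n : ℕ) : Sort → Set where
    var  : Fin n → Tm n nat
    lit  : ℕ → Tm n nat
    suc′ : Tm n nat → Tm n nat
    orc  : Tm n nat → Tm n nat
    rec  : Tm n nat → Tm n nat → Tm (suc (suc n)) nat → Tm n nat
    app  : ∀ {m s} → Tm m s → Vec (Tm n nat) m → Tm n s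
    prim : ∀ {m s} → Prim m s → Vec (Tm n nat) m → Tm n s
    pos′ : Tm n nat → Tm n bool
    not′ : Tm n bool → Tm n bool
    _∧′_ _∨′_ : Tm n bool → Tm n bool → Tm n bool
    if′  : ∀ {s} → Tm n bool → Tm n s → Tm n s → Tm n s
    all′ any′ : Tm n nat → Tm (suc n) bool → Tm n bool

  infixr 6 _∧′_
  infixr 5 _∨′_

  pos : ℕ → Bool
  pos zero = false
  pos (suc _) = true

  mutual
    ⟦_⟧ : ∀ {n s} → Tm n s → Baire → Vec ℕ n → Val s
    ⟦ var i ⟧ f ρ = lookup ρ i
    ⟦ lit k ⟧ f ρ = k
    ⟦ suc′ t ⟧ f ρ = suc (⟦ t ⟧ f ρ)
    ⟦ orc t ⟧ f ρ = f (⟦ t ⟧ f ρ)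
    ⟦ rec t z b ⟧ f ρ = natrec (⟦ z ⟧ f ρ) (λ k u → ⟦ b ⟧ f (k ∷ u ∷ ρ)) (⟦ t ⟧ f ρ)
    ⟦ app t ts ⟧ f ρ = ⟦ t ⟧ f (⟦ ts ⟧* f ρ)
    ⟦ prim p ts ⟧ f ρ = fun p (⟦ ts ⟧* f ρ)
    ⟦ pos′ t ⟧ f ρ = pos (⟦ t ⟧ f ρ)
    ⟦ not′ a ⟧ f ρ = not (⟦ a ⟧ f ρ)
    ⟦ a ∧′ b ⟧ f ρ = ⟦ a ⟧ f ρ ∧ ⟦ b ⟧ f ρ
    ⟦ a ∨′ b ⟧ f ρ = ⟦ a ⟧ f ρ ∨ ⟦ b ⟧ f ρ
    ⟦ if′ c t e ⟧ f ρ = if ⟦ c ⟧ f ρ then ⟦ t ⟧ f ρ else ⟦ e ⟧ f ρ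
    ⟦ all′ t b ⟧ f ρ = allᵇ (⟦ t ⟧ f ρ) (λ k → ⟦ b ⟧ f (k ∷ ρ))
    ⟦ any′ t b ⟧ f ρ = anyᵇ (⟦ t ⟧ f ρ) (λ k → ⟦ b ⟧ f (k ∷ ρ))

    ⟦_⟧* : ∀ {n m} → Vec (Tm n nat) m → Baire → Vec ℕ n → Vec ℕ m
    ⟦ [] ⟧* f ρ = []
    ⟦ t ∷ ts ⟧* f ρ = ⟦ t ⟧ f ρ ∷ ⟦ ts ⟧* f ρ

  litP : ∀ {n} → ℕ → PR n
  litP zero = zeroF
  litP (suc k) = comp succF (litP k ∷ [])

  andP orP : PR 2
  andP = prec zeroF (proj (suc (suc zero)))
  orP = prec (proj zero) (litP 1)

  notP posP : PR 1
  notP = prec (litP 1) zeroF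
  posP = prec zeroF (litP 1)

  ifP : PR 3
  ifP = prec (proj (suc zero)) (proj (suc (suc zero)))

  projs : ∀ {n k} → (Fin n → Fin k) → Vec (PR k) n
  projs g = tabulate (proj ∘ g)

  -- The body receives the counter and the parameters; the shift by two skips the counter and the
  -- accumulated value.
  quantP : ∀ {n} → ℕ → PR 2 → PR (suc n) → PR (suc n)
  quantP z op b = prec (litP z) (comp op (proj (suc zero) ∷ comp b (proj zero ∷ projs (λ i → suc (suc i))) ∷ []))

  mutual
    compile : ∀ {n s} → Tm n s → PR n
    compile (var i) = proj i
    compile (lit k) = litP k
    compile (suc′ t) = comp succF (compile t ∷ [])
    compile (orc t) = comp oracle (compile t ∷ [])
    compile (rec t z b) = comp (prec (compile z) (compile b)) (compile t ∷ projs id)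
    compile (app t ts) = comp (compile t) (compile* ts)
    compile (prim p ts) = comp (prog p) (compile* ts)
    compile (pos′ t) = comp posP (compile t ∷ [])
    compile (not′ t) = comp notP (compile t ∷ [])
    compile (a ∧′ b) = comp andP (compile a ∷ compile b ∷ [])
    compile (a ∨′ b) = comp orP (compile a ∷ compile b ∷ [])
    compile (if′ c t e) = comp ifP (compile c ∷ compile t ∷ compile e ∷ [])
    compile (all′ t b) = comp (quantP 1 andP (compile b)) (compile t ∷ projs id)
    compile (any′ t b) = comp (quantP 0 orP (compile b)) (compile t ∷ projs id)

    compile* : ∀ {n m} → Vec (Tm n nat) m → Vec (PR n) m
    compile* [] = []
    compile* (t ∷ ts) = compile t ∷ compile* ts

  module _ (f : Baire) where

    litP-ok : ∀ {n} k {xs : Vec ℕ n} → Eval f (litP k) xs k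
    litP-ok zero = ev-zero
    litP-ok (suc k) = ev-comp (evv-∷ (litP-ok k) evv-[]) ev-succ

    andP-ok : ∀ (a : Bool) y → Eval f andP (bit a ∷ y ∷ []) (if a then y else 0)
    andP-ok true y = ev-precS (ev-prec0 ev-zero) ev-proj
    andP-ok false y = ev-prec0 ev-zero

    orP-ok : ∀ (a : Bool) y → Eval f orP (bit a ∷ y ∷ []) (if a then 1 else y)
    orP-ok true y = ev-precS (ev-prec0 ev-proj) (litP-ok 1)
    orP-ok false y = ev-prec0 ev-proj

    and-ok : ∀ a b → Eval f andP (bit a ∷ bit b ∷ []) (bit (a ∧ b))
    and-ok true b = andP-ok true (bit b)
    and-ok false b = andP-ok false (bit b)

    or-ok : ∀ a b → Eval f orP (bit a ∷ bit b ∷ []) (bit (a ∨ b))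
    or-ok true b = orP-ok true (bit b)
    or-ok false b = orP-ok false (bit b)

    notP-ok : ∀ a → Eval f notP (bit a ∷ []) (bit (not a))
    notP-ok true = ev-precS (ev-prec0 (litP-ok 1)) ev-zero
    notP-ok false = ev-prec0 (litP-ok 1)

    posP-ok : ∀ n → Eval f posP (n ∷ []) (bit (pos n))
    posP-ok zero = ev-prec0 ev-zero
    posP-ok (suc n) = ev-precS (posP-ok n) (litP-ok 1)

    ifP-ok : ∀ {s} c (t e : Val s) → Eval f ifP (num {bool} c ∷ num t ∷ num e ∷ []) (num {s} (if c then t else e))
    ifP-ok true t e = ev-precS (ev-prec0 ev-proj) ev-proj
    ifP-ok false t e = ev-prec0 ev-proj

    projs-ok′ : ∀ {n k} (g : Fin n → Fin k) xs → EvalVec f (projs g) xs (tabulate (lookup xs ∘ g))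
    projs-ok′ {zero} g xs = evv-[]
    projs-ok′ {suc n} g xs = evv-∷ ev-proj (projs-ok′ (g ∘ suc) xs)

    projs-ok : ∀ {n k} (g : Fin n → Fin k) xs ys → (∀ i → lookup xs (g i) ≡ lookup ys i) →
               EvalVec f (projs g) xs ys
    projs-ok g xs ys h = subst (EvalVec f (projs g) xs) (trans (tabulate-cong h) (tabulate∘lookup ys)) (projs-ok′ g xs)

    quantP-ok : ∀ {n} z op (b : PR (suc n)) (_⊛_ : Bool → Bool → Bool) (base : Bool) (xs : Vec ℕ n) (p : ℕ → Bool) →
      z ≡ bit base → (∀ x y → Eval f op (bit x ∷ bit y ∷ []) (bit (x ⊛ y))) →
      (q : ℕ → Bool) → q 0 ≡ base → (∀ k → q (suc k) ≡ q k ⊛ p k) →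
      (∀ k → Eval f b (k ∷ xs) (bit (p k))) →
      ∀ m → Eval f (quantP z op b) (m ∷ xs) (bit (q m))
    quantP-ok z op b _⊛_ base xs p refl hop q q0 qs hb zero =
      subst (λ v → Eval f (quantP z op b) (0 ∷ xs) (bit v)) (sym q0) (ev-prec0 (litP-ok z))
    quantP-ok z op b _⊛_ base xs p refl hop q q0 qs hb (suc m) =
      subst (λ v → Eval f (quantP z op b) (suc m ∷ xs) (bit v)) (sym (qs m))
        (ev-precS (quantP-ok z op b _⊛_ base xs p refl hop q q0 qs hb m)
          (ev-comp (evv-∷ ev-proj (evv-∷ (ev-comp (evv-∷ ev-proj (projs-ok (λ i → suc (suc i)) _ xs (λ _ → refl))) (hb m)) evv-[]))
            (hop (q m) (p m))))

    mutual
      compile-ok : ∀ {n s} (t : Tm n s) ρ → Eval f (compile t) ρ (num (⟦ t ⟧ f ρ))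
      compile-ok (var i) ρ = ev-proj
      compile-ok (lit k) ρ = litP-ok k
      compile-ok (suc′ t) ρ = ev-comp (evv-∷ (compile-ok t ρ) evv-[]) ev-succ
      compile-ok (orc t) ρ = ev-comp (evv-∷ (compile-ok t ρ) evv-[]) ev-orac
      compile-ok (rec t z b) ρ =
        ev-comp (evv-∷ (compile-ok t ρ) (projs-ok id ρ ρ (λ _ → refl))) (rec-ok z b ρ (⟦ t ⟧ f ρ))
      compile-ok (app t ts) ρ = ev-comp (compile*-ok ts ρ) (compile-ok t _)
      compile-ok (prim p ts) ρ = ev-comp (compile*-ok ts ρ) (correct p f _)
      compile-ok (pos′ t) ρ = ev-comp (evv-∷ (compile-ok t ρ) evv-[]) (posP-ok _)
      compile-ok (not′ t) ρ = ev-comp (evv-∷ (compile-ok t ρ) evv-[]) (notP-ok (⟦ t ⟧ f ρ))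
      compile-ok (a ∧′ b) ρ = ev-comp (evv-∷ (compile-ok a ρ) (evv-∷ (compile-ok b ρ) evv-[])) (and-ok (⟦ a ⟧ f ρ) (⟦ b ⟧ f ρ))
      compile-ok (a ∨′ b) ρ = ev-comp (evv-∷ (compile-ok a ρ) (evv-∷ (compile-ok b ρ) evv-[])) (or-ok (⟦ a ⟧ f ρ) (⟦ b ⟧ f ρ))
      compile-ok {s = s} (if′ c t e) ρ =
        ev-comp (evv-∷ (compile-ok c ρ) (evv-∷ (compile-ok t ρ) (evv-∷ (compile-ok e ρ) evv-[]))) (ifP-ok {s} (⟦ c ⟧ f ρ) (⟦ t ⟧ f ρ) (⟦ e ⟧ f ρ))
      compile-ok (all′ t b) ρ =
        ev-comp (evv-∷ (compile-ok t ρ) (projs-ok id ρ ρ (λ _ → refl)))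
          (quantP-ok 1 andP (compile b) _∧_ true ρ p refl and-ok (λ m → allᵇ m p) refl (λ _ → refl)
            (λ k → compile-ok b (k ∷ ρ)) (⟦ t ⟧ f ρ))
        where p : ℕ → Bool
              p k = ⟦ b ⟧ f (k ∷ ρ)
      compile-ok (any′ t b) ρ =
        ev-comp (evv-∷ (compile-ok t ρ) (projs-ok id ρ ρ (λ _ → refl)))
          (quantP-ok 0 orP (compile b) _∨_ false ρ p refl or-ok (λ m → anyᵇ m p) refl (λ _ → refl)
            (λ k → compile-ok b (k ∷ ρ)) (⟦ t ⟧ f ρ))
        where p : ℕ → Bool
              p k = ⟦ b ⟧ f (k ∷ ρ)

      rec-ok : ∀ {n} (z : Tm n nat) b ρ m →
        Eval f (prec (compile z) (compile b)) (m ∷ ρ) (natrec (⟦ z ⟧ f ρ) (λ k u → ⟦ b ⟧ f (k ∷ u ∷ ρ)) m)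
      rec-ok z b ρ zero = ev-prec0 (compile-ok z ρ)
      rec-ok z b ρ (suc m) = ev-precS (rec-ok z b ρ m) (compile-ok b _)

      compile*-ok : ∀ {n m} (ts : Vec (Tm n nat) m) ρ → EvalVec f (compile* ts) ρ (⟦ ts ⟧* f ρ)
      compile*-ok [] ρ = evv-[]
      compile*-ok (t ∷ ts) ρ = evv-∷ (compile-ok t ρ) (compile*-ok ts ρ)

  mkPrim : ∀ {m s} (t : Tm m s) (F : Vec ℕ m → Val s) → (∀ f xs → ⟦ t ⟧ f xs ≡ F xs) → Prim m s
  mkPrim t F h .fun = F
  mkPrim t F h .prog = compile t
  mkPrim t F h .correct f xs = subst (λ v → Eval f (compile t) xs (num v)) (h f xs) (compile-ok f t xs)

  v0 : ∀ {n} → Tm (1 + n) nat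
  v0 = var zero
  v1 : ∀ {n} → Tm (2 + n) nat
  v1 = var (suc zero)
  v2 : ∀ {n} → Tm (3 + n) nat
  v2 = var (suc (suc zero))
  v3 : ∀ {n} → Tm (4 + n) nat
  v3 = var (suc (suc (suc zero)))
  v4 : ∀ {n} → Tm (5 + n) nat
  v4 = var (suc (suc (suc (suc zero))))

  prim₁ : (t : Tm 1 nat) (F : ℕ → ℕ) → (∀ f x → ⟦ t ⟧ f (x ∷ []) ≡ F x) → Prim 1 nat
  prim₁ t F h = mkPrim t (λ { (x ∷ []) → F x }) (λ { f (x ∷ []) → h f x })

  prim₂ : ∀ {s} (t : Tm 2 s) (F : ℕ → ℕ → Val s) → (∀ f x y → ⟦ t ⟧ f (x ∷ y ∷ []) ≡ F x y) → Prim 2 s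
  prim₂ t F h = mkPrim t (λ { (x ∷ y ∷ []) → F x y }) (λ { f (x ∷ y ∷ []) → h f x y })

  natrec-+ : ∀ x y → natrec y (λ _ → suc) x ≡ x + y
  natrec-+ zero y = refl
  natrec-+ (suc x) y = cong suc (natrec-+ x y)

  natrec-∸ : ∀ x y → natrec x (λ _ → pred) y ≡ x ∸ y
  natrec-∸ x zero = refl
  natrec-∸ x (suc y) = trans (cong pred (natrec-∸ x y)) (pred[m∸n]≡m∸[1+n] x y)

  natrec-tri : ∀ x → natrec 0 (λ k u → suc k + u) x ≡ tri x
  natrec-tri zero = refl
  natrec-tri (suc x) = cong (suc x +_) (natrec-tri x)

  natrec-diag : ∀ x → natrec 0 (λ k u → if suc k ≡ᵇ tri (suc u) then suc u else u) x ≡ diag x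
  natrec-diag zero = refl
  natrec-diag (suc x) = cong (λ u → if suc x ≡ᵇ tri (suc u) then suc u else u) (natrec-diag x)

  pos-∸ : ∀ x y → pos (y ∸ x) ≡ (x <ᵇ y)
  pos-∸ zero zero = refl
  pos-∸ zero (suc y) = refl
  pos-∸ (suc x) zero = refl
  pos-∸ (suc x) (suc y) = pos-∸ x y

  ≡ᵇ-<ᵇ : ∀ x y → not (x <ᵇ y) ∧ not (y <ᵇ x) ≡ (x ≡ᵇ y)
  ≡ᵇ-<ᵇ zero zero = refl
  ≡ᵇ-<ᵇ zero (suc y) = refl
  ≡ᵇ-<ᵇ (suc x) zero = refl
  ≡ᵇ-<ᵇ (suc x) (suc y) = ≡ᵇ-<ᵇ x y

  infixl 6 _+ᵗ_ _∸ᵗ_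
  infix 4 _<ᵗ_ _≟ᵗ_

  predᵗ : ∀ {n} → Tm n nat → Tm n nat
  predᵗ t = prim (prim₁ (rec v0 (lit 0) v0) pred λ { f zero → refl ; f (suc x) → refl }) (t ∷ [])

  _+ᵗ_ _∸ᵗ_ : ∀ {n} → Tm n nat → Tm n nat → Tm n nat
  a +ᵗ b = prim (prim₂ (rec v0 v1 (suc′ v1)) _+_ λ f → natrec-+) (a ∷ b ∷ [])
  a ∸ᵗ b = prim (prim₂ (rec v1 v0 (predᵗ v1)) _∸_ λ f → natrec-∸) (a ∷ b ∷ [])

  _<ᵗ_ _≟ᵗ_ : ∀ {n} → Tm n nat → Tm n nat → Tm n bool
  a <ᵗ b = prim (prim₂ (pos′ (v1 ∸ᵗ v0)) _<ᵇ_ λ f → pos-∸) (a ∷ b ∷ [])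
  a ≟ᵗ b = prim (prim₂ (not′ (v0 <ᵗ v1) ∧′ not′ (v1 <ᵗ v0)) _≡ᵇ_ λ f → ≡ᵇ-<ᵇ) (a ∷ b ∷ [])

  triᵗ diagᵗ fstᵗ sndᵗ : ∀ {n} → Tm n nat → Tm n nat
  triᵗ t = prim (prim₁ (rec v0 (lit 0) (suc′ v0 +ᵗ v1)) tri λ f → natrec-tri) (t ∷ [])
  diagᵗ t = prim (prim₁ (rec v0 (lit 0) (if′ (suc′ v0 ≟ᵗ triᵗ (suc′ v1)) (suc′ v1) v1)) diag λ f → natrec-diag) (t ∷ [])
  sndᵗ t = prim (prim₁ (v0 ∸ᵗ triᵗ (diagᵗ v0)) snd λ f → snd-spec) (t ∷ [])
  fstᵗ t = prim (prim₁ (diagᵗ v0 ∸ᵗ sndᵗ v0) fst λ f → fst-spec) (t ∷ [])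

  pairᵗ : ∀ {n} → Tm n nat → Tm n nat → Tm n nat
  pairᵗ a b = prim (prim₂ (triᵗ (v0 +ᵗ v1) +ᵗ v1) pair λ f x y → refl) (a ∷ b ∷ [])

  mutual
    -- The backward functional has the oracle `join p q`, whereas attacks are tested relative to
    -- `p`. Primitives stay as they are, being correct for every oracle.
    atLeft : ∀ {n s} → Tm n s → Tm n s
    atLeft (var i) = var i
    atLeft (lit k) = lit k
    atLeft (suc′ t) = suc′ (atLeft t)
    atLeft (orc t) = app (orc (v0 +ᵗ v0)) (atLeft t ∷ [])
    atLeft (rec t z b) = rec (atLeft t) (atLeft z) (atLeft b)
    atLeft (app t ts) = app (atLeft t) (atLeft* ts)
    atLeft (prim p ts) = prim p (atLeft* ts)
    atLeft (pos′ t) = pos′ (atLeft t)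
    atLeft (not′ a) = not′ (atLeft a)
    atLeft (a ∧′ b) = atLeft a ∧′ atLeft b
    atLeft (a ∨′ b) = atLeft a ∨′ atLeft b
    atLeft (if′ c t e) = if′ (atLeft c) (atLeft t) (atLeft e)
    atLeft (all′ t b) = all′ (atLeft t) (atLeft b)
    atLeft (any′ t b) = any′ (atLeft t) (atLeft b)

    atLeft* : ∀ {n m} → Vec (Tm n nat) m → Vec (Tm n nat) m
    atLeft* [] = []
    atLeft* (t ∷ ts) = atLeft t ∷ atLeft* ts

  natrec-cong : ∀ {z z′ s s′} → z ≡ z′ → (∀ k u → s k u ≡ s′ k u) → ∀ n → natrec z s n ≡ natrec z′ s′ n
  natrec-cong e h zero = e
  natrec-cong {s = s} e h (suc n) = trans (cong (s n) (natrec-cong e h n)) (h n _)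

  allᵇ-cong : ∀ {p q} → (∀ k → p k ≡ q k) → ∀ n → allᵇ n p ≡ allᵇ n q
  allᵇ-cong h zero = refl
  allᵇ-cong h (suc n) = cong₂ _∧_ (allᵇ-cong h n) (h n)

  anyᵇ-cong : ∀ {p q} → (∀ k → p k ≡ q k) → ∀ n → anyᵇ n p ≡ anyᵇ n q
  anyᵇ-cong h zero = refl
  anyᵇ-cong h (suc n) = cong₂ _∨_ (anyᵇ-cong h n) (h n)

  module _ {h p : Baire} (h≡ : ∀ x → left h x ≡ p x) where

    mutual
      atLeft-ok : ∀ {n s} (t : Tm n s) ρ → ⟦ atLeft t ⟧ h ρ ≡ ⟦ t ⟧ p ρ
      atLeft-ok (var i) ρ = refl
      atLeft-ok (lit k) ρ = refl
      atLeft-ok (suc′ t) ρ = cong suc (atLeft-ok t ρ)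
      atLeft-ok (orc t) ρ = trans (h≡ _) (cong p (atLeft-ok t ρ))
      atLeft-ok (rec t z b) ρ = trans (natrec-cong (atLeft-ok z ρ) (λ k u → atLeft-ok b (k ∷ u ∷ ρ)) (⟦ atLeft t ⟧ h ρ))
        (cong (natrec (⟦ z ⟧ p ρ) (λ k u → ⟦ b ⟧ p (k ∷ u ∷ ρ))) (atLeft-ok t ρ))
      atLeft-ok (app t ts) ρ = trans (atLeft-ok t _) (cong (⟦ t ⟧ p) (atLeft*-ok ts ρ))
      atLeft-ok (prim q ts) ρ = cong (fun q) (atLeft*-ok ts ρ)
      atLeft-ok (pos′ t) ρ = cong pos (atLeft-ok t ρ)
      atLeft-ok (not′ a) ρ = cong not (atLeft-ok a ρ)
      atLeft-ok (a ∧′ b) ρ = cong₂ _∧_ (atLeft-ok a ρ) (atLeft-ok b ρ)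
      atLeft-ok (a ∨′ b) ρ = cong₂ _∨_ (atLeft-ok a ρ) (atLeft-ok b ρ)
      atLeft-ok (if′ c t e) ρ rewrite atLeft-ok c ρ | atLeft-ok t ρ | atLeft-ok e ρ = refl
      atLeft-ok (all′ t b) ρ = trans (allᵇ-cong (λ k → atLeft-ok b (k ∷ ρ)) (⟦ atLeft t ⟧ h ρ))
        (cong (λ n → allᵇ n (λ k → ⟦ b ⟧ p (k ∷ ρ))) (atLeft-ok t ρ))
      atLeft-ok (any′ t b) ρ = trans (anyᵇ-cong (λ k → atLeft-ok b (k ∷ ρ)) (⟦ atLeft t ⟧ h ρ))
        (cong (λ n → anyᵇ n (λ k → ⟦ b ⟧ p (k ∷ ρ))) (atLeft-ok t ρ))

      atLeft*-ok : ∀ {n m} (ts : Vec (Tm n nat) m) ρ → ⟦ atLeft* ts ⟧* h ρ ≡ ⟦ ts ⟧* p ρ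
      atLeft*-ok [] ρ = refl
      atLeft*-ok (t ∷ ts) ρ = cong₂ _∷_ (atLeft-ok t ρ) (atLeft*-ok ts ρ)

-- Lexicographic orders on trees and the comparison of their order types

module Trees where

  open Pairing
  open import Data.Nat.Induction using (<-wellFounded)
  open import Data.List using (List; []; _∷_; drop)
  open import Induction.WellFounded using (Acc; acc; WellFounded)
  open import Relation.Binary.Definitions using (tri<; tri≈; tri>)
  open import Relation.Nullary using (yes; no)

  infix 4 _≺_
  _≺_ : List ℕ → List ℕ → Set
  _        ≺ []       = ⊥
  []       ≺ (_ ∷ _)  = ⊤
  (x ∷ xs) ≺ (y ∷ ys) = x < y ⊎ (x ≡ y × xs ≺ ys)

  ≺-trans : ∀ {a b c} → a ≺ b → b ≺ c → a ≺ c
  ≺-trans {[]} {_ ∷ _} {_ ∷ _} _ _ = tt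
  ≺-trans {_ ∷ _} {_ ∷ _} {_ ∷ _} (inj₁ p) (inj₁ q) = inj₁ (<-trans p q)
  ≺-trans {_ ∷ _} {_ ∷ _} {_ ∷ _} (inj₁ p) (inj₂ (refl , q)) = inj₁ p
  ≺-trans {_ ∷ _} {_ ∷ _} {_ ∷ _} (inj₂ (refl , p)) (inj₁ q) = inj₁ q
  ≺-trans {_ ∷ a} {_ ∷ b} {_ ∷ c} (inj₂ (refl , p)) (inj₂ (refl , q)) = inj₂ (refl , ≺-trans {a} {b} {c} p q)

  ≺-irrefl : ∀ a → ¬ (a ≺ a)
  ≺-irrefl (x ∷ a) (inj₁ p) = <-irrefl refl p
  ≺-irrefl (x ∷ a) (inj₂ (_ , p)) = ≺-irrefl a p

  ≺-cmp : ∀ a b → a ≺ b ⊎ (a ≡ b ⊎ b ≺ a)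
  ≺-cmp [] [] = inj₂ (inj₁ refl)
  ≺-cmp [] (_ ∷ _) = inj₁ tt
  ≺-cmp (_ ∷ _) [] = inj₂ (inj₂ tt)
  ≺-cmp (x ∷ a) (y ∷ b) with <-cmp x y
  ... | tri< p _ _ = inj₁ (inj₁ p)
  ... | tri> _ _ p = inj₂ (inj₂ (inj₁ p))
  ... | tri≈ _ refl _ with ≺-cmp a b
  ...   | inj₁ p = inj₁ (inj₂ (refl , p))
  ...   | inj₂ (inj₁ refl) = inj₂ (inj₁ refl)
  ...   | inj₂ (inj₂ p) = inj₂ (inj₂ (inj₂ (refl , p)))

  Tree : Set₁
  Tree = List ℕ → Set

  infix 20 _/_
  _/_ : Tree → ℕ → Tree
  (U / w) τ = U (w ∷ τ)

  within : Tree → List ℕ → List ℕ → Set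
  within U a b = U a × U b × a ≺ b

  -- The order is a sum along ω of the orders of the children, with `[]` at the bottom; hence an
  -- outer induction on the head and an inner one on the tail.
  within-wf : ∀ {U} → (∀ w τ → U (w ∷ τ) → WellFounded (within (U / w))) → WellFounded (within U)
  within-wf {U} h [] = acc λ { (_ , _ , ()) }
  within-wf {U} h (w ∷ τ) = acc λ { (u′ , u , lt) → rs (go w (<-wellFounded w) τ (h w τ u τ)) (u′ , u , lt) }
    where
    rs : ∀ {σ} → Acc (within U) σ → ∀ {ρ} → within U ρ σ → Acc (within U) ρ
    rs (acc f) = f
    mutual
      go : ∀ w → Acc _<_ w → ∀ τ → Acc (within (U / w)) τ → Acc (within U) (w ∷ τ)
      go w aw τ aτ = acc (step w aw τ aτ)
      step : ∀ w → Acc _<_ w → ∀ τ → Acc (within (U / w)) τ → ∀ {σ} → within U σ (w ∷ τ) → Acc (within U) σ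
      step w aw τ aτ {[]} _ = acc λ { (_ , _ , ()) }
      step w (acc aw) τ aτ {w′ ∷ τ′} (u′ , _ , inj₁ p) = go w′ (aw p) τ′ (h w′ τ′ u′ τ′)
      step w aw τ (acc aτ) {.w ∷ τ′} (u′ , u , inj₂ (refl , p)) = go w aw τ′ (aτ (u′ , u , p))

  within-mono : ∀ {U V} → (∀ τ → U τ → V τ) → ∀ {a} → Acc (within V) a → Acc (within U) a
  within-mono f (acc rs) = acc λ { (u , u′ , p) → within-mono f (rs (f _ u , f _ u′ , p)) }

  infix 4 _⋖_
  -- Classically: the order type of `U` is smaller than that of `V`. The head of `top` bounds the
  -- heads of all images, which makes the pigeonhole finite.
  record _⋖_ (U V : Tree) : Set where
    field
      map   : List ℕ → List ℕ
      into  : ∀ {τ} → U τ → V (map τ)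
      mono  : ∀ {τ τ′} → U τ → U τ′ → τ ≺ τ′ → map τ ≺ map τ′
      top   : List ℕ
      top∈  : V top
      under : ∀ {τ} → U τ → map τ ≺ top
  open _⋖_

  ⋖-restrict : ∀ {U U′ V} → (∀ {τ} → U′ τ → U τ) → U ⋖ V → U′ ⋖ V
  ⋖-restrict h e .map = map e
  ⋖-restrict h e .into u = into e (h u)
  ⋖-restrict h e .mono u u′ = mono e (h u) (h u′)
  ⋖-restrict h e .top = top e
  ⋖-restrict h e .top∈ = top∈ e
  ⋖-restrict h e .under u = under e (h u)

  ⋖-enlarge : ∀ {U V V′} → (∀ {τ} → V τ → V′ τ) → U ⋖ V → U ⋖ V′
  ⋖-enlarge h e .map = map e
  ⋖-enlarge h e .into u = h (into e u)
  ⋖-enlarge h e .mono = mono e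
  ⋖-enlarge h e .top = top e
  ⋖-enlarge h e .top∈ = h (top∈ e)
  ⋖-enlarge h e .under = under e

  monotone-bounded-repeats : ∀ (h : ℕ → ℕ) w → (∀ i → h i ≤ h (suc i)) → (∀ i → h i ≤ w) → Σ ℕ λ i → h i ≡ h (suc i)
  monotone-bounded-repeats h w mono bd = go w 0 (m≤m+n w (h 0))
    where
    -- `n` bounds the room left between `h i` and `w`, which shrinks whenever two neighbours differ.
    go : ∀ n i → w ≤ n + h i → Σ ℕ λ j → h j ≡ h (suc j)
    go zero i p = i , ≤-antisym (mono i) (≤-trans (bd (suc i)) p)
    go (suc n) i p with h i ≟ h (suc i)
    ... | yes e = i , e
    ... | no ne = go n (suc i) (≤-trans p (subst (_≤ n + h (suc i)) (+-suc n (h i)) (+-monoʳ-≤ n (≤∧≢⇒< (mono i) ne))))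

  head₀ : List ℕ → ℕ
  head₀ [] = 0
  head₀ (x ∷ _) = x

  head₀-mono : ∀ {a b} → a ≺ b → head₀ a ≤ head₀ b
  head₀-mono {[]} _ = z≤n
  head₀-mono {_ ∷ _} {_ ∷ _} (inj₁ p) = <⇒≤ p
  head₀-mono {_ ∷ _} {_ ∷ _} (inj₂ (refl , _)) = ≤-refl

  ≺-uncons : ∀ {a b} → a ≺ b → b ≡ head₀ b ∷ drop 1 b
  ≺-uncons {_} {_ ∷ _} _ = refl

  ≺-tail : ∀ {w a b} → w ∷ a ≺ w ∷ b → a ≺ b
  ≺-tail (inj₁ p) = ⊥-elim (<-irrefl refl p)
  ≺-tail (inj₂ (_ , p)) = p

  -- Pigeonhole: infinitely many children of U are mapped under finitely many children of V, so two
  -- consecutive ones land in the same child, and then the first of them lies strictly under a point of it.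
  module _ {U V : Tree} (e : U ⋖ V) (κ : ℕ → ℕ) (κ-mono : ∀ i → κ i < κ (suc i)) (κ∈ : ∀ i → U (κ i ∷ [])) where

    private
      p : ℕ → List ℕ
      -- The shift by one makes `p i` nonempty, as it lies strictly above the image of `κ i ∷ []`.
      p i = map e (κ (suc i) ∷ [])

      p-mono : ∀ i → p i ≺ p (suc i)
      p-mono i = mono e (κ∈ _) (κ∈ _) (inj₁ (κ-mono (suc i)))

      p-cons : ∀ i → p i ≡ head₀ (p i) ∷ drop 1 (p i)
      p-cons i = ≺-uncons {map e (κ i ∷ [])} (mono e (κ∈ _) (κ∈ _) (inj₁ (κ-mono i)))

    ⋖-child : Σ ℕ λ i → Σ ℕ λ w → w ≤ head₀ (top e) × (Σ (List ℕ) λ τ → V (w ∷ τ)) × U / κ i ⋖ V / w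
    ⋖-child = suc i , w , head₀-mono {p i} (under e (κ∈ _)) , (_ , subst V q≡ (into e (κ∈ _))) , child
      where
      rep : Σ ℕ λ i → head₀ (p i) ≡ head₀ (p (suc i))
      rep = monotone-bounded-repeats (λ i → head₀ (p i)) (head₀ (top e))
              (λ i → head₀-mono {p i} (p-mono i)) (λ i → head₀-mono {p i} (under e (κ∈ _)))
      i w : ℕ
      i = proj₁ rep
      w = head₀ (p i)
      q≡ : p (suc i) ≡ w ∷ drop 1 (p (suc i))
      q≡ = trans (p-cons (suc i)) (cong (_∷ drop 1 (p (suc i))) (sym (proj₂ rep)))
      m : List ℕ → List ℕ
      m τ = map e (κ (suc i) ∷ τ)
      m< : ∀ {τ} → U (κ (suc i) ∷ τ) → m τ ≺ w ∷ drop 1 (p (suc i))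
      m< {τ} u = subst (m τ ≺_) q≡ (mono e u (κ∈ _) (inj₁ (κ-mono (suc i))))
      -- All images lie between `p i` and `p (suc i)`, which share the head `w`.
      m≡ : ∀ {τ} → U (κ (suc i) ∷ τ) → m τ ≡ w ∷ drop 1 (m τ)
      m≡ {[]} u = p-cons i
      m≡ {x ∷ τ} u = trans (≺-uncons {p i} lt) (cong (_∷ drop 1 (m (x ∷ τ))) (≤-antisym (head₀-mono {m (x ∷ τ)} (m< u)) (head₀-mono {p i} lt)))
        where lt : p i ≺ m (x ∷ τ)
              lt = mono e (κ∈ _) u (inj₂ (refl , tt))
      child : U / κ (suc i) ⋖ V / w
      child .map τ = drop 1 (m τ)
      child .into u = subst V (m≡ u) (into e u)
      child .mono {τ} {τ′} u u′ lt = ≺-tail (subst₂ _≺_ (m≡ u) (m≡ u′) (mono e u u′ (inj₂ (refl , lt))))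
      child .top = drop 1 (p (suc i))
      child .top∈ = subst V q≡ (into e (κ∈ _))
      child .under {τ} u = ≺-tail (subst (_≺ (w ∷ drop 1 (p (suc i)))) (m≡ {τ} u) (m< u))

  -- An answer `s`, an exponent `t`, and a free index `k` that provides infinitely many copies of
  -- the same child, as the pigeonhole requires.
  letter : ℕ → ℕ → ℕ → ℕ
  letter s t k = pair s (pair t k)

  ans expo : ℕ → ℕ
  ans w = fst w
  expo w = fst (snd w)

  ans-letter : ∀ s t k → ans (letter s t k) ≡ s
  ans-letter s t k = fst-pair s (pair t k)

  expo-letter : ∀ s t k → expo (letter s t k) ≡ t
  expo-letter s t k = trans (cong fst (snd-pair s (pair t k))) (fst-pair t k)

  letter-mono : ∀ s t k → letter s t k < letter s t (suc k)
  letter-mono s t k = pair-monoʳ-< s (pair-monoʳ-< t ≤-refl)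

  expo≤ : ∀ w → expo w ≤ w
  expo≤ w = ≤-trans (fst≤ (snd w)) (snd≤ w)

  record Order : Set₁ where
    infix 4 _⊏_
    field
      _⊏_     : ℕ → ℕ → Set
      fld     : ℕ → Set
      ⊏-trans : ∀ {a b c} → a ⊏ b → b ⊏ c → a ⊏ c
      ⊏-cmp   : ∀ {a b} → fld a → fld b → a ⊏ b ⊎ (a ≡ b ⊎ b ⊏ a)
      ⊏-wf    : WellFounded _⊏_

  unpair-≡ : ∀ {a b} → fst a ≡ fst b → snd a ≡ snd b → a ≡ b
  unpair-≡ {a} {b} p q = trans (sym (pair-unpair a)) (trans (cong₂ pair p q) (pair-unpair b))

  data Lexω (_⊏_ : ℕ → ℕ → Set) (a b : ℕ) : Set where
    major : fst a ⊏ fst b → Lexω _⊏_ a b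
    minor : fst a ≡ fst b → snd a < snd b → Lexω _⊏_ a b

  -- Every element of `O` is replaced by a copy of ω.
  lexω : Order → Order
  lexω O = record { _⊏_ = _<<_ ; fld = λ a → fld (fst a) ; ⊏-trans = tr ; ⊏-cmp = cmp ; ⊏-wf = λ a → wf (⊏-wf (fst a)) (<-wellFounded (snd a)) a refl refl }
    where
    open Order O
    _<<_ : ℕ → ℕ → Set
    _<<_ = Lexω _⊏_
    tr : ∀ {a b c} → a << b → b << c → a << c
    tr (major p) (major q) = major (⊏-trans p q)
    tr {a} (major p) (minor e q) = major (subst (fst a ⊏_) e p)
    tr {c = c} (minor e p) (major q) = major (subst (_⊏ fst c) (sym e) q)
    tr (minor e p) (minor e′ q) = minor (trans e e′) (<-trans p q)
    cmp : ∀ {a b} → fld (fst a) → fld (fst b) → a << b ⊎ (a ≡ b ⊎ b << a)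
    cmp {a} {b} f g with ⊏-cmp f g
    ... | inj₁ p = inj₁ (major p)
    ... | inj₂ (inj₂ p) = inj₂ (inj₂ (major p))
    ... | inj₂ (inj₁ e) with <-cmp (snd a) (snd b)
    ...   | tri< p _ _ = inj₁ (minor e p)
    ...   | tri≈ _ e′ _ = inj₂ (inj₁ (unpair-≡ e e′))
    ...   | tri> _ _ p = inj₂ (inj₂ (minor (sym e) p))
    mutual
      wf : ∀ {x y} → Acc _⊏_ x → Acc _<_ y → ∀ a → fst a ≡ x → snd a ≡ y → Acc _<<_ a
      wf p q a e e′ = acc (step p q a e e′)
      step : ∀ {x y} → Acc _⊏_ x → Acc _<_ y → ∀ a → fst a ≡ x → snd a ≡ y → ∀ {b} → b << a → Acc _<<_ b
      step (acc p) q a refl refl {b} (major lt) = wf (p lt) (<-wellFounded (snd b)) b refl refl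
      step p (acc q) a refl refl {b} (minor e lt) = wf p (q lt) b e refl

  module Descending (E : Order) where
    open Order E

    -- The remaining parts of a letter are free, so each exponent below `t` recurs at infinitely
    -- many letters. Classically the order type is thus ω raised to the type of the exponents below
    -- `t`, here called ω^`t`.
    Desc : ℕ → Tree
    Desc t [] = ⊤
    Desc t (w ∷ τ) = (fld (expo w) × expo w ⊏ t) × Desc (expo w) τ

    Desc-mono : ∀ {t t′} → t ⊏ t′ → ∀ {τ} → Desc t τ → Desc t′ τ
    Desc-mono p {[]} _ = tt
    Desc-mono p {_ ∷ _} ((f , q) , d) = (f , ⊏-trans q p) , d

    Desc-wf : ∀ t → WellFounded (within (Desc t))
    Desc-wf t = go (⊏-wf t)
      where
      go : ∀ {t} → Acc _⊏_ t → WellFounded (within (Desc t))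
      go (acc rs) = within-wf λ { w τ ((_ , p) , _) σ → within-mono (λ { _ (_ , d) → d }) (go (rs p) σ) }

    -- The maximum of finitely many exponents, found under double negations because fld, ⊏ and G need not
    -- be decidable.
    ⊏-bound : ∀ {t} (G : ℕ → ℕ → Set) → (∀ {w t₁ t₂} → t₁ ⊏ t₂ → G w t₁ → G w t₂) →
      Σ ℕ (λ t₀ → t₀ ⊏ t × fld t₀) →
      (∀ w → ¬ ¬ Σ ℕ λ t′ → t′ ⊏ t × fld t′ × G w t′) →
      ∀ n → ¬ ¬ Σ ℕ λ t* → t* ⊏ t × fld t* × (∀ w → w < n → G w t*)
    ⊏-bound G up (t₀ , p , f) h zero k = k (t₀ , p , f , λ _ ())
    ⊏-bound {t} G up z h (suc n) k = ⊏-bound G up z h n λ (t₁ , p₁ , f₁ , g₁) → h n λ (t₂ , p₂ , f₂ , g₂) →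
        k (pick p₁ f₁ g₁ p₂ f₂ g₂ (⊏-cmp f₁ f₂))
      where
      snoc : ∀ {t*} → (∀ w → w < n → G w t*) → G n t* → ∀ w → w < suc n → G w t*
      snoc g g′ w (s≤s lt) with m≤n⇒m<n∨m≡n lt
      ... | inj₁ lt′ = g w lt′
      ... | inj₂ refl = g′
      pick : ∀ {t₁ t₂} → t₁ ⊏ t → fld t₁ → (∀ w → w < n → G w t₁) → t₂ ⊏ t → fld t₂ → G n t₂ →
             t₁ ⊏ t₂ ⊎ (t₁ ≡ t₂ ⊎ t₂ ⊏ t₁) → Σ ℕ λ t* → t* ⊏ t × fld t* × (∀ w → w < suc n → G w t*)
      pick p₁ f₁ g₁ p₂ f₂ g₂ (inj₁ q) = _ , p₂ , f₂ , snoc (λ w lt → up q (g₁ w lt)) g₂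
      pick p₁ f₁ g₁ p₂ f₂ g₂ (inj₂ (inj₁ refl)) = _ , p₂ , f₂ , snoc g₁ g₂
      pick p₁ f₁ g₁ p₂ f₂ g₂ (inj₂ (inj₂ q)) = _ , p₁ , f₁ , snoc g₁ (up q g₂)

    infix 4 _⋬_
    -- Classically: the order type of `V` is at most ω^`t`.
    _⋬_ : ℕ → Tree → Set
    t ⋬ V = ¬ (Desc t ⋖ V)

    ⋬-mono : ∀ {t t′ V} → t ⊏ t′ → t ⋬ V → t′ ⋬ V
    ⋬-mono p g e = g (⋖-restrict (λ {τ} → Desc-mono p {τ}) e)

    -- Only finitely many children of `V` have heads up to that of the bound `top e`, so a single
    -- `t*` below `t` serves them all. But `Desc t` has infinitely many children of exponent `t*`,
    -- and one of them would be mapped strictly into one child of `V`.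
    ⋬-children : ∀ {V t} → (∀ w τ → V (w ∷ τ) → ¬ ¬ Σ ℕ λ t′ → t′ ⊏ t × fld t′ × t′ ⋬ V / w) → t ⋬ V
    -- The child containing `top e` is occupied; its exponent `t₀` starts the maximum and is the
    -- default for empty children.
    ⋬-children {V} {t} h e = h _ _ (subst V ≡top (top∈ e)) λ (t₀ , p₀ , f₀ , _) →
        ⊏-bound G (λ q g τ v → ⋬-mono q (g τ v)) (t₀ , p₀ , f₀) (G-some (t₀ , p₀ , f₀)) (suc (head₀ (top e)))
          λ (t* , p , f , g) → no-child t* p f g
      where
      G : ℕ → ℕ → Set
      G w t* = ∀ τ → V (w ∷ τ) → t* ⋬ V / w
      ≡top : top e ≡ head₀ (top e) ∷ drop 1 (top e)
      ≡top = ≺-uncons {map e []} (under e {[]} tt)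
      G-some : Σ ℕ (λ t₀ → t₀ ⊏ t × fld t₀) → ∀ w → ¬ ¬ Σ ℕ λ t′ → t′ ⊏ t × fld t′ × G w t′
      -- Whether the child at `w` is occupied is not decided: `t₀` is offered as if it were empty,
      -- and any point of it leads to a second offer with a proper exponent.
      G-some (t₀ , p₀ , f₀) w k = k (t₀ , p₀ , f₀ , λ τ v → ⊥-elim (h w τ v λ (t′ , p , f , g) → k (t′ , p , f , λ _ _ → g)))
      κ∈ : ∀ t* → t* ⊏ t → fld t* → ∀ τ → Desc t* τ → ∀ k → Desc t (letter 0 t* k ∷ τ)
      κ∈ t* p f τ d k rewrite expo-letter 0 t* k = (f , p) , d
      no-child : ∀ t* → t* ⊏ t → fld t* → (∀ w → w < suc (head₀ (top e)) → G w t*) → ⊥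
      no-child t* p f g with ⋖-child e (letter 0 t*) (letter-mono 0 t*) (κ∈ t* p f [] tt)
      ... | i , w , w≤ , (τ , v) , e′ = g w (s≤s w≤) τ v (⋖-restrict (λ {σ} d → κ∈ t* p f σ d i) e′)

    -- The converse estimate: the order type of `U` is at least ω^`t`. The legal exponents of the
    -- finitely many heads up to that of `top e` are bounded by some `t*`. Two of the infinitely
    -- many children of `U` at `t*` land in one child of `Desc t`, which is contained in `Desc t*`,
    -- against the assumption on these children.
    ⋖̸-children : ∀ {U t} → U [] →
      (∀ t* → t* ⊏ t → fld t* → ¬ ¬ Σ ℕ λ s → ∀ k → U (letter s t* k ∷ []) × ¬ (U / letter s t* k ⋖ Desc t*)) →
      ¬ (U ⋖ Desc t)
    ⋖̸-children {U} {t} u[] h e = ⊏-bound G (λ {w} → up {w}) z G-some (suc (head₀ (top e))) λ (t* , p , f , g) →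
        h t* p f λ (s , c) → no-child t* g s c
      where
      G : ℕ → ℕ → Set
      G w t* = fld (expo w) → expo w ⊏ t → expo w ⊏ t* ⊎ expo w ≡ t*
      up : ∀ {w t₁ t₂} → t₁ ⊏ t₂ → G w t₁ → G w t₂
      up q g f p with g f p
      ... | inj₁ r = inj₁ (⊏-trans r q)
      ... | inj₂ r = inj₁ (subst (_⊏ _) (sym r) q)
      ≡top : top e ≡ head₀ (top e) ∷ drop 1 (top e)
      ≡top = ≺-uncons {map e []} (under e u[])
      z : Σ ℕ (λ t₀ → t₀ ⊏ t × fld t₀)
      z with subst (Desc t) ≡top (top∈ e)
      ... | (f , p) , _ = _ , p , f
      G-some : ∀ w → ¬ ¬ Σ ℕ λ t′ → t′ ⊏ t × fld t′ × G w t′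
      G-some w k = k (proj₁ z , proj₁ (proj₂ z) , proj₂ (proj₂ z) , λ f p → ⊥-elim (k (expo w , p , f , λ _ _ → inj₂ refl)))
      no-child : ∀ t* → (∀ w → w < suc (head₀ (top e)) → G w t*) → ∀ s →
        (∀ k → U (letter s t* k ∷ []) × ¬ (U / letter s t* k ⋖ Desc t*)) → ⊥
      no-child t* g s c with ⋖-child e (letter s t*) (letter-mono s t*) (λ k → proj₁ (c k))
      ... | i , w , w≤ , (τ , (f , p) , _) , e′ = proj₂ (c i) (⋖-enlarge (λ {σ} → into* {σ} (g w (s≤s w≤) f p)) e′)
        where into* : ∀ {σ} → expo w ⊏ t* ⊎ expo w ≡ t* → (Desc t / w) σ → Desc t* σ
              into* {σ} (inj₁ q) (_ , d) = Desc-mono q {σ} d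
              into* (inj₂ refl) (_ , d) = d

-- The kernel of a ranked digraph and the two well-orders built from it

module Kernel where

  open Pairing
  open Trees
  open import Data.List using (List; []; _∷_; _∷ʳ_; length; drop)
  open import Data.List.Properties using (length-++)
  open import Induction.WellFounded using (Acc; acc; WellFounded)
  open import Data.Nat.Induction using (<-wellFounded)
  open import Relation.Binary.Definitions using (tri<; tri≈; tri>)

  open _⋖_

  nth : List ℕ → ℕ → ℕ
  nth [] _ = 0
  nth (x ∷ _) zero = x
  nth (_ ∷ xs) (suc i) = nth xs i

  nth-∷ʳ-< : ∀ h w {i} → i < length h → nth (h ∷ʳ w) i ≡ nth h i
  nth-∷ʳ-< (x ∷ h) w {zero} _ = refl
  nth-∷ʳ-< (x ∷ h) w {suc i} (s≤s p) = nth-∷ʳ-< h w p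

  nth-∷ʳ-last : ∀ h w → nth (h ∷ʳ w) (length h) ≡ w
  nth-∷ʳ-last [] w = refl
  nth-∷ʳ-last (x ∷ h) w = nth-∷ʳ-last h w

  length-∷ʳ : ∀ (h : List ℕ) w → length (h ∷ʳ w) ≡ suc (length h)
  length-∷ʳ h w = trans (length-++ h) (+-comm (length h) 1)

  -- `high z` plays (∞, z), above all levels of attacked vertices, and `ω∞` lies above all of these.
  -- `code-high` turns a numerical bound on a code into a bound in the order, by which the image
  -- under an embedding becomes informative.
  record Ranked : Set₁ where
    field
      _⊳_ : ℕ → ℕ → Set
      lev : ℕ → ℕ
      𝓛   : Order
    open Order 𝓛 public
    field
      lev-≤    : ∀ {x y} → x ⊳ y → lev x ⊏ lev y ⊎ lev x ≡ lev y
      lev-<    : ∀ {s x y} → s ⊳ x → x ⊳ y → lev s ⊏ lev y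
      lev-fld  : ∀ {x y} → x ⊳ y → fld (lev y)
      high     : ℕ → ℕ
      ω∞       : ℕ
      lev-high : ∀ {x y} z → x ⊳ y → lev y ⊏ high z
      high-mono : ∀ {z z′} → z < z′ → high z ⊏ high z′
      high-fld : ∀ z → fld (high z)
      high-∞   : ∀ z → high z ⊏ ω∞
      code-high : ∀ {l z} → fld l → l ⊏ ω∞ → l < z → l ⊏ high z

  module KernelOrders (𝓡 : Ranked) where
    open Ranked 𝓡 using (_⊳_; lev; lev-≤; lev-<; lev-fld; high; ω∞; lev-high; high-mono; high-fld; high-∞; code-high; 𝓛)
    module L = Order 𝓛
    E : Order
    E = lexω 𝓛
    open Order E
    open Descending E

    ⊳-wf : WellFounded _⊳_
    ⊳-wf y = go y (L.⊏-wf (lev y))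
      where
      go : ∀ y → Acc L._⊏_ (lev y) → Acc _⊳_ y
      go y (acc rs) = acc λ p → acc λ q → go _ (rs (lev-< q p))

    -- Membership in the kernel refers negatively to itself, so it is defined by recursion on
    -- accessibility and not as an inductive predicate.
    Trᴬ : ∀ y → Acc _⊳_ y → Set
    Trᴬ y (acc rs) = ∀ x (p : x ⊳ y) → ¬ Trᴬ x (rs p)

    Trᴬ-irr : ∀ y a b → Trᴬ y a → Trᴬ y b
    Trᴬ-irr y (acc r) (acc r′) f x p t = f x p (Trᴬ-irr x (r′ p) (r p) t)

    Tr : ℕ → Set
    Tr y = Trᴬ y (⊳-wf y)

    Tr-intro : ∀ {y} → (∀ x → x ⊳ y → ¬ Tr x) → Tr y
    Tr-intro {y} h = lem (⊳-wf y)
      where lem : ∀ a → Trᴬ y a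
            lem (acc rs) x p t = h x p (Trᴬ-irr x _ _ t)

    Tr-elim : ∀ {x y} → Tr y → x ⊳ y → ¬ Tr x
    Tr-elim {x} {y} t p = lem (⊳-wf y) t
      where lem : ∀ a → Trᴬ y a → ¬ Tr x
            lem (acc rs) f t′ = f x p (Trᴬ-irr x _ _ t′)

    ¬Tr-attacked : ∀ {y} → ¬ Tr y → ¬ ¬ Σ ℕ λ x → x ⊳ y × Tr x
    ¬Tr-attacked n k = n (Tr-intro λ x p t → k (x , p , t))

    -- Claim 0 of the strategy tree of (y , x) says that x is the least attacker of y in the kernel;
    -- claim i+1 says that the i-th answer is in the kernel. Refute y x h i d: d refutes claim i.
    Refute : ℕ → ℕ → List ℕ → ℕ → ℕ → Set
    Refute y x h zero d = d ⊳ x ⊎ (d < x × d ⊳ y)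
    Refute y x h (suc i) d = d ⊳ ans (nth h i)

    -- The turn, which is the length of the history, codes a pair of a claim and a possible
    -- refutation of it. Every pair has its turn, and the claim has been made by then, as
    -- `fst n ≤ n`. If the pair is no refutation, any answer is allowed.
    Answer : ℕ → ℕ → List ℕ → ℕ → Set
    Answer y x h w = Refute y x h (fst (length h)) (snd (length h)) → ans w ⊳ snd (length h)

    Strat : ℕ → ℕ → List ℕ → Tree
    Strat y x h [] = ⊤
    Strat y x h (w ∷ τ) = Answer y x h w × Strat y x (h ∷ʳ w) τ

    Play : ℕ → ℕ → List ℕ → ℕ → Tree
    Play y x h t τ = Desc t τ × Strat y x h τ

    start : ℕ → ℕ
    start x = pair (high x) 0

    end : ℕ
    end = pair ω∞ 0

    -- The point `suc y ∷ []` serves as an upper bound of the block of `y`.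
    𝓜 : Tree
    𝓜 [] = ⊤
    𝓜 (y ∷ []) = ⊤
    𝓜 (y ∷ x ∷ τ) = x ⊳ y × Play y x [] (start x) τ

    -- `1 ∷ []` is the added maximum; it makes an embedding of `𝓝` a strict bound for the main part
    -- `Desc end`.
    𝓝 : Tree
    𝓝 [] = ⊤
    𝓝 (0 ∷ τ) = Desc end τ
    𝓝 (1 ∷ []) = ⊤
    𝓝 _ = ⊥

    𝓜-wf : WellFounded (within 𝓜)
    𝓜-wf = within-wf λ y _ _ → within-wf λ x _ _ τ → within-mono (λ { _ (_ , d , _) → d }) (Desc-wf (start x) τ)

    𝓝-wf : WellFounded (within 𝓝)
    𝓝-wf = within-wf λ where
      0 _ _ → Desc-wf end
      1 _ _ → within-wf λ _ _ ()
      (suc (suc _)) _ ()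

    Refute-∷ʳ : ∀ {y x h w i d} → i ≤ length h → Refute y x (h ∷ʳ w) i d → Refute y x h i d
    Refute-∷ʳ {i = zero} _ r = r
    Refute-∷ʳ {h = h} {w} {suc i} p r rewrite nth-∷ʳ-< h w p = r

    ∷ʳ-Refute : ∀ {y x h w i d} → i ≤ length h → Refute y x h i d → Refute y x (h ∷ʳ w) i d
    ∷ʳ-Refute {i = zero} _ r = r
    ∷ʳ-Refute {h = h} {w} {suc i} p r rewrite nth-∷ʳ-< h w p = r

    -- All claims made so far are true: no refutation of any of them is in the kernel.
    Sound : ℕ → ℕ → List ℕ → Set
    Sound y x h = ∀ i → i ≤ length h → ∀ d → Refute y x h i d → ¬ Tr d

    Sound-∷ʳ : ∀ {y x h w} → Sound y x h → Tr (ans w) → Sound y x (h ∷ʳ w)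
    Sound-∷ʳ {y} {x} {h} {w} c t i p d r with m≤n⇒m<n∨m≡n (subst (i ≤_) (length-∷ʳ h w) p)
    ... | inj₁ (s≤s lt) = c i lt d (Refute-∷ʳ {y} {x} {h} lt r)
    ... | inj₂ refl rewrite nth-∷ʳ-last h w = Tr-elim t r

    Sound⇒Tr : ∀ {y x h} → Sound y x h → Tr x
    Sound⇒Tr c = Tr-intro λ d p → c 0 z≤n d (inj₁ p)

    -- A refutation of a true claim is outside the kernel and so has an attacker inside, which is
    -- the answer. If there is nothing to answer, `x` itself is a true claim to add.
    sound-answer : ∀ {y x h} → Sound y x h → ¬ ¬ Σ ℕ λ s →
      (Refute y x h (fst (length h)) (snd (length h)) → s ⊳ snd (length h)) × Tr s
    sound-answer {y} {x} {h} c k = k (x , (λ r → ⊥-elim (¬Tr-attacked (c _ (fst≤ (length h)) _ r)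
      λ (s , p , t) → k (s , (λ _ → p) , t))) , Sound⇒Tr {y} {x} {h} c)

    start⊏end : ∀ x → start x ⊏ end
    start⊏end x = major (subst₂ L._⊏_ (sym (fst-pair (high x) 0)) (sym (fst-pair ω∞ 0)) (high-∞ x))

    start-fld : ∀ x → fld (start x)
    start-fld x rewrite fst-pair (high x) 0 = high-fld x

    start-mono : ∀ {x x′} → x < x′ → start x ⊏ start x′
    start-mono {x} {x′} p = major (subst₂ L._⊏_ (sym (fst-pair (high x) 0)) (sym (fst-pair (high x′) 0)) (high-mono p))

    Play-child : ∀ {y x h t w t* τ} → expo w ≡ t* → fld t* → t* ⊏ t → Answer y x h w →
      Play y x (h ∷ʳ w) t* τ → Play y x h t (w ∷ τ)
    Play-child refl f p a (d , s) = ((f , p) , d) , a , s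

    -- A true answer keeps the history sound and can be combined with every smaller exponent and
    -- every index, so by induction the tree has type at least ω^`t`.
    sound-large : ∀ {y x} t → Acc _⊏_ t → ∀ h → Sound y x h → ¬ (Play y x h t ⋖ Desc t)
    sound-large {y} {x} t (acc rs) h c = ⋖̸-children (tt , tt) λ t* p f k → sound-answer {y} {x} {h} c λ (s , a , tr) →
      k (s , λ j →
        let w = letter s t* j
            a′ = λ r → subst (_⊳ snd (length h)) (sym (ans-letter s t* j)) (a r)
            c′ = Sound-∷ʳ {y} {x} {h} {w} c (subst Tr (sym (ans-letter s t* j)) tr)
        in Play-child {y} {x} {h} {t} {w} {t*} {[]} (expo-letter s t* j) f p a′ (tt , tt) ,
           λ e → sound-large t* (rs p) (h ∷ʳ w) c′
                   (⋖-restrict (λ {τ} → Play-child {y} {x} {h} {t} {w} {t*} {τ} (expo-letter s t* j) f p a′) e))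

    -- Some claim `i` is false, as witnessed by `d` in the kernel, and the turn of this pair is
    -- still to come, in `n` moves. The level `l` exceeds that of every possible answer to `d`.
    record Refuted (y x : ℕ) (h : List ℕ) (l n : ℕ) : Set where
      field
        i d    : ℕ
        i≤     : i ≤ length h
        ≤pair  : length h ≤ pair i d
        refute : Refute y x h i d
        kernel : Tr d
        drops  : ∀ s → s ⊳ d → lev s L.⊏ l
        field-l : L.fld l
        n≡     : n ≡ pair i d ∸ length h

    rank : ℕ → ℕ → ℕ
    rank l n = pair l n

    -- Every move decreases `rank l n`: either the waiting time shrinks, or the answer is a new
    -- false claim of lower level. The bound is therefore independent of the exponent `tM` allowed
    -- to the players.
    refuted-small : ∀ {y x} t → Acc _⊏_ t → ∀ {h l n} tM → Refuted y x h l n → t ≡ rank l n → t ⋬ Play y x h tM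
    refuted-small {y} {x} t (acc rs) {h} {l} {n} tM R refl = ⋬-children child
      where
      open Refuted R
      child : ∀ w τ → Play y x h tM (w ∷ τ) → ¬ ¬ Σ ℕ λ t′ → t′ ⊏ t × fld t′ × t′ ⋬ Play y x h tM / w
      child w τ (_ , a , _) k with m≤n⇒m<n∨m≡n ≤pair
      -- The turn of `d` has not come; the same refutation is one move closer.
      ... | inj₁ lt = k (rank l n′ , lt′ , subst L.fld (sym (fst-pair l n′)) field-l , λ e →
            refuted-small _ (rs lt′) (expo w) R′ refl (⋖-enlarge (λ { (( _ , d′) , _ , s) → d′ , s }) e))
        where
        n′ : ℕ
        n′ = pair i d ∸ suc (length h)
        lt′ : rank l n′ ⊏ rank l n
        lt′ = minor (trans (fst-pair l n′) (sym (fst-pair l n)))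
          (subst₂ _<_ (sym (snd-pair l n′)) (sym (trans (snd-pair l n) n≡)) (≤-reflexive (sym (+-∸-assoc 1 lt))))
        R′ : Refuted y x (h ∷ʳ w) l n′
        R′ = record { i = i ; d = d ; i≤ = subst (i ≤_) (sym (length-∷ʳ h w)) (m≤n⇒m≤1+n i≤)
          ; ≤pair = subst (_≤ pair i d) (sym (length-∷ʳ h w)) lt
          ; refute = ∷ʳ-Refute {y} {x} {h} i≤ refute ; kernel = kernel ; drops = drops ; field-l = field-l
          ; n≡ = cong (pair i d ∸_) (sym (length-∷ʳ h w)) }
      -- The turn has come. The answer attacks `d`, which is in the kernel, so the answer is not,
      -- and some `d′` in the kernel refutes the claim just made, whose number is `suc (length h)`.
      -- The waiting time starts afresh.
      ... | inj₂ eq = ¬Tr-attacked (λ tr → Tr-elim kernel ans⊳ tr) next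
        where
        ans⊳ : ans w ⊳ d
        ans⊳ = subst (ans w ⊳_) snd≡ (a (subst₂ (Refute y x h) (sym fst≡) (sym snd≡) refute))
          where fst≡ : fst (length h) ≡ i
                fst≡ = trans (cong fst eq) (fst-pair i d)
                snd≡ : snd (length h) ≡ d
                snd≡ = trans (cong snd eq) (snd-pair i d)
        next : Σ ℕ (λ d′ → d′ ⊳ ans w × Tr d′) → ⊥
        next (d′ , p , tr) = k (rank l′ n′ , lt′ , subst L.fld (sym (fst-pair l′ n′)) (lev-fld p) , λ e →
            refuted-small _ (rs lt′) (expo w) R′ refl (⋖-enlarge (λ { (( _ , d′) , _ , s) → d′ , s }) e))
          where
          l′ n′ : ℕ
          l′ = lev (ans w)
          n′ = pair (suc (length h)) d′ ∸ length (h ∷ʳ w)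
          lt′ : rank l′ n′ ⊏ rank l n
          lt′ = major (subst₂ L._⊏_ (sym (fst-pair l′ n′)) (sym (fst-pair l n)) (drops (ans w) ans⊳))
          R′ : Refuted y x (h ∷ʳ w) l′ n′
          R′ = record { i = suc (length h) ; d = d′ ; i≤ = ≤-reflexive (sym (length-∷ʳ h w))
            ; ≤pair = ≤-trans (≤-reflexive (length-∷ʳ h w)) (a≤pair _ d′)
            ; refute = subst (λ v → d′ ⊳ ans v) (sym (nth-∷ʳ-last h w)) p
            ; kernel = tr ; drops = λ s q → lev-< q p ; field-l = lev-fld p ; n≡ = refl }

    -- True or false, a claim is worth no more than its exponent, since exponents descend.
    play-bounded : ∀ {y x} t → Acc _⊏_ t → ∀ h → t ⋬ Play y x h t
    play-bounded t (acc rs) h = ⋬-children λ { w τ (((f , p) , _) , _) k → k (expo w , p , f , λ e →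
      play-bounded (expo w) (rs p) (h ∷ʳ w) (⋖-enlarge (λ { (( _ , d) , _ , s) → d , s }) e)) }

    Least : ℕ → ℕ → Set
    Least y x = x ⊳ y × Sound y x []

    Least-unique : ∀ {y x x′} → Least y x → Least y x′ → x ≡ x′
    Least-unique {y} {x} {x′} (p , s) (p′ , s′) with <-cmp x x′
    ... | tri< lt _ _ = ⊥-elim (s′ 0 z≤n x (inj₂ (lt , p)) (Sound⇒Tr {y} {x} {[]} s))
    ... | tri≈ _ e _ = e
    ... | tri> _ _ lt = ⊥-elim (s 0 z≤n x′ (inj₂ (lt , p′)) (Sound⇒Tr {y} {x′} {[]} s′))

    -- Attackers of a refutation of the initial claim have levels below `lev y`, and `high z`
    -- exceeds `lev y` for every `z`, even for 0. As unsoundness yields no witness, soundness is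
    -- derived from the assumed map: each refutation in the kernel would exclude it.
    ¬Sound-small : ∀ {y x} z → x ⊳ y → ¬ Sound y x [] → start z ⋬ Play y x [] (start x)
    ¬Sound-small {y} {x} z p ns e = ns refuted
      where
      refuted : Sound y x []
      refuted zero _ d r tr = ⋬-mono lt (refuted-small _ (⊏-wf _) (start x) R refl) e
        where
        n = pair 0 d ∸ 0
        lt : rank (lev y) n ⊏ start z
        lt = major (subst₂ L._⊏_ (sym (fst-pair (lev y) n)) (sym (fst-pair (high z) 0)) (lev-high z p))
        lev-x : ∀ {s} → s ⊳ d → (d ⊳ x ⊎ (d < x × d ⊳ y)) → lev s L.⊏ lev y
        lev-x q (inj₂ (_ , q′)) = lev-< q q′
        lev-x {s} q (inj₁ q′) with lev-≤ p
        ... | inj₁ lt = L.⊏-trans (lev-< q q′) lt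
        ... | inj₂ e = subst (lev s L.⊏_) e (lev-< q q′)
        R : Refuted y x [] (lev y) n
        R = record { i = 0 ; d = d ; i≤ = z≤n ; ≤pair = z≤n ; refute = r ; kernel = tr
          ; drops = λ s q → lev-x q r ; field-l = lev-fld p ; n≡ = refl }
      refuted (suc _) ()

    -- All blocks over `y` are small except that of the least attacker in the kernel, which is
    -- bounded by its own starting exponent. The successor leaves the strict room that `⋬-children`
    -- requires.
    vertex-bounded : ∀ y → ¬ ¬ Σ ℕ λ z → start z ⋬ 𝓜 / y
    vertex-bounded y k = some-least λ (x₀ , h) → k (suc x₀ , ⋬-children λ { x τ (p , _) k′ →
        h x p λ g → k′ (start x₀ , start-mono ≤-refl , start-fld x₀ , λ e → g (⋖-enlarge proj₂ e)) })
      where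
      Bounds : ℕ → Set
      Bounds x₀ = ∀ x → x ⊳ y → ¬ ¬ (start x₀ ⋬ Play y x [] (start x))
      some-least : ¬ ¬ Σ ℕ Bounds
      -- The bound 0 is tried first. If it fails at `x`, then `x` is the least attacker, and as a
      -- bound it can fail at no `x′`: such an `x′` would be least too, hence equal to `x`.
      some-least k = k (0 , λ x p n → n (¬Sound-small 0 p λ s → k (x , λ x′ p′ n′ → n′
        (¬Sound-small x p′ λ s′ → n′ (subst (λ v → start x ⋬ Play y v [] (start v)) (Least-unique (p , s) (p′ , s′))
          (play-bounded (start x) (⊏-wf _) []))))))

    ¬𝓝⋖𝓜 : end ⋬ 𝓜
    ¬𝓝⋖𝓜 = ⋬-children λ { y τ v k → vertex-bounded y λ (z , g) → k (start z , start⊏end z , start-fld z , g) }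

    record Embeds (U V : Tree) : Set where
      field
        f    : List ℕ → List ℕ
        f∈   : ∀ {τ} → U τ → V (f τ)
        f-mono : ∀ {τ τ′} → U τ → U τ′ → τ ≺ τ′ → f τ ≺ f τ′

    no-embedding : ¬ Embeds 𝓝 𝓜
    no-embedding e = ¬𝓝⋖𝓜 (record
      { map = λ τ → f (0 ∷ τ) ; into = f∈ ; mono = λ u u′ p → f-mono u u′ (inj₂ (refl , p))
      ; top = f (1 ∷ []) ; top∈ = f∈ {1 ∷ []} tt ; under = λ u → f-mono u tt (inj₁ ≤-refl) })
      where open Embeds e

    module Modulus (e : Embeds 𝓜 𝓝) where
      open Embeds e

      -- The image of `suc y ∷ []` is a 0 followed by a descending sequence and lies above the image
      -- of the block of `y`; the first letter of that sequence bounds those of the whole image.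
      modulus : ℕ → ℕ
      modulus y = head₀ (drop 1 (f (suc y ∷ [])))

      -- A neighbour on each side excludes the least point `[]` and the greatest point `1 ∷ []`.
      𝓝-inner : ∀ {a b c} → 𝓝 a → 𝓝 b → 𝓝 c → c ≺ a → a ≺ b → a ≡ 0 ∷ drop 1 a × Desc end (drop 1 a)
      𝓝-inner {zero ∷ a} u v w p q = refl , u
      𝓝-inner {suc zero ∷ []} {zero ∷ b} u v w p (inj₁ ())
      𝓝-inner {suc zero ∷ []} {suc zero ∷ []} u v w p (inj₁ (s≤s ()))
      𝓝-inner {suc zero ∷ []} {suc zero ∷ []} u v w p (inj₂ (_ , ()))
      𝓝-inner {suc zero ∷ []} {suc zero ∷ _ ∷ _} u () w p q
      𝓝-inner {suc (suc _) ∷ _} ()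

      ⊏end : ∀ {t} → t ⊏ end → fst t L.⊏ ω∞
      ⊏end {t} (major q) = subst (fst t L.⊏_) (fst-pair ω∞ 0) q
      ⊏end {t} (minor _ q) = ⊥-elim (n≮0 (subst (snd t <_) (snd-pair ω∞ 0) q))

      -- An exponent is at most the letter carrying it, so `code-high` applies to the first letter;
      -- the later exponents are smaller anyway.
      Desc-start : ∀ {z x} → Desc end z → head₀ z < x → Desc (start x) z
      Desc-start {[]} _ _ = tt
      Desc-start {w ∷ z} {x} ((f , p) , d) lt = (f , major (subst (L._⊏_ (fst (expo w))) (sym (fst-pair (high x) 0))
          (code-high f (⊏end {expo w} p) (≤-<-trans (≤-trans (fst≤ (expo w)) (expo≤ w)) lt)))) , d

      -- For a larger `x` the embedding would map the strategy tree of the true claim strictly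
      -- inside `Desc (start x)`, against `sound-large`.
      Least-≤-modulus : ∀ {y x} → Least y x → x ≤ modulus y
      Least-≤-modulus {y} {x} (p , s) = ≮⇒≥ λ lt → sound-large (start x) (⊏-wf _) [] s (inside lt)
        where
        Y : List ℕ
        Y = suc y ∷ []
        nxt : ∀ τ → y ∷ τ ≺ Y
        nxt τ = inj₁ ≤-refl
        outer : f Y ≡ 0 ∷ drop 1 (f Y) × Desc end (drop 1 (f Y))
        outer = 𝓝-inner {f Y} {f (suc (suc y) ∷ [])} {f []} (f∈ {Y} tt) (f∈ {suc (suc y) ∷ []} tt) (f∈ {[]} tt)
                  (f-mono {[]} {Y} tt tt tt) (f-mono {Y} {suc (suc y) ∷ []} tt tt (inj₁ ≤-refl))
        module _ {τ} (u : Play y x [] (start x) τ) where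
          inner : f (y ∷ x ∷ τ) ≡ 0 ∷ drop 1 (f (y ∷ x ∷ τ)) × Desc end (drop 1 (f (y ∷ x ∷ τ)))
          inner = 𝓝-inner {f (y ∷ x ∷ τ)} {f Y} {f []} (f∈ (p , u)) (f∈ {Y} tt) (f∈ {[]} tt)
                    (f-mono {[]} {y ∷ x ∷ τ} tt (p , u) tt) (f-mono {y ∷ x ∷ τ} {Y} (p , u) tt (nxt (x ∷ τ)))
          inner< : drop 1 (f (y ∷ x ∷ τ)) ≺ drop 1 (f Y)
          inner< = ≺-tail (subst₂ _≺_ (proj₁ inner) (proj₁ outer) (f-mono {y ∷ x ∷ τ} {Y} (p , u) tt (nxt (x ∷ τ))))
        inside : modulus y < x → Play y x [] (start x) ⋖ Desc (start x)
        inside lt .map τ = drop 1 (f (y ∷ x ∷ τ))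
        inside lt .into {τ} u = Desc-start (proj₂ (inner u)) (≤-<-trans (head₀-mono {drop 1 (f (y ∷ x ∷ τ))} (inner< u)) lt)
        inside lt .mono u u′ q = ≺-tail (subst₂ _≺_ (proj₁ (inner u)) (proj₁ (inner u′))
          (f-mono (p , u) (p , u′) (inj₂ (refl , inj₂ (refl , q)))))
        inside lt .top = drop 1 (f Y)
        inside lt .top∈ = Desc-start (proj₂ outer) lt
        inside lt .under = inner<

      least-attacker : ∀ {y} x → Acc _<_ x → x ⊳ y → Tr x → ¬ ¬ Σ ℕ (Least y)
      least-attacker {y} x (acc rs) p t k = k (x , p , sound)
        where
        sound : Sound y x []
        sound zero _ d (inj₁ q) tr = Tr-elim t q tr
        sound zero _ d (inj₂ (lt , q)) tr = least-attacker d (rs lt) q tr k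

      attacked-below-modulus : ∀ {y x} → x ⊳ y → Tr x → ¬ ¬ Σ ℕ λ x₀ → x₀ ≤ modulus y × x₀ ⊳ y × Tr x₀
      attacked-below-modulus {y} {x} p t k = least-attacker x (<-wellFounded x) p t λ (x₀ , l) →
        k (x₀ , Least-≤-modulus l , proj₁ l , Sound⇒Tr {y} {x₀} {[]} (proj₂ l))

-- Codes of finite lists and Boolean tests on them

module Codes where

  open Pairing
  open Prog
  open Trees
  open Kernel using (nth)
  open import Data.Bool.Properties using (T-∧; T-∨)
  open import Data.Vec as Vec using ([]; _∷_)
  open import Data.List using (List; []; _∷_; length)
  open import Function.Bundles using (Equivalence)
  open Equivalence

  ∧-intro : ∀ {a b} → T a → T b → T (a ∧ b)
  ∧-intro p q = from T-∧ (p , q)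

  ∧-elim : ∀ {a b} → T (a ∧ b) → T a × T b
  ∧-elim = to T-∧

  ∨-elim : ∀ {a b} → T (a ∨ b) → T a ⊎ T b
  ∨-elim = to T-∨

  ∨-introˡ : ∀ {a b} → T a → T (a ∨ b)
  ∨-introˡ p = from T-∨ (inj₁ p)

  ∨-introʳ : ∀ {a b} → T b → T (a ∨ b)
  ∨-introʳ {a} p = from (T-∨ {a}) (inj₂ p)

  not-intro : ∀ {a} → ¬ T a → T (not a)
  not-intro {true} h = h tt
  not-intro {false} h = tt

  not-elim : ∀ {a} → T (not a) → ¬ T a
  not-elim {false} _ ()

  T-dec : ∀ a → T a ⊎ ¬ T a
  T-dec true = inj₁ tt
  T-dec false = inj₂ λ ()

  allᵇ-elim : ∀ {n p} → T (allᵇ n p) → ∀ {k} → k < n → T (p k)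
  allᵇ-elim {suc n} h {k} (s≤s lt) with m≤n⇒m<n∨m≡n lt
  ... | inj₁ lt′ = allᵇ-elim (proj₁ (∧-elim h)) lt′
  ... | inj₂ refl = proj₂ (∧-elim {allᵇ n _} h)

  allᵇ-intro : ∀ {n p} → (∀ k → k < n → T (p k)) → T (allᵇ n p)
  allᵇ-intro {zero} h = tt
  allᵇ-intro {suc n} h = ∧-intro (allᵇ-intro λ k lt → h k (m≤n⇒m≤1+n lt)) (h n ≤-refl)

  anyᵇ-elim : ∀ {n p} → T (anyᵇ n p) → Σ ℕ λ k → k < n × T (p k)
  anyᵇ-elim {suc n} {p} h with ∨-elim {anyᵇ n p} h
  ... | inj₂ q = n , ≤-refl , q
  ... | inj₁ q with anyᵇ-elim {n} q
  ...   | k , lt , r = k , m≤n⇒m≤1+n lt , r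

  anyᵇ-intro : ∀ {n p} k → k < n → T (p k) → T (anyᵇ n p)
  anyᵇ-intro {suc n} {p} k (s≤s lt) h with m≤n⇒m<n∨m≡n lt
  ... | inj₁ lt′ = ∨-introˡ (anyᵇ-intro k lt′ h)
  ... | inj₂ refl = ∨-introʳ {anyᵇ n p} h

  hd tl : ℕ → ℕ
  hd c = fst (pred c)
  tl c = snd (pred c)

  cons : ℕ → ℕ → ℕ
  cons a c = suc (pair a c)

  hd-cons : ∀ a c → hd (cons a c) ≡ a
  hd-cons = fst-pair

  tl-cons : ∀ a c → tl (cons a c) ≡ c
  tl-cons = snd-pair

  dropᶜ : ℕ → ℕ → ℕ
  dropᶜ j c = natrec c (λ _ → tl) j

  -- 0 beyond the end of the list, and the successor of the entry otherwise.
  at : ℕ → ℕ → ℕ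
  at c j = if pos (dropᶜ j c) then suc (hd (dropᶜ j c)) else 0

  enc : List ℕ → ℕ
  enc [] = 0
  enc (x ∷ l) = cons x (enc l)

  decᶠ : ℕ → ℕ → List ℕ
  decᶠ zero _ = []
  decᶠ (suc n) zero = []
  decᶠ (suc n) (suc m) = fst m ∷ decᶠ n (snd m)

  dec : ℕ → List ℕ
  dec c = decᶠ c c

  decᶠ-irr : ∀ {n n′ c} → c ≤ n → c ≤ n′ → decᶠ n c ≡ decᶠ n′ c
  decᶠ-irr {zero} {zero} z≤n z≤n = refl
  decᶠ-irr {zero} {suc n′} z≤n z≤n = refl
  decᶠ-irr {suc n} {zero} z≤n z≤n = refl
  decᶠ-irr {suc n} {suc n′} {zero} p q = refl
  decᶠ-irr {suc n} {suc n′} {suc m} (s≤s p) (s≤s q) =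
    cong (fst m ∷_) (decᶠ-irr (≤-trans (snd≤ m) p) (≤-trans (snd≤ m) q))

  dec-suc : ∀ m → dec (suc m) ≡ fst m ∷ dec (snd m)
  dec-suc m = cong (fst m ∷_) (decᶠ-irr (snd≤ m) ≤-refl)

  dec-cons : ∀ a c → dec (cons a c) ≡ a ∷ dec c
  dec-cons a c = trans (dec-suc (pair a c)) (cong₂ (λ x y → x ∷ dec y) (fst-pair a c) (snd-pair a c))

  dec-enc : ∀ l → dec (enc l) ≡ l
  dec-enc [] = refl
  dec-enc (x ∷ l) = trans (dec-cons x (enc l)) (cong (x ∷_) (dec-enc l))

  enc-decᶠ : ∀ n c → c ≤ n → enc (decᶠ n c) ≡ c
  enc-decᶠ zero zero _ = refl
  enc-decᶠ (suc n) zero _ = refl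
  enc-decᶠ (suc n) (suc m) (s≤s p) = cong suc (trans (cong (pair (fst m)) (enc-decᶠ n (snd m) (≤-trans (snd≤ m) p))) (pair-unpair m))

  enc-dec : ∀ c → enc (dec c) ≡ c
  enc-dec c = enc-decᶠ c c ≤-refl

  length≤enc : ∀ l → length l ≤ enc l
  length≤enc [] = z≤n
  length≤enc (x ∷ l) = s≤s (≤-trans (length≤enc l) (b≤pair x (enc l)))

  length-dec : ∀ c → length (dec c) ≤ c
  length-dec c = subst (length (dec c) ≤_) (enc-dec c) (length≤enc (dec c))

  _‼_ : List ℕ → ℕ → ℕ
  [] ‼ _ = 0
  (x ∷ _) ‼ zero = suc x
  (_ ∷ l) ‼ suc j = l ‼ j

  natrec-shift : ∀ j c → natrec c (λ _ → tl) (suc j) ≡ natrec (tl c) (λ _ → tl) j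
  natrec-shift zero c = refl
  natrec-shift (suc j) c = cong tl (natrec-shift j c)

  at-shift : ∀ c j → at c (suc j) ≡ at (tl c) j
  at-shift c j = cong (λ d → if pos d then suc (hd d) else 0) (natrec-shift j c)

  at-enc : ∀ l j → at (enc l) j ≡ l ‼ j
  at-enc [] zero = refl
  at-enc [] (suc j) = trans (at-shift 0 j) (at-enc [] j)
  at-enc (x ∷ l) zero = cong suc (hd-cons x (enc l))
  at-enc (x ∷ l) (suc j) = trans (at-shift (enc (x ∷ l)) j) (trans (cong (λ c → at c j) (tl-cons x (enc l))) (at-enc l j))

  at-dec : ∀ c j → at c j ≡ dec c ‼ j
  at-dec c j = trans (cong (λ d → at d j) (sym (enc-dec c))) (at-enc (dec c) j)

  pred-‼ : ∀ l j → pred (l ‼ j) ≡ nth l j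
  pred-‼ [] j = refl
  pred-‼ (x ∷ l) zero = refl
  pred-‼ (x ∷ l) (suc j) = pred-‼ l j

  ‼-pos : ∀ l j → T (pos (l ‼ j)) → j < length l
  ‼-pos (x ∷ l) zero _ = z<s
  ‼-pos (x ∷ l) (suc j) h = s<s (‼-pos l j h)

  pos-‼ : ∀ l j → j < length l → T (pos (l ‼ j))
  pos-‼ (x ∷ l) zero _ = tt
  pos-‼ (x ∷ l) (suc j) (s≤s h) = pos-‼ l j h

  nthᶜ : ℕ → ℕ → ℕ
  nthᶜ c j = pred (at c j)

  nthᶜ-dec : ∀ c j → nthᶜ c j ≡ nth (dec c) j
  nthᶜ-dec c j = trans (cong pred (at-dec c j)) (pred-‼ (dec c) j)

  -- A list is no longer than its code, so `c` bounds its positions; those beyond the end are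
  -- skipped.
  everyᵇ : ℕ → (ℕ → Bool) → Bool
  everyᵇ c q = allᵇ c (λ j → not (pos (at c j)) ∨ q j)

  everyᵇ-elim : ∀ c q → T (everyᵇ c q) → ∀ j → j < length (dec c) → T (q j)
  everyᵇ-elim c q h j lt with ∨-elim {not (pos (at c j))} (allᵇ-elim {c} h (≤-trans lt (length-dec c)))
  ... | inj₂ p = p
  ... | inj₁ p = ⊥-elim (not-elim p (subst (λ a → T (pos a)) (sym (at-dec c j)) (pos-‼ (dec c) j lt)))

  everyᵇ-intro : ∀ c q → (∀ j → j < length (dec c) → T (q j)) → T (everyᵇ c q)
  everyᵇ-intro c q h = allᵇ-intro {c} λ j _ → step j (T-dec (pos (at c j)))
    where
    step : ∀ j → T (pos (at c j)) ⊎ ¬ T (pos (at c j)) → T (not (pos (at c j)) ∨ q j)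
    step j (inj₁ p) = ∨-introʳ {not (pos (at c j))} (h j (‼-pos (dec c) j (subst (λ a → T (pos a)) (at-dec c j) p)))
    step j (inj₂ p) = ∨-introˡ (not-intro p)

  -- As `at` is 0 exactly beyond the end, comparing entries at the first difference also puts a
  -- proper prefix first.
  lexᵇ : ℕ → ℕ → Bool
  lexᵇ c d = anyᵇ d λ j → allᵇ j (λ i → at c i ≡ᵇ at d i) ∧ (at c j <ᵇ at d j)

  lexᵇ⇒≺ : ∀ c d → T (lexᵇ c d) → dec c ≺ dec d
  lexᵇ⇒≺ c d h with anyᵇ-elim {d} h
  ... | j , _ , q with ∧-elim {allᵇ j _} q
  ...   | e , lt = go (dec c) (dec d) j (λ i p → trans (sym (at-dec c i)) (trans (≡ᵇ⇒≡ _ _ (allᵇ-elim {j} e p)) (at-dec d i)))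
                     (subst₂ _<_ (at-dec c j) (at-dec d j) (<ᵇ⇒< _ _ lt))
    where
    go : ∀ l l′ j → (∀ i → i < j → l ‼ i ≡ l′ ‼ i) → l ‼ j < l′ ‼ j → l ≺ l′
    go [] (_ ∷ _) j e lt = tt
    go (x ∷ l) (y ∷ l′) zero e (s≤s lt) = inj₁ lt
    go (x ∷ l) (y ∷ l′) (suc j) e lt = inj₂ (suc-injective (e 0 z<s) , go l l′ j (λ i p → e (suc i) (s<s p)) lt)
    go [] [] j e ()
    go (_ ∷ _) [] zero e ()
    go (_ ∷ _) [] (suc _) e ()

  ≺⇒lexᵇ : ∀ c d → dec c ≺ dec d → T (lexᵇ c d)
  ≺⇒lexᵇ c d h with go (dec c) (dec d) h
    where
    go : ∀ l l′ → l ≺ l′ → Σ ℕ λ j → j < length l′ × (∀ i → i < j → l ‼ i ≡ l′ ‼ i) × l ‼ j < l′ ‼ j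
    go [] (_ ∷ _) _ = 0 , z<s , (λ _ ()) , z<s
    go (x ∷ l) (y ∷ l′) (inj₁ p) = 0 , z<s , (λ _ ()) , s<s p
    go (x ∷ l) (.x ∷ l′) (inj₂ (refl , p)) with go l l′ p
    ... | j , b , e , lt = suc j , s<s b , (λ { zero _ → refl ; (suc i) (s≤s q) → e i q }) , lt
  ... | j , b , e , lt = anyᵇ-intro {d} j (≤-trans b (length-dec d)) (∧-intro
      (allᵇ-intro {j} λ i p → ≡⇒≡ᵇ _ _ (trans (at-dec c i) (trans (e i p) (sym (at-dec d i)))))
      (<⇒<ᵇ (subst₂ _<_ (sym (at-dec c j)) (sym (at-dec d j)) lt)))

  hdᵗ tlᵗ : ∀ {n} → Tm n nat → Tm n nat
  hdᵗ t = fstᵗ (predᵗ t)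
  tlᵗ t = sndᵗ (predᵗ t)

  consᵗ atᵗ nthᵗ : ∀ {n} → Tm n nat → Tm n nat → Tm n nat
  consᵗ a c = suc′ (pairᵗ a c)
  atᵗ c j = prim (prim₂ (app (if′ (pos′ v0) (suc′ (hdᵗ v0)) (lit 0)) (rec v1 v0 (tlᵗ v1) ∷ [])) at λ f x y → refl) (c ∷ j ∷ [])
  nthᵗ c j = predᵗ (atᵗ c j)

  lexᵗ : ∀ {n} → Tm n nat → Tm n nat → Tm n bool
  lexᵗ c d = prim (prim₂ (any′ v1 (all′ v0 (atᵗ v2 v0 ≟ᵗ atᵗ v3 v0) ∧′ (atᵗ v1 v0 <ᵗ atᵗ v2 v0))) lexᵇ λ f x y → refl) (c ∷ d ∷ [])

-- The well-order of levels over `L`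

module Orders where

  open Pairing
  open Prog
  open Trees
  open Kernel
  open Codes
  open import Data.Vec as Vec using ([]; _∷_)
  open import Data.List using ([]; _∷_)
  open import Induction.WellFounded using (Acc; acc; WellFounded)
  open import Relation.Nullary using (yes; no)

  -- Codes of levels: 0 and 1 are two elements ∞ < ∞∞ on top of L, and 2 + a stands for a ∈ L.
  ltᴸ ltᴮ lt¹ lt² lt³ : Baire → ℕ → ℕ → Bool
  ltᴸ f a b = (left f (pair a b) ≡ᵇ 1) ∧ not (a ≡ᵇ b)
  ltᴮ f a b = ((b ≡ᵇ 1) ∧ not (a ≡ᵇ 1)) ∨ (((b ≡ᵇ 0) ∧ (1 <ᵇ a)) ∨ ((1 <ᵇ a) ∧ ((1 <ᵇ b) ∧ ltᴸ f (a ∸ 2) (b ∸ 2))))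

  lexᴮ : (ℕ → ℕ → Bool) → ℕ → ℕ → Bool
  lexᴮ lt a b = lt (fst a) (fst b) ∨ ((fst a ≡ᵇ fst b) ∧ (snd a <ᵇ snd b))

  lt¹ f = lexᴮ (ltᴮ f)
  lt² f = lexᴮ (lt¹ f)
  lt³ f = lexᴮ (lt² f)

  fldᴸ fldᴮ : Baire → ℕ → Bool
  fldᴸ f a = left f (pair a a) ≡ᵇ 1
  fldᴮ f a = (a <ᵇ 2) ∨ fldᴸ f (a ∸ 2)

  orcLᵗ : ∀ {n} → Tm n nat → Tm n nat → Tm n nat
  orcLᵗ a b = app (orc (v0 +ᵗ v0)) (pairᵗ a b ∷ [])

  ltᴸᵗ ltᴮᵗ lt³ᵗ : ∀ {n} → Tm n nat → Tm n nat → Tm n bool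
  ltᴸᵗ a b = app ((orcLᵗ v0 v1 ≟ᵗ lit 1) ∧′ not′ (v0 ≟ᵗ v1)) (a ∷ b ∷ [])
  ltᴮᵗ a b = app (((v1 ≟ᵗ lit 1) ∧′ not′ (v0 ≟ᵗ lit 1)) ∨′ ((v1 ≟ᵗ lit 0) ∧′ (lit 1 <ᵗ v0)) ∨′
    ((lit 1 <ᵗ v0) ∧′ (lit 1 <ᵗ v1) ∧′ ltᴸᵗ (v0 ∸ᵗ lit 2) (v1 ∸ᵗ lit 2))) (a ∷ b ∷ [])

  lexᴮᵗ : Tm 2 bool → Tm 2 bool
  lexᴮᵗ t = app t (fstᵗ v0 ∷ fstᵗ v1 ∷ []) ∨′ ((fstᵗ v0 ≟ᵗ fstᵗ v1) ∧′ (sndᵗ v0 <ᵗ sndᵗ v1))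

  lt³ᵗ a b = app (lexᴮᵗ (lexᴮᵗ (lexᴮᵗ (ltᴮᵗ v0 v1)))) (a ∷ b ∷ [])

  fldᴸᵗ fldᴮᵗ : ∀ {n} → Tm n nat → Tm n bool
  fldᴸᵗ a = app (orcLᵗ v0 v0 ≟ᵗ lit 1) (a ∷ [])
  fldᴮᵗ a = app ((v0 <ᵗ lit 2) ∨′ fldᴸᵗ (v0 ∸ᵗ lit 2)) (a ∷ [])

  lt³ᵗ-ok : ∀ f a b → ⟦ lt³ᵗ v0 v1 ⟧ f (a ∷ b ∷ []) ≡ lt³ f a b
  lt³ᵗ-ok f a b = refl

  lexᴮ-sound : ∀ {lt} (O : Order) → (∀ {a b} → T (lt a b) → Order._⊏_ O a b) →
    ∀ {a b} → T (lexᴮ lt a b) → Order._⊏_ (lexω O) a b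
  lexᴮ-sound {lt} O sound {a} {b} h with ∨-elim {lt (fst a) (fst b)} h
  ... | inj₁ p = major (sound p)
  ... | inj₂ p = minor (≡ᵇ⇒≡ _ _ (proj₁ (∧-elim p))) (<ᵇ⇒< _ _ (proj₂ (∧-elim {fst a ≡ᵇ fst b} p)))

  lexᴮ-complete : ∀ {lt} (O : Order) → (∀ {a b} → Order._⊏_ O a b → T (lt a b)) →
    ∀ {a b} → Order._⊏_ (lexω O) a b → T (lexᴮ lt a b)
  lexᴮ-complete O complete (major p) = ∨-introˡ (complete p)
  lexᴮ-complete {lt} O complete {a} {b} (minor e p) =
    ∨-introʳ {lt (fst a) (fst b)} (∧-intro (≡⇒≡ᵇ _ _ e) (<⇒<ᵇ p))

  opaque
    triple : ℕ → ℕ → ℕ → ℕ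
    triple a m k = pair (pair a m) k

    triple-def : ∀ a m k → triple a m k ≡ pair (pair a m) k
    triple-def a m k = refl

  module LevelOrder (f : Baire) (W : IsWellOrder (left f)) where

    r : Baire
    r = left f
    open IsLinOrder (proj₁ W) renaming (trans to ≤-transᴸ)

    ltᴸ-sound : ∀ {a b} → T (ltᴸ f a b) → a <[ r ] b
    ltᴸ-sound {a} {b} h = ≡ᵇ⇒≡ _ _ (proj₁ (∧-elim h)) ,
      λ e → not-elim (proj₂ (∧-elim {r (pair a b) ≡ᵇ 1} h)) (≡⇒≡ᵇ _ _ e)

    ltᴸ-complete : ∀ {a b} → a <[ r ] b → T (ltᴸ f a b)
    ltᴸ-complete (p , ne) = ∧-intro (≡⇒≡ᵇ _ _ p) (not-intro λ h → ne (≡ᵇ⇒≡ _ _ h))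

    <-transᴸ : ∀ {a b c} → a <[ r ] b → b <[ r ] c → a <[ r ] c
    <-transᴸ {a} {b} {c} (p , n) (q , n′) = ≤-transᴸ a b c p q , λ { refl → n (antisym a b p q) }

    data _<₀_ : ℕ → ℕ → Set where
      to∞∞ : ∀ {a} → a ≢ 1 → a <₀ 1
      to∞  : ∀ {a} → (2 + a) <₀ 0
      in-L : ∀ {a b} → a <[ r ] b → (2 + a) <₀ (2 + b)

    fld₀ : ℕ → Set
    fld₀ 0 = ⊤
    fld₀ 1 = ⊤
    fld₀ (suc (suc a)) = Field r a

    <₀-trans : ∀ {a b c} → a <₀ b → b <₀ c → a <₀ c
    <₀-trans (to∞∞ _) (to∞∞ n) = ⊥-elim (n refl)
    <₀-trans to∞ (to∞∞ _) = to∞∞ λ ()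
    <₀-trans (in-L _) (to∞∞ _) = to∞∞ λ ()
    <₀-trans (in-L _) to∞ = to∞
    <₀-trans (in-L {a} {b} p) (in-L {b = c} q) = in-L (<-transᴸ {a} {b} {c} p q)

    <₀-cmp : ∀ {a b} → fld₀ a → fld₀ b → a <₀ b ⊎ (a ≡ b ⊎ b <₀ a)
    <₀-cmp {0} {0} _ _ = inj₂ (inj₁ refl)
    <₀-cmp {0} {1} _ _ = inj₁ (to∞∞ λ ())
    <₀-cmp {0} {suc (suc b)} _ _ = inj₂ (inj₂ to∞)
    <₀-cmp {1} {0} _ _ = inj₂ (inj₂ (to∞∞ λ ()))
    <₀-cmp {1} {1} _ _ = inj₂ (inj₁ refl)
    <₀-cmp {1} {suc (suc b)} _ _ = inj₂ (inj₂ (to∞∞ λ ()))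
    <₀-cmp {suc (suc a)} {0} _ _ = inj₁ to∞
    <₀-cmp {suc (suc a)} {1} _ _ = inj₁ (to∞∞ λ ())
    <₀-cmp {suc (suc a)} {suc (suc b)} p q with a ≟ b
    ... | yes refl = inj₂ (inj₁ refl)
    ... | no ne with total a b p q
    ...   | inj₁ l = inj₁ (in-L (l , ne))
    ...   | inj₂ l = inj₂ (inj₂ (in-L (l , λ e → ne (sym e))))

    <₀-wf : WellFounded _<₀_
    <₀-wf 1 = acc λ
      { {0} _ → acc₀
      ; {1} (to∞∞ n) → ⊥-elim (n refl)
      ; {suc (suc a)} _ → accᴸ (proj₂ W a) }
      where
      accᴸ : ∀ {a} → Acc (λ a b → a <[ r ] b) a → Acc _<₀_ (2 + a)
      accᴸ (acc rs) = acc λ { (in-L p) → accᴸ (rs p) }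
      acc₀ : Acc _<₀_ 0
      acc₀ = acc λ { to∞ → accᴸ (proj₂ W _) }
    <₀-wf 0 with <₀-wf 1
    ... | acc rs = rs (to∞∞ λ ())
    <₀-wf (suc (suc a)) with <₀-wf 1
    ... | acc rs = rs (to∞∞ λ ())

    O₀ 𝓛 : Order
    O₀ = record { _⊏_ = _<₀_ ; fld = fld₀ ; ⊏-trans = <₀-trans ; ⊏-cmp = <₀-cmp ; ⊏-wf = <₀-wf }
    𝓛 = lexω (lexω O₀)

    ltᴮ-sound : ∀ {a b} → T (ltᴮ f a b) → a <₀ b
    ltᴮ-sound {0} {1} _ = to∞∞ λ ()
    ltᴮ-sound {suc (suc a)} {1} _ = to∞∞ λ ()
    ltᴮ-sound {suc (suc a)} {0} _ = to∞
    ltᴮ-sound {suc (suc a)} {suc (suc b)} h = in-L (ltᴸ-sound h)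

    ltᴮ-complete : ∀ {a b} → a <₀ b → T (ltᴮ f a b)
    ltᴮ-complete {0} (to∞∞ _) = tt
    ltᴮ-complete {1} (to∞∞ n) = ⊥-elim (n refl)
    ltᴮ-complete {suc (suc a)} (to∞∞ _) = tt
    ltᴮ-complete to∞ = tt
    ltᴮ-complete (in-L p) = ltᴸ-complete p

    lt³-sound : ∀ {a b} → T (lt³ f a b) → Order._⊏_ (lexω 𝓛) a b
    lt³-sound {a} {b} = lexᴮ-sound {lt² f} 𝓛 (λ {a} {b} → lexᴮ-sound {lt¹ f} (lexω O₀) (λ {a} {b} → lexᴮ-sound {ltᴮ f} O₀ ltᴮ-sound {a} {b}) {a} {b}) {a} {b}

    lt³-complete : ∀ {a b} → Order._⊏_ (lexω 𝓛) a b → T (lt³ f a b)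
    lt³-complete {a} {b} = lexᴮ-complete {lt² f} 𝓛 (λ {a} {b} → lexᴮ-complete {lt¹ f} (lexω O₀) (λ {a} {b} → lexᴮ-complete {ltᴮ f} O₀ ltᴮ-complete {a} {b}) {a} {b}) {a} {b}

    fldᴮ-sound : ∀ {a} → T (fldᴮ f a) → fld₀ a
    fldᴮ-sound {0} _ = tt
    fldᴮ-sound {1} _ = tt
    fldᴮ-sound {suc (suc a)} h = ≡ᵇ⇒≡ _ _ h

    fldᴮ-complete : ∀ {a} → fld₀ a → T (fldᴮ f a)
    fldᴮ-complete {0} _ = tt
    fldᴮ-complete {1} _ = tt
    fldᴮ-complete {suc (suc a)} h = ≡⇒≡ᵇ _ _ h

    open Order 𝓛 using () renaming (_⊏_ to _⊏ˡ_; fld to fldˡ)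

    opaque
      unfolding triple

      triple-η : ∀ l → triple (fst (fst l)) (snd (fst l)) (snd l) ≡ l
      triple-η l = trans (cong (λ x → pair x (snd l)) (pair-unpair (fst l))) (pair-unpair l)

      lex₁ : ∀ {a b m n k l} → a <₀ b → triple a m k ⊏ˡ triple b n l
      lex₁ {a} {b} {m} {n} {k} {l} p = major (subst₂ (Lexω _<₀_) (sym (fst-pair (pair a m) k)) (sym (fst-pair (pair b n) l))
        (major (subst₂ _<₀_ (sym (fst-pair a m)) (sym (fst-pair b n)) p)))

      lex₂ : ∀ {a m n k l} → m < n → triple a m k ⊏ˡ triple a n l
      lex₂ {a} {m} {n} {k} {l} p = major (subst₂ (Lexω _<₀_) (sym (fst-pair (pair a m) k)) (sym (fst-pair (pair a n) l))
        (minor (trans (fst-pair a m) (sym (fst-pair a n))) (subst₂ _<_ (sym (snd-pair a m)) (sym (snd-pair a n)) p)))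

      lex₃ : ∀ {a m k l} → k < l → triple a m k ⊏ˡ triple a m l
      lex₃ {a} {m} {k} {l} p = minor (trans (fst-pair (pair a m) k) (sym (fst-pair (pair a m) l)))
        (subst₂ _<_ (sym (snd-pair (pair a m) k)) (sym (snd-pair (pair a m) l)) p)

      fld₃ : ∀ {a m k} → fld₀ a → fldˡ (triple a m k)
      fld₃ {a} {m} {k} p = subst (λ x → fld₀ (fst x)) (sym (fst-pair (pair a m) k)) (subst fld₀ (sym (fst-pair a m)) p)

      ⊏ˡ-triple : ∀ {l a} → l ⊏ˡ triple a 0 0 → fst (fst l) <₀ a
      ⊏ˡ-triple {l} {a} (major p) = go (subst (Lexω _<₀_ (fst l)) (fst-pair (pair a 0) 0) p)
        where go : Lexω _<₀_ (fst l) (pair a 0) → fst (fst l) <₀ a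
              go (major q) = subst (fst (fst l) <₀_) (fst-pair a 0) q
              go (minor _ q) = ⊥-elim (n≮0 (subst (snd (fst l) <_) (snd-pair a 0) q))
      ⊏ˡ-triple {l} {a} (minor _ q) = ⊥-elim (n≮0 (subst (snd l <_) (snd-pair (pair a 0) 0) q))

    high : ℕ → ℕ
    high x = triple 0 x 0

    ω∞ : ℕ
    ω∞ = triple 1 0 0

    -- Below `ω∞` the first component is in `L` or is ∞. In `L` it is below ∞ already; at ∞ the
    -- second component decides, and it is at most the code `l`.
    code-high : ∀ {l z} → fldˡ l → l ⊏ˡ ω∞ → l < z → l ⊏ˡ high z
    code-high {l} {z} _ p lt = subst (_⊏ˡ high z) (triple-η l) (base (fst (fst l)) (⊏ˡ-triple p))
      where
      m<z : snd (fst l) < z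
      m<z = ≤-<-trans (≤-trans (snd≤ (fst l)) (fst≤ l)) lt
      base : ∀ a → a <₀ 1 → triple a (snd (fst l)) (snd l) ⊏ˡ high z
      base 0 _ = lex₂ m<z
      base 1 (to∞∞ n) = ⊥-elim (n refl)
      base (suc (suc a)) _ = lex₁ to∞

-- Facts about the hierarchy, their rules, and the attack relation

module Facts where

  open Pairing
  open Prog
  open Trees
  open Codes
  open Orders
  open import Data.Fin using (suc; #_)
  open import Data.Vec as Vec using (Vec; []; _∷_)
  open import Data.List using (List; []; _∷_)

  opaque
    fact : ℕ → ℕ → ℕ → ℕ → ℕ → ℕ
    fact b tag u xs v = pair b (pair tag (pair u (pair xs v)))

  factᵗ : ∀ {n} → Tm n nat → Tm n nat → Tm n nat → Tm n nat → Tm n nat → Tm n nat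
  factᵗ b tag u xs v = pairᵗ b (pairᵗ tag (pairᵗ u (pairᵗ xs v)))

  opaque
    unfolding fact

    factᵗ-ok : ∀ {n} (b tag u xs v : Tm n nat) f ρ →
      ⟦ factᵗ b tag u xs v ⟧ f ρ ≡ fact (⟦ b ⟧ f ρ) (⟦ tag ⟧ f ρ) (⟦ u ⟧ f ρ) (⟦ xs ⟧ f ρ) (⟦ v ⟧ f ρ)
    factᵗ-ok b tag u xs v f ρ = refl

    fst-fact : ∀ b tag u xs v → fst (fact b tag u xs v) ≡ b
    fst-fact b tag u xs v = fst-pair b (pair tag (pair u (pair xs v)))

  caseᵗ : ∀ {n s} → Tm n nat → List (Tm n s) → Tm n s → Tm n s
  caseᵗ {n} {s} t = go 0
    where go : ℕ → List (Tm n s) → Tm n s → Tm n s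
          go k [] d = d
          go k (a ∷ as) d = if′ (t ≟ᵗ lit k) a (go (suc k) as d)

  -- The instance of a rule concluding φ = ⟨b, tag, u, xs, v⟩ with extra data w is coded by ⟨φ, w⟩.
  -- Tags: 0 "u ∈ X_b", 1 "u codes a PR xs", 2 "u codes a vector of v PR xs", 3 "u maps xs to v",
  -- 4 "the vector u maps xs to v", 5 "u is positive at (z , xs) for all z < v"; tags 3 to 5 are
  -- relative to the oracle ⊕_{a <_L b} X_a. Here u = ⟨ct, ca⟩, hx and tx are head and
  -- tail of xs, and w = ⟨wk, wr⟩.
  bᵛ tagᵛ ctᵛ caᵛ uᵛ xsᵛ hxᵛ txᵛ vᵛ wᵛ wkᵛ wrᵛ : Tm 12 nat
  bᵛ = var (# 0)
  tagᵛ = var (# 1)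
  ctᵛ = var (# 2)
  caᵛ = var (# 3)
  uᵛ = var (# 4)
  xsᵛ = var (# 5)
  hxᵛ = var (# 6)
  txᵛ = var (# 7)
  vᵛ = var (# 8)
  wᵛ = var (# 9)
  wkᵛ = var (# 10)
  wrᵛ = var (# 11)

  trueᵗ falseᵗ : Tm 12 bool
  trueᵗ = lit 0 ≟ᵗ lit 0
  falseᵗ = lit 0 ≟ᵗ lit 1

  -- The side conditions of the rules. For tag 0, `wk = 0` selects the rule that copies `A`;
  -- otherwise `wr` is a pair of some z below `b`, showing that `b` is not least, and the value of
  -- the halting computation.
  validᵗ leastᵗ : Tm 12 bool
  validᵗ = fldᴸᵗ bᵛ ∧′ caseᵗ tagᵛ
    ( if′ (wkᵛ ≟ᵗ lit 0) (orc (suc′ (uᵛ +ᵗ uᵛ)) ≟ᵗ lit 1) (ltᴸᵗ (fstᵗ wrᵛ) bᵛ)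
    ∷ caseᵗ ctᵛ
      ( (caᵛ ≟ᵗ lit 0)
      ∷ ((caᵛ ≟ᵗ lit 0) ∧′ (xsᵛ ≟ᵗ lit 1))
      ∷ (caᵛ <ᵗ xsᵛ)
      ∷ ((caᵛ ≟ᵗ lit 0) ∧′ (xsᵛ ≟ᵗ lit 1))
      ∷ trueᵗ
      ∷ pos′ xsᵛ
      ∷ trueᵗ
      ∷ []) falseᵗ
    ∷ if′ (pos′ uᵛ) (pos′ vᵛ) (vᵛ ≟ᵗ lit 0)
    ∷ caseᵗ ctᵛ
      ( (vᵛ ≟ᵗ lit 0)
      ∷ (vᵛ ≟ᵗ suc′ hxᵛ)
      ∷ (atᵗ xsᵛ caᵛ ≟ᵗ suc′ vᵛ)
      -- The oracle may answer 0 also on columns that are not below `b`, in which case nothing has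
      -- to be denied.
      ∷ ((vᵛ ≟ᵗ lit 0) ∨′ ((vᵛ ≟ᵗ lit 1) ∧′ ltᴸᵗ (fstᵗ hxᵛ) bᵛ))
      ∷ trueᵗ
      ∷ trueᵗ
      ∷ trueᵗ
      ∷ []) falseᵗ
    ∷ if′ (pos′ uᵛ) (pos′ vᵛ) (vᵛ ≟ᵗ lit 0)
    ∷ trueᵗ
    ∷ []) falseᵗ

  leastᵗ = (tagᵛ ≟ᵗ lit 0) ∧′ (wkᵛ ≟ᵗ lit 0)

  -- Premises are optional: 0 stands for none, and a fact is shifted by one.
  noneᵗ : Tm 12 nat
  noneᵗ = lit 0

  someᵗ : ℕ → Tm 12 nat → Tm 12 nat → Tm 12 nat → Tm 12 nat
  someᵗ k u xs v = suc′ (factᵗ bᵛ (lit k) u xs v)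

  prem₁ᵗ prem₂ᵗ negᵗ : Tm 12 nat
  prem₁ᵗ = caseᵗ tagᵛ
    ( if′ (wkᵛ ≟ᵗ lit 0) noneᵗ (someᵗ 1 uᵛ (lit 1) (lit 0))
    ∷ caseᵗ ctᵛ
      ( noneᵗ ∷ noneᵗ ∷ noneᵗ ∷ noneᵗ
      ∷ someᵗ 1 (fstᵗ (sndᵗ caᵛ)) (fstᵗ caᵛ) (lit 0)
      ∷ someᵗ 1 (fstᵗ caᵛ) (predᵗ xsᵛ) (lit 0)
      ∷ someᵗ 1 caᵛ (suc′ xsᵛ) (lit 0)
      ∷ []) noneᵗ
    ∷ if′ (pos′ uᵛ) (someᵗ 1 (hdᵗ uᵛ) xsᵛ (lit 0)) noneᵗ
    ∷ caseᵗ ctᵛ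
      ( noneᵗ ∷ noneᵗ ∷ noneᵗ
      ∷ if′ (vᵛ ≟ᵗ lit 1) (suc′ (factᵗ (fstᵗ hxᵛ) (lit 0) (sndᵗ hxᵛ) (lit 0) (lit 0))) noneᵗ
      -- The extra datum `w` supplies what a derivation has to guess: the vector of inner values of
      -- a composition, the value at the predecessor in a recursion, and, for tag 5, the predecessor
      -- of the positive value.
      ∷ someᵗ 4 (sndᵗ (sndᵗ caᵛ)) xsᵛ wᵛ
      ∷ if′ (pos′ hxᵛ) (someᵗ 3 uᵛ (consᵗ (predᵗ hxᵛ) txᵛ) wᵛ) (someᵗ 3 (fstᵗ caᵛ) txᵛ vᵛ)
      ∷ someᵗ 3 caᵛ (consᵗ vᵛ xsᵛ) (lit 0)
      ∷ []) noneᵗ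
    ∷ if′ (pos′ uᵛ) (someᵗ 3 (hdᵗ uᵛ) xsᵛ (hdᵗ vᵛ)) noneᵗ
    ∷ if′ (pos′ vᵛ) (someᵗ 5 uᵛ xsᵛ (predᵗ vᵛ)) noneᵗ
    ∷ []) noneᵗ

  prem₂ᵗ = caseᵗ tagᵛ
    ( if′ (wkᵛ ≟ᵗ lit 0) noneᵗ (someᵗ 3 uᵛ (consᵗ uᵛ (lit 0)) (sndᵗ wrᵛ))
    ∷ caseᵗ ctᵛ
      ( noneᵗ ∷ noneᵗ ∷ noneᵗ ∷ noneᵗ
      ∷ someᵗ 2 (sndᵗ (sndᵗ caᵛ)) xsᵛ (fstᵗ caᵛ)
      ∷ someᵗ 1 (sndᵗ caᵛ) (suc′ xsᵛ) (lit 0)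
      ∷ noneᵗ
      ∷ []) noneᵗ
    ∷ if′ (pos′ uᵛ) (someᵗ 2 (tlᵗ uᵛ) xsᵛ (predᵗ vᵛ)) noneᵗ
    ∷ caseᵗ ctᵛ
      ( noneᵗ ∷ noneᵗ ∷ noneᵗ ∷ noneᵗ
      ∷ someᵗ 3 (fstᵗ (sndᵗ caᵛ)) wᵛ vᵛ
      ∷ if′ (pos′ hxᵛ) (someᵗ 3 (sndᵗ caᵛ) (consᵗ (predᵗ hxᵛ) (consᵗ wᵛ txᵛ)) vᵛ) noneᵗ
      ∷ someᵗ 5 caᵛ xsᵛ vᵛ
      ∷ []) noneᵗ
    ∷ if′ (pos′ uᵛ) (someᵗ 4 (tlᵗ uᵛ) xsᵛ (tlᵗ vᵛ)) noneᵗ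
    ∷ if′ (pos′ vᵛ) (someᵗ 3 uᵛ (consᵗ (predᵗ vᵛ) xsᵛ) (suc′ wᵛ)) noneᵗ
    ∷ []) noneᵗ

  -- The only negative premise: the oracle answers 0 on a column below `b`.
  negᵗ = if′ ((tagᵛ ≟ᵗ lit 3) ∧′ (ctᵛ ≟ᵗ lit 3) ∧′ (vᵛ ≟ᵗ lit 0) ∧′ ltᴸᵗ (fstᵗ hxᵛ) bᵛ)
    (suc′ (factᵗ (fstᵗ hxᵛ) (lit 0) (sndᵗ hxᵛ) (lit 0) (lit 0))) noneᵗ

  args : ℕ → ℕ → ℕ → ℕ → ℕ → ℕ → Vec ℕ 12
  args b tag u xs v w = b ∷ tag ∷ fst u ∷ snd u ∷ u ∷ xs ∷ hd xs ∷ tl xs ∷ v ∷ w ∷ fst w ∷ snd w ∷ []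

  split : ℕ → Vec ℕ 12
  split ρ = args (fst (fst ρ)) (fst (snd (fst ρ))) (fst (snd (snd (fst ρ)))) (fst (snd (snd (snd (fst ρ)))))
    (snd (snd (snd (snd (fst ρ))))) (snd ρ)

  argsᵗ : ∀ {n} → Tm n nat → Tm n nat → Tm n nat → Tm n nat → Tm n nat → Tm n nat → Vec (Tm n nat) 12
  argsᵗ b tag u xs v w = b ∷ tag ∷ fstᵗ u ∷ sndᵗ u ∷ u ∷ xs ∷ hdᵗ xs ∷ tlᵗ xs ∷ v ∷ w ∷ fstᵗ w ∷ sndᵗ w ∷ []

  splitᵗ : ∀ {n} → Tm n nat → Vec (Tm n nat) 12
  splitᵗ ρ = argsᵗ (fstᵗ (fstᵗ ρ)) (fstᵗ (sndᵗ (fstᵗ ρ))) (fstᵗ (sndᵗ (sndᵗ (fstᵗ ρ)))) (fstᵗ (sndᵗ (sndᵗ (sndᵗ (fstᵗ ρ)))))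
    (sndᵗ (sndᵗ (sndᵗ (sndᵗ (fstᵗ ρ))))) (sndᵗ ρ)

  opaque
    unfolding fact

    split-fact : ∀ b tag u xs v w → split (pair (fact b tag u xs v) w) ≡ args b tag u xs v w
    split-fact b tag u xs v w
      rewrite fst-pair (fact b tag u xs v) w | snd-pair (fact b tag u xs v) w
      | fst-pair b (pair tag (pair u (pair xs v))) | snd-pair b (pair tag (pair u (pair xs v)))
      | fst-pair tag (pair u (pair xs v)) | snd-pair tag (pair u (pair xs v))
      | fst-pair u (pair xs v) | snd-pair u (pair xs v) | fst-pair xs v | snd-pair xs v = refl

  module Attacks (valid least : ℕ → Bool) (prem₁ prem₂ neg : ℕ → ℕ) (lt : ℕ → ℕ → Bool) where

    -- Vertices: ⟨0, φ⟩ denies the fact φ, ⟨1, ρ⟩ asserts the premises of the rule instance ρ, and ⟨2, z⟩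
    -- is unattacked.
    attackᵇ : ℕ → ℕ → Bool
    attackᵇ x y =
      ((fst y ≡ᵇ 0) ∧ ((fst x ≡ᵇ 1) ∧ ((fst (snd x) ≡ᵇ snd y) ∧ valid (snd x)))) ∨
      ((fst y ≡ᵇ 1) ∧ (valid (snd y) ∧
        (((fst x ≡ᵇ 0) ∧ ((suc (snd x) ≡ᵇ prem₁ (snd y)) ∨ (suc (snd x) ≡ᵇ prem₂ (snd y)))) ∨
        (((fst x ≡ᵇ 1) ∧ ((suc (fst (snd x)) ≡ᵇ neg (snd y)) ∧ valid (snd x))) ∨
        ((fst x ≡ᵇ 2) ∧ (least (snd y) ∧ lt (snd x) (fst (fst (snd y)))))))))

    -- A positive premise is challenged by its denial, a negative one by each rule instance that
    -- would prove it. Leastness of `b` is challenged by any smaller z, whose vertex is unattacked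
    -- and so belongs to the kernel.
    data Attack (x y : ℕ) : Set where
      by-rule : ∀ ρ → x ≡ pair 1 ρ → y ≡ pair 0 (fst ρ) → T (valid ρ) → Attack x y
      by-premise : ∀ φ ρ → x ≡ pair 0 φ → y ≡ pair 1 ρ → T (valid ρ) → suc φ ≡ prem₁ ρ ⊎ suc φ ≡ prem₂ ρ → Attack x y
      by-negation : ∀ ρ′ ρ → x ≡ pair 1 ρ′ → y ≡ pair 1 ρ → T (valid ρ) → suc (fst ρ′) ≡ neg ρ → T (valid ρ′) → Attack x y
      by-smaller : ∀ z ρ → x ≡ pair 2 z → y ≡ pair 1 ρ → T (valid ρ) → T (least ρ) → T (lt z (fst (fst ρ))) → Attack x y

    kind : ∀ {x k} → T (fst x ≡ᵇ k) → x ≡ pair k (snd x)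
    kind {x} {k} h = trans (sym (pair-unpair x)) (cong (λ j → pair j (snd x)) (≡ᵇ⇒≡ (fst x) k h))

    attack-sound : ∀ x y → T (attackᵇ x y) → Attack x y
    attack-sound x y h with ∨-elim {(fst y ≡ᵇ 0) ∧ _} h
    ... | inj₁ p =
      let y0 , p₁ = ∧-elim {fst y ≡ᵇ 0} p
          x1 , p₂ = ∧-elim {fst x ≡ᵇ 1} p₁
          e , va = ∧-elim {fst (snd x) ≡ᵇ snd y} p₂
      in by-rule (snd x) (kind x1) (trans (kind y0) (cong (pair 0) (sym (≡ᵇ⇒≡ (fst (snd x)) (snd y) e)))) va
    ... | inj₂ p with ∧-elim {fst y ≡ᵇ 1} p
    ...   | y1 , p₁ with ∧-elim {valid (snd y)} p₁
    ...     | va , p₂ with ∨-elim {(fst x ≡ᵇ 0) ∧ _} p₂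
    ...       | inj₁ q with ∧-elim {fst x ≡ᵇ 0} q
    ...         | x0 , q₁ with ∨-elim {suc (snd x) ≡ᵇ prem₁ (snd y)} q₁
    ...           | inj₁ e = by-premise (snd x) (snd y) (kind x0) (kind y1) va (inj₁ (≡ᵇ⇒≡ _ _ e))
    ...           | inj₂ e = by-premise (snd x) (snd y) (kind x0) (kind y1) va (inj₂ (≡ᵇ⇒≡ _ _ e))
    attack-sound x y h | inj₂ p | y1 , p₁ | va , p₂ | inj₂ q with ∨-elim {(fst x ≡ᵇ 1) ∧ _} q
    ... | inj₁ r =
      let x1 , r₁ = ∧-elim {fst x ≡ᵇ 1} r
          e , va′ = ∧-elim {suc (fst (snd x)) ≡ᵇ neg (snd y)} r₁
      in by-negation (snd x) (snd y) (kind x1) (kind y1) va (≡ᵇ⇒≡ _ _ e) va′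
    ... | inj₂ r =
      let x2 , r₁ = ∧-elim {fst x ≡ᵇ 2} r
          l , z< = ∧-elim {least (snd y)} r₁
      in by-smaller (snd x) (snd y) (kind x2) (kind y1) va l z<

    attack-complete : ∀ {x y} → Attack x y → T (attackᵇ x y)
    attack-complete (by-rule ρ refl refl va)
      rewrite fst-pair 0 (fst ρ) | snd-pair 0 (fst ρ) | fst-pair 1 ρ | snd-pair 1 ρ =
      ∨-introˡ (∧-intro {fst ρ ≡ᵇ fst ρ} (≡⇒≡ᵇ (fst ρ) _ refl) va)
    attack-complete (by-premise φ ρ refl refl va (inj₁ e))
      rewrite fst-pair 0 φ | snd-pair 0 φ | fst-pair 1 ρ | snd-pair 1 ρ =
      ∧-intro va (∨-introˡ (∨-introˡ (≡⇒≡ᵇ (suc φ) _ e)))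
    attack-complete (by-premise φ ρ refl refl va (inj₂ e))
      rewrite fst-pair 0 φ | snd-pair 0 φ | fst-pair 1 ρ | snd-pair 1 ρ =
      ∧-intro va (∨-introˡ (∨-introʳ {suc φ ≡ᵇ prem₁ ρ} (≡⇒≡ᵇ (suc φ) _ e)))
    attack-complete (by-negation ρ′ ρ refl refl va e va′)
      rewrite fst-pair 1 ρ′ | snd-pair 1 ρ′ | fst-pair 1 ρ | snd-pair 1 ρ =
      ∧-intro va (∨-introˡ (∧-intro (≡⇒≡ᵇ (suc (fst ρ′)) _ e) va′))
    attack-complete (by-smaller z ρ refl refl va l z<)
      rewrite fst-pair 2 z | snd-pair 2 z | fst-pair 1 ρ | snd-pair 1 ρ =
      ∧-intro va (∧-intro l z<)

  opaque
    validᴬ leastᴬ : Baire → Vec ℕ 12 → Bool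
    validᴬ f a = ⟦ validᵗ ⟧ f a
    leastᴬ f a = ⟦ leastᵗ ⟧ f a

    prem₁ᴬ prem₂ᴬ negᴬ : Baire → Vec ℕ 12 → ℕ
    prem₁ᴬ f a = ⟦ prem₁ᵗ ⟧ f a
    prem₂ᴬ f a = ⟦ prem₂ᵗ ⟧ f a
    negᴬ f a = ⟦ negᵗ ⟧ f a

  module _ (f : Baire) where

    validᵇ leastᵇ : ℕ → Bool
    validᵇ ρ = validᴬ f (split ρ)
    leastᵇ ρ = leastᴬ f (split ρ)

    prem₁ prem₂ neg : ℕ → ℕ
    prem₁ ρ = prem₁ᴬ f (split ρ)
    prem₂ ρ = prem₂ᴬ f (split ρ)
    neg ρ = negᴬ f (split ρ)

    open Attacks validᵇ leastᵇ prem₁ prem₂ neg (ltᴸ f) public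

  attackᵗ : ∀ {n} → Tm n nat → Tm n nat → Tm n bool
  attackᵗ x y = app (
      ((fstᵗ v1 ≟ᵗ lit 0) ∧′ (fstᵗ v0 ≟ᵗ lit 1) ∧′ (fstᵗ (sndᵗ v0) ≟ᵗ sndᵗ v1) ∧′ app validᵗ (splitᵗ (sndᵗ v0))) ∨′
      ((fstᵗ v1 ≟ᵗ lit 1) ∧′ app validᵗ (splitᵗ (sndᵗ v1)) ∧′
        (((fstᵗ v0 ≟ᵗ lit 0) ∧′ ((suc′ (sndᵗ v0) ≟ᵗ app prem₁ᵗ (splitᵗ (sndᵗ v1))) ∨′ (suc′ (sndᵗ v0) ≟ᵗ app prem₂ᵗ (splitᵗ (sndᵗ v1))))) ∨′
        ((fstᵗ v0 ≟ᵗ lit 1) ∧′ (suc′ (fstᵗ (sndᵗ v0)) ≟ᵗ app negᵗ (splitᵗ (sndᵗ v1))) ∧′ app validᵗ (splitᵗ (sndᵗ v0))) ∨′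
        ((fstᵗ v0 ≟ᵗ lit 2) ∧′ app leastᵗ (splitᵗ (sndᵗ v1)) ∧′ ltᴸᵗ (sndᵗ v0) (fstᵗ (fstᵗ (sndᵗ v1)))))))
    (x ∷ y ∷ [])

  opaque
    unfolding validᴬ

    attackᵗ-ok : ∀ f x y → ⟦ attackᵗ v0 v1 ⟧ f (x ∷ y ∷ []) ≡ attackᵇ f x y
    attackᵗ-ok f x y = refl

  -- Records the entries of the rule tables for one shape of fact. The tables are opaque, and the
  -- semantics of the rules goes through these equations.
  record Row (f : Baire) (a : Vec ℕ 12) (va : Bool) (p₁ p₂ np : ℕ) (le : Bool) : Set where
    constructor values
    field
      valid≡ : validᴬ f a ≡ fldᴸ f (Vec.head a) ∧ va
      prem₁≡ : prem₁ᴬ f a ≡ p₁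
      prem₂≡ : prem₂ᴬ f a ≡ p₂
      neg≡   : negᴬ f a ≡ np
      least≡ : leastᴬ f a ≡ le

  module Rules (f : Baire) (b : ℕ) where

    opaque
      unfolding validᴬ fact

      row-A : ∀ {ct ca u xs hx tx v w wr} → Row f (b ∷ 0 ∷ ct ∷ ca ∷ u ∷ xs ∷ hx ∷ tx ∷ v ∷ w ∷ 0 ∷ wr ∷ [])
        (f (suc (u + u)) ≡ᵇ 1) 0 0 0 true
      row-A = values refl refl refl refl refl

      row-J : ∀ {ct ca u xs hx tx v w k wr} → Row f (b ∷ 0 ∷ ct ∷ ca ∷ u ∷ xs ∷ hx ∷ tx ∷ v ∷ w ∷ suc k ∷ wr ∷ [])
        (ltᴸ f (fst wr) b) (suc (fact b 1 u 1 0)) (suc (fact b 3 u (cons u 0) (snd wr))) 0 false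
      row-J = values refl refl refl refl refl

      row-wf0 : ∀ {ca xs tx w wk wr u hx v} → Row f (b ∷ 1 ∷ 0 ∷ ca ∷ u ∷ xs ∷ hx ∷ tx ∷ v ∷ w ∷ wk ∷ wr ∷ [])
        (ca ≡ᵇ 0) 0 0 0 false
      row-wf0 = values refl refl refl refl refl

      row-wf1 : ∀ {ca xs tx w wk wr u hx v} → Row f (b ∷ 1 ∷ 1 ∷ ca ∷ u ∷ xs ∷ hx ∷ tx ∷ v ∷ w ∷ wk ∷ wr ∷ [])
        ((ca ≡ᵇ 0) ∧ (xs ≡ᵇ 1)) 0 0 0 false
      row-wf1 = values refl refl refl refl refl

      row-wf2 : ∀ {ca xs tx w wk wr u hx v} → Row f (b ∷ 1 ∷ 2 ∷ ca ∷ u ∷ xs ∷ hx ∷ tx ∷ v ∷ w ∷ wk ∷ wr ∷ [])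
        (ca <ᵇ xs) 0 0 0 false
      row-wf2 = values refl refl refl refl refl

      row-wf3 : ∀ {ca xs tx w wk wr u hx v} → Row f (b ∷ 1 ∷ 3 ∷ ca ∷ u ∷ xs ∷ hx ∷ tx ∷ v ∷ w ∷ wk ∷ wr ∷ [])
        ((ca ≡ᵇ 0) ∧ (xs ≡ᵇ 1)) 0 0 0 false
      row-wf3 = values refl refl refl refl refl

      row-wf4 : ∀ {ca xs tx w wk wr u hx v} → Row f (b ∷ 1 ∷ 4 ∷ ca ∷ u ∷ xs ∷ hx ∷ tx ∷ v ∷ w ∷ wk ∷ wr ∷ [])
        true (suc (fact b 1 (fst (snd ca)) (fst ca) 0)) (suc (fact b 2 (snd (snd ca)) xs (fst ca))) 0 false
      row-wf4 = values refl refl refl refl refl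

      row-wf5 : ∀ {ca xs tx w wk wr u hx v} → Row f (b ∷ 1 ∷ 5 ∷ ca ∷ u ∷ xs ∷ hx ∷ tx ∷ v ∷ w ∷ wk ∷ wr ∷ [])
        (pos xs) (suc (fact b 1 (fst ca) (pred xs) 0)) (suc (fact b 1 (snd ca) (suc xs) 0)) 0 false
      row-wf5 = values refl refl refl refl refl

      row-wf6 : ∀ {ca xs tx w wk wr u hx v} → Row f (b ∷ 1 ∷ 6 ∷ ca ∷ u ∷ xs ∷ hx ∷ tx ∷ v ∷ w ∷ wk ∷ wr ∷ [])
        true (suc (fact b 1 ca (suc xs) 0)) 0 0 false
      row-wf6 = values refl refl refl refl refl

      row-wf7 : ∀ {ca xs tx w wk wr ct u hx v} → Row f (b ∷ 1 ∷ (7 + ct) ∷ ca ∷ u ∷ xs ∷ hx ∷ tx ∷ v ∷ w ∷ wk ∷ wr ∷ [])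
        false 0 0 0 false
      row-wf7 = values refl refl refl refl refl

      row-wfv0 : ∀ {ca xs tx w wk wr ct hx v} → Row f (b ∷ 2 ∷ ct ∷ ca ∷ 0 ∷ xs ∷ hx ∷ tx ∷ v ∷ w ∷ wk ∷ wr ∷ [])
        (v ≡ᵇ 0) 0 0 0 false
      row-wfv0 = values refl refl refl refl refl

      row-wfvS : ∀ {ca xs tx w wk wr ct u hx v} → Row f (b ∷ 2 ∷ ct ∷ ca ∷ (suc u) ∷ xs ∷ hx ∷ tx ∷ v ∷ w ∷ wk ∷ wr ∷ [])
        (pos v) (suc (fact b 1 (hd (suc u)) xs 0)) (suc (fact b 2 (tl (suc u)) xs (pred v))) 0 false
      row-wfvS = values refl refl refl refl refl

      row-ev0 : ∀ {ca xs tx w wk wr u hx v} → Row f (b ∷ 3 ∷ 0 ∷ ca ∷ u ∷ xs ∷ hx ∷ tx ∷ v ∷ w ∷ wk ∷ wr ∷ [])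
        (v ≡ᵇ 0) 0 0 0 false
      row-ev0 = values refl refl refl refl refl

      row-ev1 : ∀ {ca xs tx w wk wr u hx v} → Row f (b ∷ 3 ∷ 1 ∷ ca ∷ u ∷ xs ∷ hx ∷ tx ∷ v ∷ w ∷ wk ∷ wr ∷ [])
        (v ≡ᵇ suc hx) 0 0 0 false
      row-ev1 = values refl refl refl refl refl

      row-ev2 : ∀ {ca xs tx w wk wr u hx v} → Row f (b ∷ 3 ∷ 2 ∷ ca ∷ u ∷ xs ∷ hx ∷ tx ∷ v ∷ w ∷ wk ∷ wr ∷ [])
        (at xs ca ≡ᵇ suc v) 0 0 0 false
      row-ev2 = values refl refl refl refl refl

      row-ev3 : ∀ {ca xs tx w wk wr u hx v} → Row f (b ∷ 3 ∷ 3 ∷ ca ∷ u ∷ xs ∷ hx ∷ tx ∷ v ∷ w ∷ wk ∷ wr ∷ [])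
        ((v ≡ᵇ 0) ∨ ((v ≡ᵇ 1) ∧ ltᴸ f (fst hx) b)) (if v ≡ᵇ 1 then suc (fact (fst hx) 0 (snd hx) 0 0) else 0) 0 (if (v ≡ᵇ 0) ∧ ltᴸ f (fst hx) b then suc (fact (fst hx) 0 (snd hx) 0 0) else 0) false
      row-ev3 = values refl refl refl refl refl

      row-ev4 : ∀ {ca xs tx w wk wr u hx v} → Row f (b ∷ 3 ∷ 4 ∷ ca ∷ u ∷ xs ∷ hx ∷ tx ∷ v ∷ w ∷ wk ∷ wr ∷ [])
        true (suc (fact b 4 (snd (snd ca)) xs w)) (suc (fact b 3 (fst (snd ca)) w v)) 0 false
      row-ev4 = values refl refl refl refl refl

      row-ev50 : ∀ {ca xs tx w wk wr u v} → Row f (b ∷ 3 ∷ 5 ∷ ca ∷ u ∷ xs ∷ 0 ∷ tx ∷ v ∷ w ∷ wk ∷ wr ∷ [])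
        true (suc (fact b 3 (fst ca) tx v)) 0 0 false
      row-ev50 = values refl refl refl refl refl

      row-ev5S : ∀ {ca xs tx w wk wr u hx v} → Row f (b ∷ 3 ∷ 5 ∷ ca ∷ u ∷ xs ∷ (suc hx) ∷ tx ∷ v ∷ w ∷ wk ∷ wr ∷ [])
        true (suc (fact b 3 u (cons hx tx) w)) (suc (fact b 3 (snd ca) (cons hx (cons w tx)) v)) 0 false
      row-ev5S = values refl refl refl refl refl

      row-ev6 : ∀ {ca xs tx w wk wr u hx v} → Row f (b ∷ 3 ∷ 6 ∷ ca ∷ u ∷ xs ∷ hx ∷ tx ∷ v ∷ w ∷ wk ∷ wr ∷ [])
        true (suc (fact b 3 ca (cons v xs) 0)) (suc (fact b 5 ca xs v)) 0 false
      row-ev6 = values refl refl refl refl refl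

      row-evv0 : ∀ {ca xs tx w wk wr ct hx v} → Row f (b ∷ 4 ∷ ct ∷ ca ∷ 0 ∷ xs ∷ hx ∷ tx ∷ v ∷ w ∷ wk ∷ wr ∷ [])
        (v ≡ᵇ 0) 0 0 0 false
      row-evv0 = values refl refl refl refl refl

      row-evvS : ∀ {ca xs tx w wk wr ct u hx v} → Row f (b ∷ 4 ∷ ct ∷ ca ∷ (suc u) ∷ xs ∷ hx ∷ tx ∷ v ∷ w ∷ wk ∷ wr ∷ [])
        (pos v) (suc (fact b 3 (hd (suc u)) xs (hd v))) (suc (fact b 4 (tl (suc u)) xs (tl v))) 0 false
      row-evvS = values refl refl refl refl refl

      row-mu0 : ∀ {ca xs tx w wk wr ct u hx} → Row f (b ∷ 5 ∷ ct ∷ ca ∷ u ∷ xs ∷ hx ∷ tx ∷ 0 ∷ w ∷ wk ∷ wr ∷ [])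
        true 0 0 0 false
      row-mu0 = values refl refl refl refl refl

      row-muS : ∀ {ca xs tx w wk wr ct u hx v} → Row f (b ∷ 5 ∷ ct ∷ ca ∷ u ∷ xs ∷ hx ∷ tx ∷ (suc v) ∷ w ∷ wk ∷ wr ∷ [])
        true (suc (fact b 5 u xs v)) (suc (fact b 3 u (cons v xs) (suc w))) 0 false
      row-muS = values refl refl refl refl refl

-- Ranking the attack relation by levels over `L`

module Ranks where

  open Pairing
  open Trees
  open Kernel
  open Codes
  open Orders
  open Facts
  open import Data.Vec as Vec using (Vec; []; _∷_)

  -- Tags 0 and 5 have premises about `u` itself, with other tags, and therefore weigh one more than
  -- `u`.
  weight : ℕ → ℕ → ℕ
  weight 0 u = suc u
  weight 5 u = suc u
  weight _ u = u

  -- Breaks ties between facts about the same program: primitive recursion descends in its first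
  -- argument, positivity in its bound.
  step : ℕ → ℕ → ℕ → ℕ
  step 3 hx v = hx
  step 5 hx v = v
  step _ hx v = 0

  level : ℕ → ℕ → ℕ → ℕ → ℕ → ℕ
  level b tag u hx v = triple (2 + b) (weight tag u) (step tag hx v)

  level-of : ℕ → ℕ
  level-of φ = level (fst φ) (fst (snd φ)) (fst (snd (snd φ))) (hd (fst (snd (snd (snd φ))))) (snd (snd (snd (snd φ))))

  opaque
    unfolding fact

    level-of-fact : ∀ b tag u xs v → level-of (fact b tag u xs v) ≡ level b tag u (hd xs) v
    level-of-fact b tag u xs v
      rewrite fst-pair b (pair tag (pair u (pair xs v))) | snd-pair b (pair tag (pair u (pair xs v)))
      | fst-pair tag (pair u (pair xs v)) | snd-pair tag (pair u (pair xs v))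
      | fst-pair u (pair xs v) | snd-pair u (pair xs v) | fst-pair xs v | snd-pair xs v = refl

  level-of-vertex : ℕ → ℕ → ℕ
  level-of-vertex 0 φ = level-of φ
  level-of-vertex 1 ρ = level-of (fst ρ)
  level-of-vertex _ z = triple (2 + z) 0 0

  vertex-level : ℕ → ℕ
  vertex-level y = level-of-vertex (fst y) (snd y)

  vertex-level-pair : ∀ k a → vertex-level (pair k a) ≡ level-of-vertex k a
  vertex-level-pair k a rewrite fst-pair k a | snd-pair k a = refl

  module GraphRanks (f : Baire) (W : IsWellOrder (left f)) where
    open LevelOrder f W
    open Order 𝓛 using (_⊏_; fld)

    level-< : ∀ {b tag u xs v l} → level b tag u (hd xs) v ⊏ l → level-of (fact b tag u xs v) ⊏ l
    level-< {b} {tag} {u} {xs} {v} {l} = subst (_⊏ l) (sym (level-of-fact b tag u xs v))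

    fst-snd≤ : ∀ n → fst (snd n) ≤ n
    fst-snd≤ n = ≤-trans (fst≤ (snd n)) (snd≤ n)

    snd-snd≤ : ∀ n → snd (snd n) ≤ n
    snd-snd≤ n = ≤-trans (snd≤ (snd n)) (snd≤ n)

    part : ∀ k ca {u n} → u ≡ pair (suc k) ca → n ≤ ca → n < u
    part k ca refl p = ≤-<-trans p (b<pair k ca)

    -- Minimization has a premise of tag 5, whose weight is `suc ca`; the constructor number 6
    -- leaves room for the extra one.
    suc-part : ∀ ca {u} → u ≡ pair 6 ca → suc ca < u
    suc-part ca refl = ≤-trans (s≤s (s≤s (m≤n+m ca 4))) (≤-trans (n≤tri (6 + ca)) (m≤m+n _ ca))

    module _ (b : ℕ) where
      private
        Vars : ℕ → ℕ → ℕ → ℕ → ℕ → ℕ → ℕ → ℕ → ℕ → ℕ → ℕ → Vec ℕ 12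
        Vars tag ct ca u xs hx tx v w wk wr = b ∷ tag ∷ ct ∷ ca ∷ u ∷ xs ∷ hx ∷ tx ∷ v ∷ w ∷ wk ∷ wr ∷ []

      opaque
        unfolding validᴬ fact

        prem₁-< : ∀ tag ct ca u xs hx tx v w wk wr φ → u ≡ pair ct ca → T (validᴬ f (Vars tag ct ca u xs hx tx v w wk wr)) →
          suc φ ≡ prem₁ᴬ f (Vars tag ct ca u xs hx tx v w wk wr) → level-of φ ⊏ level b tag u hx v
        prem₁-< 0 ct ca u xs hx tx v w (suc _) wr φ _ va refl = level-< {b} {1} {u} {1} {0} (lex₂ ≤-refl)
        prem₁-< 1 4 ca u xs hx tx v w wk wr φ eu va refl = level-< {b} {1} {fst (snd ca)} {fst ca} {0} (lex₂ (part 3 ca eu (fst-snd≤ ca)))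
        prem₁-< 1 5 ca u xs hx tx v w wk wr φ eu va refl = level-< {b} {1} {fst ca} {pred xs} {0} (lex₂ (part 4 ca eu (fst≤ ca)))
        prem₁-< 1 6 ca u xs hx tx v w wk wr φ eu va refl = level-< {b} {1} {ca} {suc xs} {0} (lex₂ (part 5 ca eu ≤-refl))
        prem₁-< 2 ct ca (suc u) xs hx tx v w wk wr φ _ va refl = level-< {b} {1} {fst u} {xs} {0} (lex₂ (s≤s (fst≤ u)))
        prem₁-< 3 3 ca u xs hx tx 1 w wk wr φ _ va refl =
          level-< {fst hx} {0} {snd hx} {0} {0} (lex₁ (in-L (ltᴸ-sound (proj₂ (∧-elim {fldᴸ f b} va)))))
        prem₁-< 3 4 ca u xs hx tx v w wk wr φ eu va refl = level-< {b} {4} {snd (snd ca)} {xs} {w} (lex₂ (part 3 ca eu (snd-snd≤ ca)))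
        prem₁-< 3 5 ca u xs zero tx v w wk wr φ eu va refl = level-< {b} {3} {fst ca} {tx} {v} (lex₂ (part 4 ca eu (fst≤ ca)))
        prem₁-< 3 5 ca u xs (suc k) tx v w wk wr φ eu va refl = level-< {b} {3} {u} {cons k tx} {w}
          (subst (λ j → triple (2 + b) u j ⊏ triple (2 + b) u (suc k)) (sym (hd-cons k tx)) (lex₃ ≤-refl))
        prem₁-< 3 6 ca u xs hx tx v w wk wr φ eu va refl = level-< {b} {3} {ca} {cons v xs} {0} (lex₂ (part 5 ca eu ≤-refl))
        prem₁-< 4 ct ca (suc u) xs hx tx v w wk wr φ _ va refl = level-< {b} {3} {fst u} {xs} {hd v} (lex₂ (s≤s (fst≤ u)))
        prem₁-< 5 ct ca u xs hx tx (suc v) w wk wr φ _ va refl = level-< {b} {5} {u} {xs} {v} (lex₃ ≤-refl)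

        prem₂-< : ∀ tag ct ca u xs hx tx v w wk wr φ → u ≡ pair ct ca →
          suc φ ≡ prem₂ᴬ f (Vars tag ct ca u xs hx tx v w wk wr) → level-of φ ⊏ level b tag u hx v
        prem₂-< 0 ct ca u xs hx tx v w (suc _) wr φ _ refl = level-< {b} {3} {u} {cons u 0} {snd wr} (lex₂ ≤-refl)
        prem₂-< 1 4 ca u xs hx tx v w wk wr φ eu refl = level-< {b} {2} {snd (snd ca)} {xs} {fst ca} (lex₂ (part 3 ca eu (snd-snd≤ ca)))
        prem₂-< 1 5 ca u xs hx tx v w wk wr φ eu refl = level-< {b} {1} {snd ca} {suc xs} {0} (lex₂ (part 4 ca eu (snd≤ ca)))
        prem₂-< 2 ct ca (suc u) xs hx tx v w wk wr φ _ refl = level-< {b} {2} {snd u} {xs} {pred v} (lex₂ (s≤s (snd≤ u)))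
        prem₂-< 3 4 ca u xs hx tx v w wk wr φ eu refl = level-< {b} {3} {fst (snd ca)} {w} {v} (lex₂ (part 3 ca eu (fst-snd≤ ca)))
        prem₂-< 3 5 ca u xs (suc k) tx v w wk wr φ eu refl = level-< {b} {3} {snd ca} {cons k (cons w tx)} {v} (lex₂ (part 4 ca eu (snd≤ ca)))
        prem₂-< 3 6 ca u xs hx tx v w wk wr φ eu refl = level-< {b} {5} {ca} {xs} {v} (lex₂ (suc-part ca eu))
        prem₂-< 4 ct ca (suc u) xs hx tx v w wk wr φ _ refl = level-< {b} {4} {snd u} {xs} {tl v} (lex₂ (s≤s (snd≤ u)))
        prem₂-< 5 ct ca u xs hx tx (suc v) w wk wr φ _ refl = level-< {b} {3} {u} {cons v xs} {suc w} (lex₂ ≤-refl)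

        prem₂-< 1 6 ca u xs hx tx v w wk wr φ _ ()
        prem₂-< 1 (suc (suc (suc (suc (suc (suc (suc _))))))) ca u xs hx tx v w wk wr φ _ ()
        prem₂-< 3 (suc (suc (suc (suc (suc (suc (suc _))))))) ca u xs hx tx v w wk wr φ _ ()

        neg-< : ∀ tag ct ca u xs hx tx v w wk wr φ →
          suc φ ≡ negᴬ f (Vars tag ct ca u xs hx tx v w wk wr) → level-of φ ⊏ level b tag u hx v
        neg-< 3 3 ca u xs hx tx 0 w wk wr φ e with T-dec (ltᴸ f (fst hx) b)
        ... | inj₁ lt = subst (λ φ → level-of φ ⊏ level b 3 u hx 0) (suc-injective (sym (trans e (if-true lt))))
                (level-< {fst hx} {0} {snd hx} {0} {0} (lex₁ (in-L (ltᴸ-sound lt))))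
        ... | inj₂ ge with () ← trans e (if-false ge)

    opaque
      unfolding validᴬ

      valid-field : ∀ ρ → T (validᵇ f ρ) → Field r (fst (fst ρ))
      valid-field ρ va = ≡ᵇ⇒≡ _ _ (proj₁ (∧-elim va))

    unpaired : ∀ u → u ≡ pair (fst u) (snd u)
    unpaired u = sym (pair-unpair u)

    _▹_ : ℕ → ℕ → Set
    x ▹ y = Attack f x y

    below-rule : ∀ {x y} ρ → y ≡ pair 1 ρ → x ▹ y → vertex-level x ⊏ level-of (fst ρ)
    below-rule ρ e (by-rule ρ′ _ e′ _) with () ← pair-inj₁ {1} {ρ} {0} {fst ρ′} (trans (sym e) e′)
    below-rule ρ refl (by-premise φ ρ′ refl e′ va p) with refl ← pair-inj₂ {1} {ρ} {1} {ρ′} e′ =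
      subst (_⊏ level-of (fst ρ)) (sym (vertex-level-pair 0 φ)) (go p)
      where
      b = fst (fst ρ) ; tag = fst (snd (fst ρ)) ; u = fst (snd (snd (fst ρ))) ; xs = fst (snd (snd (snd (fst ρ))))
      v = snd (snd (snd (snd (fst ρ)))) ; w = snd ρ
      go : suc φ ≡ prem₁ f ρ ⊎ suc φ ≡ prem₂ f ρ → level-of φ ⊏ level-of (fst ρ)
      go (inj₁ q) = prem₁-< b tag (fst u) (snd u) u xs (hd xs) (tl xs) v w (fst w) (snd w) φ (unpaired u) va q
      go (inj₂ q) = prem₂-< b tag (fst u) (snd u) u xs (hd xs) (tl xs) v w (fst w) (snd w) φ (unpaired u) q
    below-rule ρ refl (by-negation ρ′ ρ″ refl e′ va q va′) with refl ← pair-inj₂ {1} {ρ} {1} {ρ″} e′ =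
      subst (_⊏ level-of (fst ρ)) (sym (vertex-level-pair 1 ρ′))
        (neg-< b tag (fst u) (snd u) u xs (hd xs) (tl xs) v w (fst w) (snd w) (fst ρ′) q)
      where
      b = fst (fst ρ) ; tag = fst (snd (fst ρ)) ; u = fst (snd (snd (fst ρ))) ; xs = fst (snd (snd (snd (fst ρ))))
      v = snd (snd (snd (snd (fst ρ)))) ; w = snd ρ
    below-rule ρ refl (by-smaller z ρ′ refl e′ va _ z<) with refl ← pair-inj₂ {1} {ρ} {1} {ρ′} e′ =
      subst (_⊏ level-of (fst ρ)) (sym (vertex-level-pair 2 z)) (lex₁ (in-L (ltᴸ-sound z<)))

    -- `same` arises when a rule instance attacks the denial of its conclusion. The next attack is
    -- then on a rule instance and lowers the level, whence `step-<`.
    data Step (x y : ℕ) : Set where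
      same  : ∀ ρ → x ≡ pair 1 ρ → vertex-level x ≡ vertex-level y → Step x y
      lower : vertex-level x ⊏ vertex-level y → Step x y

    ▹-level : ∀ {x y} → x ▹ y → Σ ℕ λ ρ → T (validᵇ f ρ) × vertex-level y ≡ level-of (fst ρ) × Step x y
    ▹-level {x} {y} p = go p
      where
      at-rule : ∀ ρ → y ≡ pair 1 ρ → T (validᵇ f ρ) → Σ ℕ λ ρ → T (validᵇ f ρ) × vertex-level y ≡ level-of (fst ρ) × Step x y
      at-rule ρ e va = ρ , va , lv , lower (subst (vertex-level x ⊏_) (sym lv) (below-rule ρ e p))
        where lv : vertex-level y ≡ level-of (fst ρ)
              lv = trans (cong vertex-level e) (vertex-level-pair 1 ρ)
      go : x ▹ y → Σ ℕ λ ρ → T (validᵇ f ρ) × vertex-level y ≡ level-of (fst ρ) × Step x y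
      go (by-rule ρ e e′ va) = ρ , va , lv , same ρ e (trans (trans (cong vertex-level e) (vertex-level-pair 1 ρ)) (sym lv))
        where lv : vertex-level y ≡ level-of (fst ρ)
              lv = trans (cong vertex-level e′) (vertex-level-pair 0 (fst ρ))
      go (by-premise _ ρ _ e va _) = at-rule ρ e va
      go (by-negation _ ρ _ e va _ _) = at-rule ρ e va
      go (by-smaller _ ρ _ e va _ _) = at-rule ρ e va

    step-≤ : ∀ {x y} → x ▹ y → vertex-level x ⊏ vertex-level y ⊎ vertex-level x ≡ vertex-level y
    step-≤ p with proj₂ (proj₂ (proj₂ (▹-level p)))
    ... | same _ _ e = inj₂ e
    ... | lower q = inj₁ q

    step-< : ∀ {s x y} → s ▹ x → x ▹ y → vertex-level s ⊏ vertex-level y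
    step-< {s} q p with proj₂ (proj₂ (proj₂ (▹-level p)))
    ... | same ρ refl e = subst (vertex-level s ⊏_) (trans (sym (vertex-level-pair 1 ρ)) e) (below-rule ρ refl q)
    ... | lower lt with step-≤ q
    ...   | inj₁ lt′ = Order.⊏-trans 𝓛 lt′ lt
    ...   | inj₂ e = subst (_⊏ _) (sym e) lt

    graph : Ranked
    graph = record
      { _⊳_ = _▹_ ; lev = vertex-level ; 𝓛 = 𝓛 ; lev-≤ = step-≤ ; lev-< = step-<
      ; lev-fld = λ p → let ρ , va , e , _ = ▹-level p in subst fld (sym e) (fld₃ (valid-field ρ va))
      ; high = high ; ω∞ = ω∞
      ; lev-high = λ z p → let ρ , va , e , _ = ▹-level p in subst (_⊏ high z) (sym e) (lex₁ to∞)
      ; high-mono = lex₂ ; high-fld = λ _ → fld₃ tt ; high-∞ = λ z → lex₁ (to∞∞ λ ())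
      ; code-high = code-high }

-- Decision procedures for the two trees and the instance built from them

module Checks where

  open Pairing
  open Prog
  open Trees
  open Codes
  open import Data.Vec as Vec using ([]; _∷_)
  open import Data.List using ([]; _∷_)

  module Tests (atk lt : ℕ → ℕ → Bool) (fd : ℕ → Bool) where

    descᵇ : ℕ → ℕ → Bool
    descᵇ t c = everyᵇ c λ j → fd (expo (nthᶜ c j)) ∧
      lt (expo (nthᶜ c j)) (if j ≡ᵇ 0 then t else expo (nthᶜ c (pred j)))

    refuteᵇ : ℕ → ℕ → ℕ → ℕ → ℕ → Bool
    refuteᵇ y x c i d = if i ≡ᵇ 0 then atk d x ∨ ((d <ᵇ x) ∧ atk d y) else atk d (ans (nthᶜ c (pred i)))

    -- The claim challenged at turn `j` has number `fst j ≤ j` and depends only on answers before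
    -- `j`; so the complete list may stand for the history.
    stratᵇ : ℕ → ℕ → ℕ → Bool
    stratᵇ y x c = everyᵇ c λ j → not (refuteᵇ y x c (fst j) (snd j)) ∨ atk (ans (nthᶜ c j)) (snd j)

    in𝓜 in𝓝 : ℕ → Bool
    in𝓜 c = (tl c ≡ᵇ 0) ∨ (atk (hd (tl c)) (hd c) ∧
      (descᵇ (pair (pair (pair 0 (hd (tl c))) 0) 0) (tl (tl c)) ∧ stratᵇ (hd c) (hd (tl c)) (tl (tl c))))
    -- The empty list has code 0 and passes the first test, as `hd 0` and `tl 0` are both 0.
    in𝓝 c = ((hd c ≡ᵇ 0) ∧ descᵇ (pair (pair (pair 1 0) 0) 0) (tl c)) ∨ ((hd c ≡ᵇ 1) ∧ (tl c ≡ᵇ 0))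

  leqᵇ : (ℕ → Bool) → ℕ → Bool
  leqᵇ U m = U (fst m) ∧ (U (snd m) ∧ ((fst m ≡ᵇ snd m) ∨ lexᵇ (fst m) (snd m)))

  everyᵗ : ∀ {n} → Tm n nat → Tm (suc n) nat → Tm (suc n) bool → Tm n bool
  everyᵗ c c↑ q = all′ c (not′ (pos′ (atᵗ c↑ v0)) ∨′ q)

  ansᵗ expoᵗ : ∀ {n} → Tm n nat → Tm n nat
  ansᵗ w = fstᵗ w
  expoᵗ w = fstᵗ (sndᵗ w)

  leqᵗ : Tm 1 bool → Tm 1 bool
  leqᵗ U = app U (fstᵗ v0 ∷ []) ∧′ app U (sndᵗ v0 ∷ []) ∧′ ((fstᵗ v0 ≟ᵗ sndᵗ v0) ∨′ lexᵗ (fstᵗ v0) (sndᵗ v0))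

  module Testsᵗ (A Lt : Tm 2 bool) (Fd : Tm 1 bool) where

    atkᵗ ltᵗ : ∀ {n} → Tm n nat → Tm n nat → Tm n bool
    atkᵗ x y = app A (x ∷ y ∷ [])
    ltᵗ x y = app Lt (x ∷ y ∷ [])

    fdᵗ : ∀ {n} → Tm n nat → Tm n bool
    fdᵗ x = app Fd (x ∷ [])

    descᵗ : ∀ {n} → Tm n nat → Tm n nat → Tm n bool
    descᵗ t c = app (everyᵗ v1 v2 (fdᵗ (expoᵗ (nthᵗ v2 v0)) ∧′
      ltᵗ (expoᵗ (nthᵗ v2 v0)) (if′ (v0 ≟ᵗ lit 0) v1 (expoᵗ (nthᵗ v2 (predᵗ v0)))))) (t ∷ c ∷ [])

    refuteᵗ : ∀ {n} → Tm n nat → Tm n nat → Tm n nat → Tm n nat → Tm n nat → Tm n bool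
    refuteᵗ y x c i d = app (if′ (v3 ≟ᵗ lit 0) (atkᵗ v4 v1 ∨′ ((v4 <ᵗ v1) ∧′ atkᵗ v4 v0))
      (atkᵗ v4 (ansᵗ (nthᵗ v2 (predᵗ v3))))) (y ∷ x ∷ c ∷ i ∷ d ∷ [])

    stratᵗ : ∀ {n} → Tm n nat → Tm n nat → Tm n nat → Tm n bool
    stratᵗ y x c = app (everyᵗ v2 v3 (not′ (refuteᵗ v1 v2 v3 (fstᵗ v0) (sndᵗ v0)) ∨′ atkᵗ (ansᵗ (nthᵗ v3 v0)) (sndᵗ v0)))
      (y ∷ x ∷ c ∷ [])

    in𝓜ᵗ in𝓝ᵗ : Tm 1 bool
    in𝓜ᵗ = (tlᵗ v0 ≟ᵗ lit 0) ∨′ (atkᵗ (hdᵗ (tlᵗ v0)) (hdᵗ v0) ∧′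
      descᵗ (pairᵗ (pairᵗ (pairᵗ (lit 0) (hdᵗ (tlᵗ v0))) (lit 0)) (lit 0)) (tlᵗ (tlᵗ v0)) ∧′
      stratᵗ (hdᵗ v0) (hdᵗ (tlᵗ v0)) (tlᵗ (tlᵗ v0)))
    in𝓝ᵗ = ((hdᵗ v0 ≟ᵗ lit 0) ∧′ descᵗ (lit (pair (pair (pair 1 0) 0) 0)) (tlᵗ v0)) ∨′
      ((hdᵗ v0 ≟ᵗ lit 1) ∧′ (tlᵗ v0 ≟ᵗ lit 0))

    module _ (f : Baire) where

      open Tests (λ x y → ⟦ A ⟧ f (x ∷ y ∷ [])) (λ x y → ⟦ Lt ⟧ f (x ∷ y ∷ [])) (λ x → ⟦ Fd ⟧ f (x ∷ []))

      leq𝓜-ok : ∀ m → ⟦ leqᵗ in𝓜ᵗ ⟧ f (m ∷ []) ≡ leqᵇ in𝓜 m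
      leq𝓜-ok m = refl

      leq𝓝-ok : ∀ m → ⟦ leqᵗ in𝓝ᵗ ⟧ f (m ∷ []) ≡ leqᵇ in𝓝 m
      leq𝓝-ok m = refl

  par half : ℕ → ℕ
  par = natrec 0 (λ _ u → 1 ∸ u)
  half = natrec 0 (λ k u → u + par k)

  par-double : ∀ n → par (n + n) ≡ 0
  par-double zero = refl
  par-double (suc n) rewrite +-suc n n | par-double n = refl

  half-double : ∀ n → half (n + n) ≡ n
  half-double zero = refl
  half-double (suc n) rewrite +-suc n n | half-double n | par-double n = trans (cong (_+ 1) (+-identityʳ n)) (+-comm n 1)

  half-odd : ∀ n → half (suc (n + n)) ≡ n
  half-odd n rewrite par-double n | half-double n = +-identityʳ n

  interleaveᵗ : Tm 1 bool → Tm 1 bool → Tm 1 nat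
  interleaveᵗ a b = if′ (parᵗ ≟ᵗ lit 0) (if′ (app a (halfᵗ ∷ [])) (lit 1) (lit 0)) (if′ (app b (halfᵗ ∷ [])) (lit 1) (lit 0))
    where
    parᵗ halfᵗ : Tm 1 nat
    parᵗ = rec v0 (lit 0) (lit 1 ∸ᵗ v1)
    halfᵗ = rec v0 (lit 0) (v1 +ᵗ rec v0 (lit 0) (lit 1 ∸ᵗ v1))

  interleave-left : ∀ a b f m → left (λ n → ⟦ interleaveᵗ a b ⟧ f (n ∷ [])) m ≡ bit (⟦ a ⟧ f (m ∷ []))
  interleave-left a b f m = lem (par-double m) (half-double m)
    where lem : ∀ {p h} → p ≡ 0 → h ≡ m →
            (if p ≡ᵇ 0 then bit (⟦ a ⟧ f (h ∷ [])) else bit (⟦ b ⟧ f (h ∷ []))) ≡ bit (⟦ a ⟧ f (m ∷ []))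
          lem refl refl = refl

  interleave-right : ∀ a b f m → right (λ n → ⟦ interleaveᵗ a b ⟧ f (n ∷ [])) m ≡ bit (⟦ b ⟧ f (m ∷ []))
  interleave-right a b f m = lem (cong (1 ∸_) (par-double m)) (half-odd m)
    where lem : ∀ {p h} → p ≡ 1 → h ≡ m →
            (if p ≡ᵇ 0 then bit (⟦ a ⟧ f (h ∷ [])) else bit (⟦ b ⟧ f (h ∷ []))) ≡ bit (⟦ b ⟧ f (m ∷ []))
          lem refl refl = refl

-- Correctness of the decision procedures and of the coded orders

module Specs where

  open Pairing
  open Prog
  open Trees
  open Kernel
  open Codes
  open Orders
  open Checks
  open import Data.List using (List; []; _∷_; _++_; _∷ʳ_; length)
  open import Data.List.Properties using (∷ʳ-++; length-++; ++-identityʳ)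
  open import Induction.WellFounded using (Acc; acc; WellFounded)

  nth-++ : ∀ h l {i} → i < length h → nth (h ++ l) i ≡ nth h i
  nth-++ (x ∷ h) l {zero} _ = refl
  nth-++ (x ∷ h) l {suc i} (s≤s p) = nth-++ h l p

  nth-++-head : ∀ h w l → nth (h ++ w ∷ l) (length h) ≡ w
  nth-++-head [] w l = refl
  nth-++-head (x ∷ h) w l = nth-++-head h w l

  module TestsSpec (𝓡 : Ranked) (atk lt : ℕ → ℕ → Bool) (fd : ℕ → Bool) where
    open Ranked 𝓡 using (_⊳_)
    open KernelOrders 𝓡
    open Order E
    open Descending E
    open Tests atk lt fd

    module Correctness (atk-s : ∀ {x y} → T (atk x y) → x ⊳ y) (atk-c : ∀ {x y} → x ⊳ y → T (atk x y))
      (lt-s : ∀ {a b} → T (lt a b) → a ⊏ b) (lt-c : ∀ {a b} → a ⊏ b → T (lt a b))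
      (fd-s : ∀ {a} → T (fd a) → fld a) (fd-c : ∀ {a} → fld a → T (fd a))
      (start≡ : ∀ x → start x ≡ pair (pair (pair 0 x) 0) 0) (end≡ : end ≡ pair (pair (pair 1 0) 0) 0) where

      DescAt : ℕ → List ℕ → ℕ → Set
      DescAt t l j = fld (expo (nth l j)) × expo (nth l j) ⊏ (if j ≡ᵇ 0 then t else expo (nth l (pred j)))

      DescAt⇒Desc : ∀ t l → (∀ j → j < length l → DescAt t l j) → Desc t l
      DescAt⇒Desc t [] h = tt
      DescAt⇒Desc t (w ∷ l) h = h 0 z<s , DescAt⇒Desc (expo w) l λ { zero p → h 1 (s<s p) ; (suc j) p → h (suc (suc j)) (s<s p) }

      Desc⇒DescAt : ∀ t l → Desc t l → ∀ j → j < length l → DescAt t l j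
      Desc⇒DescAt t (w ∷ l) (a , d) zero _ = a
      Desc⇒DescAt t (w ∷ l) (a , d) (suc zero) (s≤s p) = Desc⇒DescAt (expo w) l d 0 p
      Desc⇒DescAt t (w ∷ l) (a , d) (suc (suc j)) (s≤s p) = Desc⇒DescAt (expo w) l d (suc j) p

      nthᶜ≡ : ∀ c → (λ j → nthᶜ c j) ≗ nth (dec c)
      nthᶜ≡ c = nthᶜ-dec c

      desc-sound : ∀ t c → T (descᵇ t c) → Desc t (dec c)
      desc-sound t c h = DescAt⇒Desc t (dec c) λ j p →
        let q = everyᵇ-elim c _ h j p
            a , b = ∧-elim {fd (expo (nthᶜ c j))} q
        in subst (λ w → fld (expo w)) (nthᶜ≡ c j) (fd-s a) ,
           subst₂ (λ w w′ → expo w ⊏ (if j ≡ᵇ 0 then t else expo w′)) (nthᶜ≡ c j) (nthᶜ≡ c (pred j)) (lt-s b)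

      desc-complete : ∀ t c → Desc t (dec c) → T (descᵇ t c)
      desc-complete t c d = everyᵇ-intro c _ λ j p →
        let a , b = Desc⇒DescAt t (dec c) d j p
        in ∧-intro (fd-c (subst (λ w → fld (expo w)) (sym (nthᶜ≡ c j)) a))
             (lt-c (subst₂ (λ w w′ → expo w ⊏ (if j ≡ᵇ 0 then t else expo w′)) (sym (nthᶜ≡ c j)) (sym (nthᶜ≡ c (pred j))) b))

      module _ (y x : ℕ) where

        AnswerAt : List ℕ → ℕ → Set
        AnswerAt l j = Refute y x l (fst j) (snd j) → ans (nth l j) ⊳ snd j

        Refute-++ : ∀ h l {i d} → i ≤ length h → Refute y x (h ++ l) i d → Refute y x h i d
        Refute-++ h l {zero} _ r = r
        Refute-++ h l {suc i} p r rewrite nth-++ h l p = r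

        ++-Refute : ∀ h l {i d} → i ≤ length h → Refute y x h i d → Refute y x (h ++ l) i d
        ++-Refute h l {zero} _ r = r
        ++-Refute h l {suc i} p r rewrite nth-++ h l p = r

        AnswerAt⇒Strat : ∀ h l → (∀ j → length h ≤ j → j < length (h ++ l) → AnswerAt (h ++ l) j) → Strat y x h l
        AnswerAt⇒Strat h [] a = tt
        AnswerAt⇒Strat h (w ∷ l) a =
          (λ r → subst (λ v → ans v ⊳ snd (length h)) (nth-++-head h w l)
            (a (length h) ≤-refl lt′ (++-Refute h (w ∷ l) (fst≤ (length h)) r))) ,
          AnswerAt⇒Strat (h ∷ʳ w) l λ j p q → subst (λ l → AnswerAt l j) (sym (∷ʳ-++ h w l))
            (a j (≤-trans (n≤1+n _) (subst (_≤ j) (length-∷ʳ h w) p)) (subst (λ l → j < length l) (∷ʳ-++ h w l) q))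
          where lt′ : length h < length (h ++ w ∷ l)
                lt′ = subst (length h <_) (sym (length-++ h)) (m<m+n (length h) z<s)

        Strat⇒AnswerAt : ∀ h l → Strat y x h l → ∀ j → length h ≤ j → j < length (h ++ l) → AnswerAt (h ++ l) j
        Strat⇒AnswerAt h [] s j p q = ⊥-elim (<-irrefl refl (≤-<-trans p (subst (λ l → j < length l) (++-identityʳ h) q)))
        Strat⇒AnswerAt h (w ∷ l) (a , s) j p q with m≤n⇒m<n∨m≡n p
        ... | inj₂ refl = λ r → subst (λ v → ans v ⊳ snd (length h)) (sym (nth-++-head h w l)) (a (Refute-++ h (w ∷ l) (fst≤ (length h)) r))
        ... | inj₁ lt′ = subst (λ l → AnswerAt l j) (∷ʳ-++ h w l)
            (Strat⇒AnswerAt (h ∷ʳ w) l s j (subst (_≤ j) (sym (length-∷ʳ h w)) lt′) (subst (λ l → j < length l) (sym (∷ʳ-++ h w l)) q))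

        refute-sound : ∀ c i d → T (refuteᵇ y x c i d) → Refute y x (dec c) i d
        refute-sound c zero d h with ∨-elim {atk d x} h
        ... | inj₁ p = inj₁ (atk-s p)
        ... | inj₂ p = let q , q′ = ∧-elim {d <ᵇ x} p in inj₂ (<ᵇ⇒< d x q , atk-s q′)
        refute-sound c (suc i) d h = subst (λ w → d ⊳ ans w) (nthᶜ≡ c i) (atk-s h)

        refute-complete : ∀ c i d → Refute y x (dec c) i d → T (refuteᵇ y x c i d)
        refute-complete c zero d (inj₁ p) = ∨-introˡ (atk-c p)
        refute-complete c zero d (inj₂ (p , q)) = ∨-introʳ {atk d x} (∧-intro (<⇒<ᵇ p) (atk-c q))
        refute-complete c (suc i) d r = atk-c (subst (λ w → d ⊳ ans w) (sym (nthᶜ≡ c i)) r)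

        strat-sound : ∀ c → T (stratᵇ y x c) → Strat y x [] (dec c)
        strat-sound c h = AnswerAt⇒Strat [] (dec c) λ j _ p r → go j r (∨-elim {not (refuteᵇ y x c (fst j) (snd j))} (everyᵇ-elim c _ h j p))
          where
          go : ∀ j → Refute y x (dec c) (fst j) (snd j) →
               T (not (refuteᵇ y x c (fst j) (snd j))) ⊎ T (atk (ans (nthᶜ c j)) (snd j)) → ans (nth (dec c) j) ⊳ snd j
          go j r (inj₁ n) = ⊥-elim (not-elim n (refute-complete c (fst j) (snd j) r))
          go j r (inj₂ p) = subst (λ w → ans w ⊳ snd j) (nthᶜ≡ c j) (atk-s p)

        strat-complete : ∀ c → Strat y x [] (dec c) → T (stratᵇ y x c)
        strat-complete c s = everyᵇ-intro c _ λ j p → go j (Strat⇒AnswerAt [] (dec c) s j z≤n p) (T-dec (refuteᵇ y x c (fst j) (snd j)))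
          where
          go : ∀ j → AnswerAt (dec c) j → T (refuteᵇ y x c (fst j) (snd j)) ⊎ ¬ T (refuteᵇ y x c (fst j) (snd j)) →
               T (not (refuteᵇ y x c (fst j) (snd j)) ∨ atk (ans (nthᶜ c j)) (snd j))
          go j a (inj₁ r) = ∨-introʳ {not (refuteᵇ y x c (fst j) (snd j))}
            (atk-c (subst (λ w → ans w ⊳ snd j) (sym (nthᶜ≡ c j)) (a (refute-sound c (fst j) (snd j) r))))
          go j a (inj₂ n) = ∨-introˡ (not-intro n)

      Desc-start≡ : ∀ {x l} → Desc (pair (pair (pair 0 x) 0) 0) l → Desc (start x) l
      Desc-start≡ {x} {l} = subst (λ t → Desc t l) (sym (start≡ x))

      in𝓜-sound : ∀ c → T (in𝓜 c) → 𝓜 (dec c)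
      in𝓜-sound zero _ = tt
      in𝓜-sound (suc m) h = subst 𝓜 (sym (dec-suc m)) (go (snd m) (∨-elim {snd m ≡ᵇ 0} h))
        where
        go : ∀ c → T (c ≡ᵇ 0) ⊎ T (atk (hd c) (fst m) ∧ (descᵇ (pair (pair (pair 0 (hd c)) 0) 0) (tl c) ∧ stratᵇ (fst m) (hd c) (tl c))) →
             𝓜 (fst m ∷ dec c)
        go zero _ = tt
        go (suc n) (inj₂ p) = subst (λ l → 𝓜 (fst m ∷ l)) (sym (dec-suc n))
          (let a , p′ = ∧-elim {atk (fst n) (fst m)} p
               d , s = ∧-elim {descᵇ (pair (pair (pair 0 (fst n)) 0) 0) (snd n)} p′
           in (atk-s a , Desc-start≡ {fst n} {dec (snd n)} (desc-sound _ (snd n) d) , strat-sound (fst m) (fst n) (snd n) s))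

      in𝓜-complete : ∀ c → 𝓜 (dec c) → T (in𝓜 c)
      in𝓜-complete zero _ = tt
      in𝓜-complete (suc m) h = go (snd m) (subst 𝓜 (dec-suc m) h)
        where
        go : ∀ c → 𝓜 (fst m ∷ dec c) →
             T ((c ≡ᵇ 0) ∨ (atk (hd c) (fst m) ∧ (descᵇ (pair (pair (pair 0 (hd c)) 0) 0) (tl c) ∧ stratᵇ (fst m) (hd c) (tl c))))
        go zero _ = tt
        go (suc n) h with subst (λ l → 𝓜 (fst m ∷ l)) (dec-suc n) h
        ... | a , d , s = ∧-intro (atk-c a) (∧-intro (desc-complete _ (snd n) (subst (λ t → Desc t (dec (snd n))) (start≡ (fst n)) d))
                (strat-complete (fst m) (fst n) (snd n) s))

      in𝓝-sound : ∀ c → T (in𝓝 c) → 𝓝 (dec c)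
      in𝓝-sound zero _ = tt
      in𝓝-sound (suc m) h = subst 𝓝 (sym (dec-suc m)) (go (fst m) (snd m) h)
        where
        go : ∀ k c → T (((k ≡ᵇ 0) ∧ descᵇ (pair (pair (pair 1 0) 0) 0) c) ∨ ((k ≡ᵇ 1) ∧ (c ≡ᵇ 0))) → 𝓝 (k ∷ dec c)
        go 0 c p with ∨-elim {descᵇ (pair (pair (pair 1 0) 0) 0) c} p
        ... | inj₁ d = subst (λ t → Desc t (dec c)) (sym end≡) (desc-sound _ c d)
        go 1 zero p = tt

      in𝓝-complete : ∀ c → 𝓝 (dec c) → T (in𝓝 c)
      in𝓝-complete zero _ = tt
      in𝓝-complete (suc m) h = go (fst m) (snd m) (subst 𝓝 (dec-suc m) h)
        where
        go : ∀ k c → 𝓝 (k ∷ dec c) → T (((k ≡ᵇ 0) ∧ descᵇ (pair (pair (pair 1 0) 0) 0) c) ∨ ((k ≡ᵇ 1) ∧ (c ≡ᵇ 0)))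
        go 0 c d = ∨-introˡ (desc-complete _ c (subst (λ t → Desc t (dec c)) end≡ d))
        go 1 zero p = tt
        go 1 (suc c) p with subst (λ l → 𝓝 (1 ∷ l)) (dec-suc c) p
        ... | ()

  module CodedTree (V : ℕ → Bool) (U : Tree) (V-s : ∀ c → T (V c) → U (dec c)) (V-c : ∀ c → U (dec c) → T (V c))
    (r : Baire) (r-def : ∀ m → r m ≡ bit (leqᵇ V m)) where

    bit-1 : ∀ {a} → bit a ≡ 1 → T a
    bit-1 {true} _ = tt

    1-bit : ∀ {a} → T a → bit a ≡ 1
    1-bit {true} _ = refl

    ≤-sound : ∀ a b → a ≤[ r ] b → U (dec a) × U (dec b) × (a ≡ b ⊎ dec a ≺ dec b)
    ≤-sound a b h = subst₂ (λ x y → U (dec x) × U (dec y) × (x ≡ y ⊎ dec x ≺ dec y)) (fst-pair a b) (snd-pair a b)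
        (V-s _ p , V-s _ q , cmp (∨-elim {fst m ≡ᵇ snd m} s))
      where
      m : ℕ
      m = pair a b
      t : T (leqᵇ V m)
      t = bit-1 (trans (sym (r-def m)) h)
      p : T (V (fst m))
      p = proj₁ (∧-elim t)
      q : T (V (snd m))
      q = proj₁ (∧-elim (proj₂ (∧-elim {V (fst m)} t)))
      s : T ((fst m ≡ᵇ snd m) ∨ lexᵇ (fst m) (snd m))
      s = proj₂ (∧-elim {V (snd m)} (proj₂ (∧-elim {V (fst m)} t)))
      cmp : T (fst m ≡ᵇ snd m) ⊎ T (lexᵇ (fst m) (snd m)) → fst m ≡ snd m ⊎ dec (fst m) ≺ dec (snd m)
      cmp (inj₁ e) = inj₁ (≡ᵇ⇒≡ _ _ e)
      cmp (inj₂ l) = inj₂ (lexᵇ⇒≺ (fst m) (snd m) l)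

    ≤-complete : ∀ a b → U (dec a) → U (dec b) → a ≡ b ⊎ dec a ≺ dec b → a ≤[ r ] b
    ≤-complete a b u v h = trans (r-def (pair a b)) (1-bit (subst₂ (λ x y → T (V x ∧ (V y ∧ ((x ≡ᵇ y) ∨ lexᵇ x y))))
        (sym (fst-pair a b)) (sym (snd-pair a b)) (∧-intro (V-c a u) (∧-intro (V-c b v) (cmp h)))))
      where
      cmp : a ≡ b ⊎ dec a ≺ dec b → T ((a ≡ᵇ b) ∨ lexᵇ a b)
      cmp (inj₁ e) = ∨-introˡ (≡⇒≡ᵇ a b e)
      cmp (inj₂ l) = ∨-introʳ {a ≡ᵇ b} (≺⇒lexᵇ a b l)

    dec-inj : ∀ {a b} → dec a ≡ dec b → a ≡ b
    dec-inj {a} {b} e = trans (sym (enc-dec a)) (trans (cong enc e) (enc-dec b))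

    isLinOrder : IsLinOrder r
    isLinOrder = record
      { char = λ n → subst (λ v → v ≡ 0 ⊎ v ≡ 1) (sym (r-def n)) (bit-01 (leqᵇ V n))
      ; inField = λ a b h → let u , v , _ = ≤-sound a b h in ≤-complete a a u u (inj₁ refl) , ≤-complete b b v v (inj₁ refl)
      ; antisym = λ a b p q → anti (proj₂ (proj₂ (≤-sound a b p))) (proj₂ (proj₂ (≤-sound b a q)))
      ; trans = λ a b c p q → let u , _ , s = ≤-sound a b p ; _ , v , t = ≤-sound b c q in ≤-complete a c u v (tr s t)
      ; total = λ a b p q → tot a b (proj₁ (≤-sound a a p)) (proj₁ (≤-sound b b q)) (≺-cmp (dec a) (dec b)) }
      where
      bit-01 : ∀ a → bit a ≡ 0 ⊎ bit a ≡ 1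
      bit-01 true = inj₂ refl
      bit-01 false = inj₁ refl
      anti : ∀ {a b} → a ≡ b ⊎ dec a ≺ dec b → b ≡ a ⊎ dec b ≺ dec a → a ≡ b
      anti (inj₁ e) _ = e
      anti (inj₂ _) (inj₁ e) = sym e
      anti {a} {b} (inj₂ p) (inj₂ q) = ⊥-elim (≺-irrefl (dec a) (≺-trans {dec a} {dec b} {dec a} p q))
      tr : ∀ {a b c} → a ≡ b ⊎ dec a ≺ dec b → b ≡ c ⊎ dec b ≺ dec c → a ≡ c ⊎ dec a ≺ dec c
      tr (inj₁ refl) q = q
      tr (inj₂ p) (inj₁ refl) = inj₂ p
      tr {a} {b} {c} (inj₂ p) (inj₂ q) = inj₂ (≺-trans {dec a} {dec b} {dec c} p q)
      tot : ∀ a b → U (dec a) → U (dec b) → dec a ≺ dec b ⊎ (dec a ≡ dec b ⊎ dec b ≺ dec a) → a ≤[ r ] b ⊎ b ≤[ r ] a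
      tot a b u v (inj₁ p) = inj₁ (≤-complete a b u v (inj₂ p))
      tot a b u v (inj₂ (inj₁ e)) = inj₁ (≤-complete a b u v (inj₁ (dec-inj e)))
      tot a b u v (inj₂ (inj₂ p)) = inj₂ (≤-complete b a v u (inj₂ p))

    <-sound : ∀ {a b} → a <[ r ] b → within U (dec a) (dec b)
    <-sound {a} {b} (p , ne) with ≤-sound a b p
    ... | u , v , inj₁ e = ⊥-elim (ne e)
    ... | u , v , inj₂ l = u , v , l

    <-complete : ∀ {a b} → within U (dec a) (dec b) → a <[ r ] b
    <-complete {a} {b} (u , v , l) = ≤-complete a b u v (inj₂ l) , λ { refl → ≺-irrefl (dec a) l }

    isWellOrder : WellFounded (within U) → IsWellOrder r
    isWellOrder wf = isLinOrder , λ a → go (wf (dec a))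
      where
      go : ∀ {a} → Acc (within U) (dec a) → Acc (λ a b → a <[ r ] b) a
      go (acc rs) = acc λ p → go (rs (<-sound p))

    field-sound : ∀ {a} → Field r a → U (dec a)
    field-sound {a} p = proj₁ (≤-sound a a p)

    field-complete : ∀ {a} → U (dec a) → Field r a
    field-complete {a} u = ≤-complete a a u u (inj₁ refl)

-- Kernel membership as truth about the jump hierarchy

module Semantics where

  open Pairing
  open Trees
  open Kernel
  open Codes
  open Orders
  open Facts
  open Ranks
  open import Data.Nat.Induction using (<-wellFounded)
  open import Data.Fin using (zero; suc; toℕ; fromℕ<)
  open import Data.Fin.Properties using (toℕ<n; toℕ-fromℕ<)
  open import Data.Vec as Vec using (Vec; []; _∷_; lookup)
  open import Induction.WellFounded using (Acc; acc)

  fst-snd-pair : ∀ a b c → fst (snd (pair a (pair b c))) ≡ b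
  fst-snd-pair a b c = trans (cong fst (snd-pair a (pair b c))) (fst-pair b c)

  snd-snd-pair : ∀ a b c → snd (snd (pair a (pair b c))) ≡ c
  snd-snd-pair a b c = trans (cong snd (snd-pair a (pair b c))) (snd-pair b c)

  codeV : ∀ {n} → Vec ℕ n → ℕ
  codeV [] = 0
  codeV (x ∷ xs) = cons x (codeV xs)

  at-codeV : ∀ {n} (xs : Vec ℕ n) i → at (codeV xs) (toℕ i) ≡ suc (lookup xs i)
  at-codeV (x ∷ xs) zero = cong suc (hd-cons x (codeV xs))
  at-codeV (x ∷ xs) (suc i) = trans (at-shift (codeV (x ∷ xs)) (toℕ i))
    (trans (cong (λ c → at c (toℕ i)) (tl-cons x (codeV xs))) (at-codeV xs i))

  row : ℕ → ℕ → ℕ → ℕ → ℕ → ℕ → ℕ → ℕ → ℕ → ℕ → Vec ℕ 12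
  row b tag ct ca u xs hx tx v w = b ∷ tag ∷ ct ∷ ca ∷ u ∷ xs ∷ hx ∷ tx ∷ v ∷ w ∷ fst w ∷ snd w ∷ []

  module Truth (f : Baire) (W : IsWellOrder (left f)) where
    open LevelOrder f W using (r; ltᴸ-sound; ltᴸ-complete)
    open GraphRanks f W using (graph; _▹_)
    open KernelOrders graph using (Tr; Tr-intro; Tr-elim)

    module Decided (decide : ∀ y → Tr y ⊎ Σ ℕ λ x → x ▹ y × Tr x) where

      record Holds (φ : ℕ) : Set where
        constructor holding
        field untrue : ¬ Tr (pair 0 φ)
      open Holds

      -- Apart from validity, the fields exclude the three kinds of attack on a rule instance: `p₁`
      -- and `p₂` by a denied premise, `np` by a proof of the negative premise, `least` by a smaller
      -- element.
      record Justified (a : Vec ℕ 12) : Set where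
        constructor just
        field
          valid : T (validᴬ f a)
          p₁ : ∀ φ → suc φ ≡ prem₁ᴬ f a → Holds φ
          p₂ : ∀ φ → suc φ ≡ prem₂ᴬ f a → Holds φ
          np : ∀ φ → suc φ ≡ negᴬ f a → ¬ Holds φ
          least : T (leastᴬ f a) → ∀ z → ¬ T (ltᴸ f z (Vec.head a))

      leaf : ∀ z → Tr (pair 2 z)
      leaf z = Tr-intro λ x p → ⊥-elim (go p)
        where
        go : ∀ {x} → ¬ (x ▹ pair 2 z)
        go (by-rule ρ _ e _) with () ← pair-inj₁ {2} {z} {0} {fst ρ} e
        go (by-premise _ ρ _ e _ _) with () ← pair-inj₁ {2} {z} {1} {ρ} e
        go (by-negation _ ρ _ e _ _ _) with () ← pair-inj₁ {2} {z} {1} {ρ} e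
        go (by-smaller _ ρ _ e _ _ _) with () ← pair-inj₁ {2} {z} {1} {ρ} e

      rule-holds : ∀ ρ → T (validᵇ f ρ) → Tr (pair 1 ρ) → Holds (fst ρ)
      rule-holds ρ va t = holding λ t′ → Tr-elim t′ (by-rule ρ refl refl va) t

      Justified⇒Tr : ∀ ρ → Justified (split ρ) → Tr (pair 1 ρ)
      Justified⇒Tr ρ j = Tr-intro λ x p t → go p t
        where
        open Justified j
        go : ∀ {x} → x ▹ pair 1 ρ → ¬ Tr x
        go (by-rule ρ′ _ e _) _ with () ← pair-inj₁ {1} {ρ} {0} {fst ρ′} e
        go (by-premise φ ρ′ refl e _ q) t with refl ← pair-inj₂ {1} {ρ} {1} {ρ′} e = prem q
          where prem : suc φ ≡ prem₁ f ρ ⊎ suc φ ≡ prem₂ f ρ → ⊥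
                prem (inj₁ q) = untrue (p₁ φ q) t
                prem (inj₂ q) = untrue (p₂ φ q) t
        go (by-negation ρ″ ρ′ refl e _ q va) t with refl ← pair-inj₂ {1} {ρ} {1} {ρ′} e = np (fst ρ″) q (rule-holds ρ″ va t)
        go (by-smaller z ρ′ refl e _ l z<) t with refl ← pair-inj₂ {1} {ρ} {1} {ρ′} e = least l z z<

      -- Here `decide` enters: a denial outside the kernel has an actual attacker in it, and only
      -- rule instances attack denials. This is how witnesses of computations are extracted.
      Holds-rule : ∀ {φ} → Holds φ → Σ ℕ λ ρ → fst ρ ≡ φ × T (validᵇ f ρ) × Tr (pair 1 ρ)
      Holds-rule {φ} h with decide (pair 0 φ)
      ... | inj₁ t = ⊥-elim (untrue h t)
      ... | inj₂ (x , p , t) = go p t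
        where
        go : ∀ {x} → x ▹ pair 0 φ → Tr x → Σ ℕ λ ρ → fst ρ ≡ φ × T (validᵇ f ρ) × Tr (pair 1 ρ)
        go (by-rule ρ refl e va) t = ρ , sym (pair-inj₂ {0} {φ} {0} {fst ρ} e) , va , t
        go (by-premise _ ρ _ e _ _) _ with () ← pair-inj₁ {0} {φ} {1} {ρ} e
        go (by-negation _ ρ _ e _ _ _) _ with () ← pair-inj₁ {0} {φ} {1} {ρ} e
        go (by-smaller _ ρ _ e _ _ _) _ with () ← pair-inj₁ {0} {φ} {1} {ρ} e

      Tr⇒Justified : ∀ ρ → T (validᵇ f ρ) → Tr (pair 1 ρ) → Justified (split ρ)
      Tr⇒Justified ρ va t = just va
        (λ φ e → holding (Tr-elim t (by-premise φ ρ refl refl va (inj₁ e))))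
        (λ φ e → holding (Tr-elim t (by-premise φ ρ refl refl va (inj₂ e))))
        (λ φ e h → let ρ′ , e′ , va′ , t′ = Holds-rule h in
          Tr-elim t (by-negation ρ′ ρ refl refl va (trans (cong suc e′) e) va′) t′)
        (λ l z z< → Tr-elim t (by-smaller z ρ refl refl va l z<) (leaf z))

      Prem NPrem : ℕ → Set
      Prem 0 = ⊤
      Prem (suc φ) = Holds φ
      NPrem 0 = ⊤
      NPrem (suc φ) = ¬ Holds φ

      Minimal : Bool → ℕ → Set
      Minimal false b = ⊤
      Minimal true b = ∀ z → ¬ T (ltᴸ f z b)

      Premises : ℕ → Bool → ℕ → ℕ → ℕ → Bool → Set
      Premises b va p q n l = T (fldᴸ f b) × T va × Prem p × Prem q × NPrem n × Minimal l b

      justify : ∀ {a va p q n l} → Row f a va p q n l → Premises (Vec.head a) va p q n l → Justified a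
      justify R (fb , va , hp , hq , hn , hl) = just (subst T (sym valid≡) (∧-intro fb va))
        (λ φ e → subst Prem (sym (trans e prem₁≡)) hp) (λ φ e → subst Prem (sym (trans e prem₂≡)) hq)
        (λ φ e → subst NPrem (sym (trans e neg≡)) hn) (λ l → minimal (subst T least≡ l) hl)
        where
        open Row R
        minimal : ∀ {l b} → T l → Minimal l b → Minimal true b
        minimal {true} _ h = h

      unjustify : ∀ {a va p q n l} → Row f a va p q n l → Justified a → Premises (Vec.head a) va p q n l
      unjustify {p = p} {q} {n} {l} R j = let fb , va = ∧-elim (subst T valid≡ valid) in
          fb , va , pos-prem p (λ φ e → p₁ φ (trans e (sym prem₁≡))) , pos-prem q (λ φ e → p₂ φ (trans e (sym prem₂≡))) ,
          neg-prem n (λ φ e → np φ (trans e (sym neg≡))) , minimal l (λ t → least (subst T (sym least≡) t))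
        where
        open Row R
        open Justified j
        pos-prem : ∀ p → (∀ φ → suc φ ≡ p → Holds φ) → Prem p
        pos-prem zero h = tt
        pos-prem (suc φ) h = h φ refl
        neg-prem : ∀ p → (∀ φ → suc φ ≡ p → ¬ Holds φ) → NPrem p
        neg-prem zero h = tt
        neg-prem (suc φ) h = h φ refl
        minimal : ∀ l {b} → (T l → Minimal true b) → Minimal l b
        minimal false h = tt
        minimal true h = h tt

      module _ (b tag u xs v : ℕ) {ct ca hx tx : ℕ}
        (ct≡ : fst u ≡ ct) (ca≡ : snd u ≡ ca) (hx≡ : hd xs ≡ hx) (tx≡ : tl xs ≡ tx) where

        row≡ : ∀ w → split (pair (fact b tag u xs v) w) ≡ row b tag ct ca u xs hx tx v w
        row≡ w = trans (split-fact b tag u xs v w) (cong₂ (λ { (ct , ca) (hx , tx) → row b tag ct ca u xs hx tx v w })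
          (cong₂ _,_ ct≡ ca≡) (cong₂ _,_ hx≡ tx≡))

        conclude : ∀ w {va p q n l} → Row f (row b tag ct ca u xs hx tx v w) va p q n l → Premises b va p q n l →
          Holds (fact b tag u xs v)
        conclude w R h = subst Holds (fst-pair (fact b tag u xs v) w) (rule-holds (pair (fact b tag u xs v) w) (Justified.valid j) (Justified⇒Tr (pair (fact b tag u xs v) w) j))
          where j : Justified (split (pair (fact b tag u xs v) w))
                j = subst Justified (sym (row≡ w)) (justify R h)

        invert : Holds (fact b tag u xs v) → Σ ℕ λ w → Justified (row b tag ct ca u xs hx tx v w)
        invert h = let ρ , e , va , t = Holds-rule h in
          snd ρ , subst Justified (trans (trans (cong split (sym (pair-unpair ρ))) (cong (λ φ → split (pair φ (snd ρ))) e)) (row≡ (snd ρ)))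
            (Tr⇒Justified ρ va t)

      module AtLevel (b : ℕ) where
        open Rules f b

        module _ (fb : T (fldᴸ f b)) where

          wf-rule : ∀ n ct ca {va p q} → (∀ {tx w wk wr u hx v} → Row f (b ∷ 1 ∷ ct ∷ ca ∷ u ∷ n ∷ hx ∷ tx ∷ v ∷ w ∷ wk ∷ wr ∷ []) va p q 0 false) →
            T va → Prem p → Prem q → Holds (fact b 1 (pair ct ca) n 0)
          wf-rule n ct ca R va p q = conclude b 1 (pair ct ca) n 0 (fst-pair ct ca) (snd-pair ct ca) refl refl 0 R (fb , va , p , q , tt , tt)

          mutual
            wf-complete : ∀ {n} (c : PR n) → Holds (fact b 1 (encode c) n 0)
            wf-complete {n} zeroF = wf-rule n 0 0 row-wf0 tt tt tt
            wf-complete succF = wf-rule 1 1 0 row-wf1 tt tt tt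
            wf-complete {n} (proj i) = wf-rule n 2 (toℕ i) row-wf2 (<⇒<ᵇ (toℕ<n i)) tt tt
            wf-complete oracle = wf-rule 1 3 0 row-wf3 tt tt tt
            wf-complete {n} (comp {m = m} g hs) = wf-rule n 4 (pair m (pair (encode g) (encodeVec hs))) row-wf4 tt
              (subst₂ (λ g m → Holds (fact b 1 g m 0)) (sym (fst-snd-pair m (encode g) (encodeVec hs))) (sym (fst-pair m (pair (encode g) (encodeVec hs)))) (wf-complete g))
              (subst₂ (λ hs m → Holds (fact b 2 hs n m)) (sym (snd-snd-pair m (encode g) (encodeVec hs))) (sym (fst-pair m (pair (encode g) (encodeVec hs)))) (wfv-complete hs))
            wf-complete {suc n} (prec g h) = wf-rule (suc n) 5 (pair (encode g) (encode h)) row-wf5 tt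
              (subst (λ g → Holds (fact b 1 g n 0)) (sym (fst-pair (encode g) (encode h))) (wf-complete g))
              (subst (λ h → Holds (fact b 1 h (2 + n) 0)) (sym (snd-pair (encode g) (encode h))) (wf-complete h))
            wf-complete {n} (mu g) = wf-rule n 6 (encode g) row-wf6 tt (wf-complete g) tt

            wfv-complete : ∀ {n m} (hs : Vec (PR n) m) → Holds (fact b 2 (encodeVec hs) n m)
            wfv-complete {n} [] = conclude b 2 0 n 0 refl refl refl refl 0 row-wfv0 (fb , tt , tt , tt , tt , tt)
            wfv-complete {n} {suc m} (h ∷ hs) = conclude b 2 (cons (encode h) (encodeVec hs)) n (suc m) refl refl refl refl 0 row-wfvS
              (fb , tt , subst (λ h → Holds (fact b 1 h n 0)) (sym (hd-cons (encode h) (encodeVec hs))) (wf-complete h)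
              , subst (λ hs → Holds (fact b 2 hs n m)) (sym (tl-cons (encode h) (encodeVec hs))) (wfv-complete hs) , tt , tt)

        ev-rule : ∀ ct ca xs v w {hx tx va p q np} → hd xs ≡ hx → tl xs ≡ tx →
          Row f (row b 3 ct ca (pair ct ca) xs hx tx v w) va p q np false → Premises b va p q np false → Holds (fact b 3 (pair ct ca) xs v)
        ev-rule ct ca xs v w hx≡ tx≡ R P = conclude b 3 (pair ct ca) xs v (fst-pair ct ca) (snd-pair ct ca) hx≡ tx≡ w R P

        ev-unrule : ∀ ct ca xs v {hx tx} → hd xs ≡ hx → tl xs ≡ tx → Holds (fact b 3 (pair ct ca) xs v) →
          Σ ℕ λ w → Justified (row b 3 ct ca (pair ct ca) xs hx tx v w)
        ev-unrule ct ca xs v hx≡ tx≡ h = invert b 3 (pair ct ca) xs v (fst-pair ct ca) (snd-pair ct ca) hx≡ tx≡ h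

        mutual
          -- `Jump` asks for a typed program with the given code, which has to be rebuilt from the
          -- code.
          wf-sound : ∀ {c} → Acc _<_ c → ∀ n → Holds (fact b 1 c n 0) → Σ (PR n) λ e → encode e ≡ c
          wf-sound {c} a n h = wf-case a n (fst c) (snd c) (sym (pair-unpair c))
            (invert b 1 c n 0 refl refl refl refl h)

          wf-case : ∀ {c} → Acc _<_ c → ∀ n ct ca → c ≡ pair ct ca →
            (Σ ℕ λ w → Justified (row b 1 ct ca c n (hd n) (tl n) 0 w)) → Σ (PR n) λ e → encode e ≡ c
          wf-case a n 0 ca refl (w , j) with unjustify row-wf0 j
          ... | _ , z , _ with refl ← ≡ᵇ⇒≡ ca 0 z = zeroF , refl
          wf-case a n 1 ca refl (w , j) with unjustify row-wf1 j
          ... | _ , z , _ with ∧-elim {ca ≡ᵇ 0} z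
          ...   | p , q with refl ← ≡ᵇ⇒≡ ca 0 p | refl ← ≡ᵇ⇒≡ n 1 q = succF , refl
          wf-case a n 2 ca refl (w , j) with unjustify row-wf2 j
          ... | _ , z , _ = proj (fromℕ< (<ᵇ⇒< ca n z)) , cong (pair 2) (toℕ-fromℕ< (<ᵇ⇒< ca n z))
          wf-case a n 3 ca refl (w , j) with unjustify row-wf3 j
          ... | _ , z , _ with ∧-elim {ca ≡ᵇ 0} z
          ...   | p , q with refl ← ≡ᵇ⇒≡ ca 0 p | refl ← ≡ᵇ⇒≡ n 1 q = oracle , refl
          wf-case (acc rs) n 4 ca refl (w , j) with unjustify row-wf4 j
          ... | _ , _ , hg , hh , _ with wf-sound (rs (≤-<-trans (≤-trans (fst≤ (snd ca)) (snd≤ ca)) (b<pair 3 ca))) (fst ca) hg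
                                   | wfv-sound (rs (≤-<-trans (≤-trans (snd≤ (snd ca)) (snd≤ ca)) (b<pair 3 ca))) n (fst ca) hh
          ...   | g , eg | hs , eh = comp g hs , cong (pair 4) (trans (cong₂ (λ x y → pair (fst ca) (pair x y)) eg eh)
                  (trans (cong (pair (fst ca)) (pair-unpair (snd ca))) (pair-unpair ca)))
          wf-case (acc rs) zero 5 ca refl (w , j) with unjustify row-wf5 j
          ... | _ , () , _
          wf-case (acc rs) (suc n) 5 ca refl (w , j) with unjustify row-wf5 j
          ... | _ , _ , hg , hh , _ with wf-sound (rs (≤-<-trans (fst≤ ca) (b<pair 4 ca))) n hg
                                   | wf-sound (rs (≤-<-trans (snd≤ ca) (b<pair 4 ca))) (2 + n) hh
          ...   | g , eg | h , eh = prec g h , cong (pair 5) (trans (cong₂ pair eg eh) (pair-unpair ca))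
          wf-case (acc rs) n 6 ca refl (w , j) with unjustify row-wf6 j
          ... | _ , _ , hg , _ with wf-sound (rs (b<pair 5 ca)) (suc n) hg
          ...   | g , eg = mu g , cong (pair 6) eg
          wf-case a n (suc (suc (suc (suc (suc (suc (suc ct))))))) ca e (w , j) with unjustify row-wf7 j
          ... | _ , () , _

          wfv-sound : ∀ {cs} → Acc _<_ cs → ∀ n m → Holds (fact b 2 cs n m) → Σ (Vec (PR n) m) λ hs → encodeVec hs ≡ cs
          wfv-sound {zero} a n m h with invert b 2 0 n m refl refl refl refl h
          ... | w , j with unjustify row-wfv0 j
          ...   | _ , z , _ with refl ← ≡ᵇ⇒≡ m 0 z = [] , refl
          wfv-sound {suc cs} (acc rs) n m h with invert b 2 (suc cs) n m refl refl refl refl h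
          wfv-sound {suc cs} (acc rs) n zero h | w , j with unjustify row-wfvS j
          ... | _ , () , _
          wfv-sound {suc cs} (acc rs) n (suc m) h | w , j with unjustify row-wfvS j
          ... | _ , _ , hh , hhs , _ with wf-sound (rs (s≤s (fst≤ cs))) n hh | wfv-sound (rs (s≤s (snd≤ cs))) n m hhs
          ...   | e , ee | es , ees = e ∷ es , cong suc (trans (cong₂ pair ee ees) (pair-unpair cs))

        module Evaluation (fb : T (fldᴸ f b)) (o : Baire) (o-set : IsSet o)
          (o-1 : ∀ x → o x ≡ 1 → T (ltᴸ f (fst x) b) × Holds (fact (fst x) 0 (snd x) 0 0))
          (o-0 : ∀ x → o x ≡ 0 → T (ltᴸ f (fst x) b) → ¬ Holds (fact (fst x) 0 (snd x) 0 0)) where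

          -- The value 0 has two causes, a column not below `b` or a number outside the column; only
          -- the second one has a negative premise to establish.
          oracle-complete : ∀ x → Holds (fact b 3 (pair 3 0) (cons x 0) (o x))
          oracle-complete x = ev-rule 3 0 (cons x 0) (o x) 0 (hd-cons x 0) (tl-cons x 0) row-ev3 (go (o x) refl (o-set x))
            where
            φ⁺ : ℕ
            φ⁺ = suc (fact (fst x) 0 (snd x) 0 0)
            go : ∀ v → o x ≡ v → v ≡ 0 ⊎ v ≡ 1 → Premises b ((v ≡ᵇ 0) ∨ ((v ≡ᵇ 1) ∧ ltᴸ f (fst x) b))
              (if v ≡ᵇ 1 then φ⁺ else 0) 0 (if (v ≡ᵇ 0) ∧ ltᴸ f (fst x) b then φ⁺ else 0) false
            go 0 e (inj₁ refl) = fb , tt , tt , tt , np (ltᴸ f (fst x) b) (o-0 x e) , tt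
              where np : ∀ l → (T l → NPrem φ⁺) → NPrem (if l then φ⁺ else 0)
                    np true h = h tt
                    np false h = tt
            go 1 e (inj₂ refl) = fb , proj₁ (o-1 x e) , proj₂ (o-1 x e) , tt , tt , tt
            go 0 e (inj₂ ())
            go (suc _) e (inj₁ ())
            go (suc (suc _)) e (inj₂ ())

          oracle-sound : ∀ x v → Holds (fact b 3 (pair 3 0) (cons x 0) v) → v ≡ o x
          oracle-sound x v h with ev-unrule 3 0 (cons x 0) v (hd-cons x 0) (tl-cons x 0) h
          ... | w , j with unjustify row-ev3 j
          ...   | _ , va , p , _ , np , _ = go v va p np (o-set x)
            where
            φ⁺ : ℕ
            φ⁺ = suc (fact (fst x) 0 (snd x) 0 0)
            go : ∀ v → T ((v ≡ᵇ 0) ∨ ((v ≡ᵇ 1) ∧ ltᴸ f (fst x) b)) → Prem (if v ≡ᵇ 1 then φ⁺ else 0) →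
              NPrem (if (v ≡ᵇ 0) ∧ ltᴸ f (fst x) b then φ⁺ else 0) → o x ≡ 0 ⊎ o x ≡ 1 → v ≡ o x
            go 0 _ _ _ (inj₁ e) = sym e
            go 0 _ _ np (inj₂ e) = ⊥-elim (subst NPrem (if-true (proj₁ (o-1 x e))) np (proj₂ (o-1 x e)))
            go 1 lt p _ (inj₁ e) = ⊥-elim (o-0 x e lt p)
            go 1 _ _ _ (inj₂ e) = sym e

          mutual
            ev-complete : ∀ {n} {c : PR n} {xs v} → Eval o c xs v → Holds (fact b 3 (encode c) (codeV xs) v)
            ev-complete {xs = xs} ev-zero = ev-rule 0 0 (codeV xs) 0 0 refl refl row-ev0 (fb , tt , tt , tt , tt , tt)
            ev-complete (ev-succ {x}) = ev-rule 1 0 (cons x 0) (suc x) 0 (hd-cons x 0) (tl-cons x 0) row-ev1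
              (fb , ≡⇒≡ᵇ x x refl , tt , tt , tt , tt)
            ev-complete (ev-proj {i = i} {xs}) = ev-rule 2 (toℕ i) (codeV xs) (lookup xs i) 0 refl refl row-ev2
              (fb , ≡⇒≡ᵇ (at (codeV xs) (toℕ i)) _ (at-codeV xs i) , tt , tt , tt , tt)
            ev-complete (ev-orac {x}) = oracle-complete x
            ev-complete (ev-comp {m = m} {g} {hs} {xs} {ys} {v} es e) =
              ev-rule 4 (pair m (pair (encode g) (encodeVec hs))) (codeV xs) v (codeV ys) refl refl row-ev4
                (fb , tt , subst (λ h → Holds (fact b 4 h (codeV xs) (codeV ys))) (sym (snd-snd-pair m (encode g) (encodeVec hs))) (evv-complete es)
                , subst (λ g → Holds (fact b 3 g (codeV ys) v)) (sym (fst-snd-pair m (encode g) (encodeVec hs))) (ev-complete e) , tt , tt)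
            ev-complete (ev-prec0 {g = g} {h} {xs} {v} e) =
              ev-rule 5 (pair (encode g) (encode h)) (cons 0 (codeV xs)) v 0 (hd-cons 0 (codeV xs)) (tl-cons 0 (codeV xs)) row-ev50
                (fb , tt , subst (λ g → Holds (fact b 3 g (codeV xs) v)) (sym (fst-pair (encode g) (encode h))) (ev-complete e) , tt , tt , tt)
            ev-complete (ev-precS {g = g} {h} {k} {xs} {u} {v} e e′) =
              ev-rule 5 (pair (encode g) (encode h)) (cons (suc k) (codeV xs)) v u (hd-cons (suc k) (codeV xs)) (tl-cons (suc k) (codeV xs)) row-ev5S
                (fb , tt , ev-complete e , subst (λ h → Holds (fact b 3 h (cons k (cons u (codeV xs))) v)) (sym (snd-pair (encode g) (encode h))) (ev-complete e′) , tt , tt)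
            ev-complete (ev-mu {g = g} {xs} {y} e es) =
              ev-rule 6 (encode g) (codeV xs) y 0 refl refl row-ev6 (fb , tt , ev-complete e , mu-complete y es y ≤-refl , tt , tt)

            evv-complete : ∀ {n m} {hs : Vec (PR n) m} {xs ys} → EvalVec o hs xs ys → Holds (fact b 4 (encodeVec hs) (codeV xs) (codeV ys))
            evv-complete {xs = xs} evv-[] = conclude b 4 0 (codeV xs) 0 refl refl refl refl 0 row-evv0 (fb , tt , tt , tt , tt , tt)
            evv-complete {xs = xs} (evv-∷ {h = h} {hs} {y = y} {ys} e es) =
              conclude b 4 (cons (encode h) (encodeVec hs)) (codeV xs) (cons y (codeV ys)) refl refl refl refl 0 row-evvS
                (fb , tt , subst₂ (λ h y → Holds (fact b 3 h (codeV xs) y)) (sym (hd-cons (encode h) (encodeVec hs))) (sym (hd-cons y (codeV ys))) (ev-complete e)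
                , subst₂ (λ hs ys → Holds (fact b 4 hs (codeV xs) ys)) (sym (tl-cons (encode h) (encodeVec hs))) (sym (tl-cons y (codeV ys))) (evv-complete es) , tt , tt)

            mu-complete : ∀ {n} {g : PR (suc n)} {xs} y → (∀ z → z < y → Σ ℕ λ k → Eval o g (z ∷ xs) (suc k)) →
              ∀ z → z ≤ y → Holds (fact b 5 (encode g) (codeV xs) z)
            mu-complete {g = g} {xs} y es zero _ = conclude b 5 (encode g) (codeV xs) 0 refl refl refl refl 0 row-mu0 (fb , tt , tt , tt , tt , tt)
            mu-complete {g = g} {xs} y es (suc z) lt = conclude b 5 (encode g) (codeV xs) (suc z) refl refl refl refl (proj₁ (es z lt)) row-muS
              (fb , tt , mu-complete y es z (<⇒≤ lt) , ev-complete (proj₂ (es z lt)) , tt , tt)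

          mutual
            -- Recursion on the program, with inner recursions on the recursion argument and on the
            -- search bound; these are the last two components of the levels.
            ev-sound : ∀ {n} (c : PR n) xs v → Holds (fact b 3 (encode c) (codeV xs) v) → Eval o c xs v
            ev-sound zeroF xs v h with ev-unrule 0 0 (codeV xs) v refl refl h
            ... | w , j with unjustify row-ev0 j
            ...   | _ , z , _ with refl ← ≡ᵇ⇒≡ v 0 z = ev-zero
            ev-sound succF (x ∷ []) v h with ev-unrule 1 0 (cons x 0) v (hd-cons x 0) (tl-cons x 0) h
            ... | w , j with unjustify row-ev1 j
            ...   | _ , z , _ with refl ← ≡ᵇ⇒≡ v (suc x) z = ev-succ
            ev-sound (proj i) xs v h with ev-unrule 2 (toℕ i) (codeV xs) v refl refl h
            ... | w , j with unjustify row-ev2 j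
            ...   | _ , z , _ = subst (Eval o (proj i) xs) (suc-injective (trans (sym (at-codeV xs i)) (≡ᵇ⇒≡ (at (codeV xs) (toℕ i)) (suc v) z))) ev-proj
            ev-sound oracle (x ∷ []) v h = subst (Eval o oracle (x ∷ [])) (sym (oracle-sound x v h)) ev-orac
            ev-sound (comp {m = m} g hs) xs v h
              with ev-unrule 4 (pair m (pair (encode g) (encodeVec hs))) (codeV xs) v refl refl h
            ... | w , j with unjustify row-ev4 j
            ...   | _ , _ , hhs , hg , _
              with evv-sound hs xs w (subst (λ h → Holds (fact b 4 h (codeV xs) w)) (snd-snd-pair m (encode g) (encodeVec hs)) hhs)
            ...     | ys , refl , es = ev-comp es (ev-sound g ys v (subst (λ g → Holds (fact b 3 g (codeV ys) v)) (fst-snd-pair m (encode g) (encodeVec hs)) hg))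
            ev-sound (prec g h) (k ∷ xs) v hh = prec-sound g h k xs v hh
            ev-sound (mu g) xs v h with ev-unrule 6 (encode g) (codeV xs) v refl refl h
            ... | w , j with unjustify row-ev6 j
            ...   | _ , _ , hg , hm , _ = ev-mu (ev-sound g (v ∷ xs) 0 hg) (mu-sound g xs v hm)

            prec-sound : ∀ {n} (g : PR n) h k xs v → Holds (fact b 3 (encode (prec g h)) (cons k (codeV xs)) v) → Eval o (prec g h) (k ∷ xs) v
            prec-sound g h zero xs v hh
              with ev-unrule 5 (pair (encode g) (encode h)) (cons 0 (codeV xs)) v (hd-cons 0 (codeV xs)) (tl-cons 0 (codeV xs)) hh
            ... | w , j with unjustify row-ev50 j
            ...   | _ , _ , hg , _ = ev-prec0 (ev-sound g xs v (subst (λ g → Holds (fact b 3 g (codeV xs) v)) (fst-pair (encode g) (encode h)) hg))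
            prec-sound g h (suc k) xs v hh
              with ev-unrule 5 (pair (encode g) (encode h)) (cons (suc k) (codeV xs)) v (hd-cons (suc k) (codeV xs)) (tl-cons (suc k) (codeV xs)) hh
            ... | w , j with unjustify row-ev5S j
            ...   | _ , _ , hp , hh′ , _ = ev-precS (prec-sound g h k xs w hp)
                      (ev-sound h (k ∷ w ∷ xs) v (subst (λ h → Holds (fact b 3 h (cons k (cons w (codeV xs))) v)) (snd-pair (encode g) (encode h)) hh′))

            evv-sound : ∀ {n m} (hs : Vec (PR n) m) xs ys → Holds (fact b 4 (encodeVec hs) (codeV xs) ys) →
              Σ (Vec ℕ m) λ ys′ → codeV ys′ ≡ ys × EvalVec o hs xs ys′
            evv-sound [] xs ys h with invert b 4 0 (codeV xs) ys refl refl refl refl h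
            ... | w , j with unjustify row-evv0 j
            ...   | _ , z , _ with refl ← ≡ᵇ⇒≡ ys 0 z = [] , refl , evv-[]
            evv-sound (h ∷ hs) xs ys hh with invert b 4 (cons (encode h) (encodeVec hs)) (codeV xs) ys refl refl refl refl hh
            evv-sound (h ∷ hs) xs zero hh | w , j with unjustify row-evvS j
            ... | _ , () , _
            evv-sound (h ∷ hs) xs (suc ys) hh | w , j with unjustify row-evvS j
            ... | _ , _ , he , hes , _
              with evv-sound hs xs (snd ys) (subst (λ hs → Holds (fact b 4 hs (codeV xs) (snd ys))) (tl-cons (encode h) (encodeVec hs)) hes)
            ...   | ys′ , e , es = fst ys ∷ ys′ , cong suc (trans (cong (pair (fst ys)) e) (pair-unpair ys)) ,
                      evv-∷ (ev-sound h xs (fst ys) (subst (λ h → Holds (fact b 3 h (codeV xs) (fst ys))) (hd-cons (encode h) (encodeVec hs)) he)) es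

            mu-sound : ∀ {n} (g : PR (suc n)) xs v → Holds (fact b 5 (encode g) (codeV xs) v) → ∀ z → z < v → Σ ℕ λ k → Eval o g (z ∷ xs) (suc k)
            mu-sound g xs (suc v) h z (s≤s lt) with invert b 5 (encode g) (codeV xs) (suc v) refl refl refl refl h
            ... | w , j with unjustify row-muS j
            ...   | _ , _ , hm , he , _ with m≤n⇒m<n∨m≡n lt
            ...     | inj₁ lt′ = mu-sound g xs v hm z lt′
            ...     | inj₂ refl = w , ev-sound g (z ∷ xs) (suc w) he

          jump-complete : ∀ z e → T (ltᴸ f z b) → Jump o e → Holds (fact b 0 e 0 0)
          jump-complete z e z<b (c , refl , v , ev) = conclude b 0 u 0 0 refl refl refl refl w
            (subst (λ k → Row f (b ∷ 0 ∷ fst u ∷ snd u ∷ u ∷ 0 ∷ hd 0 ∷ tl 0 ∷ 0 ∷ w ∷ k ∷ snd w ∷ []) (ltᴸ f (fst (snd w)) b)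
                (suc (fact b 1 u 1 0)) (suc (fact b 3 u (cons u 0) (snd (snd w)))) 0 false)
              (sym (fst-pair 1 (pair z v))) (row-J {w = w} {k = 0} {wr = snd w}))
            (fb , subst (λ z → T (ltᴸ f z b)) (sym (fst-snd-pair 1 z v)) z<b , wf-complete fb c ,
              subst (λ v → Holds (fact b 3 u (cons u 0) v)) (sym (snd-snd-pair 1 z v)) (ev-complete ev) , tt , tt)
            where u w : ℕ
                  u = encode c
                  -- The 1 selects the jump rule; any nonzero number would do.
                  w = pair 1 (pair z v)

          jump-sound : ∀ e → Holds (fact b 0 e 0 0) → (T (f (suc (e + e)) ≡ᵇ 1) × (∀ z → ¬ T (ltᴸ f z b))) ⊎ (Σ ℕ λ z → T (ltᴸ f z b) × Jump o e)
          jump-sound e h with invert b 0 e 0 0 refl refl refl refl h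
          ... | w , j = go (fst w) j
            where
            go : ∀ k → Justified (b ∷ 0 ∷ fst e ∷ snd e ∷ e ∷ 0 ∷ hd 0 ∷ tl 0 ∷ 0 ∷ w ∷ k ∷ snd w ∷ []) →
              (T (f (suc (e + e)) ≡ᵇ 1) × (∀ z → ¬ T (ltᴸ f z b))) ⊎ (Σ ℕ λ z → T (ltᴸ f z b) × Jump o e)
            go zero j with unjustify row-A j
            ... | _ , va , _ , _ , _ , l = inj₁ (va , l)
            go (suc k) j with unjustify row-J j
            ... | _ , va , hw , he , _ with wf-sound (<-wellFounded e) 1 hw
            ...   | c , refl = inj₂ (fst (snd w) , va , c , refl , snd (snd w) , ev-sound c (encode c ∷ []) (snd (snd w)) he)

        initial-complete : ∀ e → T (fldᴸ f b) → T (f (suc (e + e)) ≡ᵇ 1) → (∀ z → ¬ T (ltᴸ f z b)) → Holds (fact b 0 e 0 0)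
        initial-complete e fb va l = conclude b 0 e 0 0 refl refl refl refl 0 row-A (fb , va , tt , tt , tt , l)

-- Deciding the kernel by a search for finite tables

module Tables where

  open Pairing
  open Prog
  open Trees
  open Kernel
  open Codes
  open Facts using (factᵗ)
  open import Data.Vec as Vec using ([]; _∷_)
  open import Data.List using (List; []; _∷_; _++_; length)
  open import Data.List.Membership.Propositional using (_∈_)
  open import Data.List.Membership.Propositional.Properties using (∈-++⁺ˡ; ∈-++⁺ʳ; ∈-++⁻)
  open import Data.List.Relation.Unary.Any using (here; there)
  open import Induction.WellFounded using (Acc; acc)

  nth-∈ : ∀ l {i} → i < length l → nth l i ∈ l
  nth-∈ (x ∷ l) {zero} _ = here refl
  nth-∈ (x ∷ l) {suc i} (s≤s p) = there (nth-∈ l p)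

  ∈-nth : ∀ {x l} → x ∈ l → Σ ℕ λ i → i < length l × nth l i ≡ x
  ∈-nth (here e) = 0 , z<s , sym e
  ∈-nth (there p) = let i , lt , e = ∈-nth p in suc i , s<s lt , e

  -- The entry ⟨y, β⟩ of a table claims that y is in the kernel if β = 1, and that it is not otherwise.
  module TableCheck (atk : ℕ → ℕ → Bool) (W : ℕ → ℕ) where

    hasᵇ : ℕ → ℕ → Bool
    hasᵇ c e = anyᵇ c λ i → at c i ≡ᵇ suc e

    entryᵇ : ℕ → ℕ → Bool
    entryᵇ c e = if snd e ≡ᵇ 1
      then allᵇ (suc (W (fst e))) (λ x → not (atk x (fst e)) ∨ hasᵇ c (pair x 0))
      else anyᵇ (suc (W (fst e))) (λ x → atk x (fst e) ∧ hasᵇ c (pair x 1))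

    correctᵇ : ℕ → Bool
    correctᵇ c = everyᵇ c λ i → entryᵇ c (nthᶜ c i)

    forᵇ : ℕ → ℕ → Bool
    forᵇ c y = correctᵇ c ∧ (pos c ∧ (fst (hd c) ≡ᵇ y))

    has-sound : ∀ c e → T (hasᵇ c e) → e ∈ dec c
    has-sound c e h with anyᵇ-elim {c} h
    ... | i , _ , q = go (dec c) i (trans (sym (at-dec c i)) (≡ᵇ⇒≡ _ _ q))
      where
      go : ∀ l i → l ‼ i ≡ suc e → e ∈ l
      go (x ∷ l) zero refl = here refl
      go (x ∷ l) (suc i) p = there (go l i p)
      go [] i ()

    has-complete : ∀ c e → e ∈ dec c → T (hasᵇ c e)
    has-complete c e p with go p
      where
      go : ∀ {l} → e ∈ l → Σ ℕ λ i → i < length l × l ‼ i ≡ suc e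
      go (here refl) = 0 , z<s , refl
      go (there p) = let i , lt , q = go p in suc i , s<s lt , q
    ... | i , lt , q = anyᵇ-intro {c} i (≤-trans lt (length-dec c)) (≡⇒≡ᵇ _ _ (trans (at-dec c i) q))

    data Entry (l : List ℕ) (e : ℕ) : Set where
      accept : snd e ≡ 1 → (∀ x → x ≤ W (fst e) → T (atk x (fst e)) → pair x 0 ∈ l) → Entry l e
      reject  : snd e ≢ 1 → ∀ x → x ≤ W (fst e) → T (atk x (fst e)) → pair x 1 ∈ l → Entry l e

    Correct : List ℕ → Set
    Correct l = ∀ {e} → e ∈ l → Entry l e

    entry-sound : ∀ c e → T (entryᵇ c e) → Entry (dec c) e
    entry-sound c e h with T-dec (snd e ≡ᵇ 1)
    ... | inj₁ b1 = accept (≡ᵇ⇒≡ _ _ b1) λ x x≤ a → has-sound c (pair x 0) (go x a (∨-elim {not (atk x (fst e))}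
            (allᵇ-elim {suc (W (fst e))} (subst T (if-true b1) h) (s≤s x≤))))
      where go : ∀ x → T (atk x (fst e)) → T (not (atk x (fst e))) ⊎ T (hasᵇ c (pair x 0)) → T (hasᵇ c (pair x 0))
            go x a (inj₁ n) = ⊥-elim (not-elim n a)
            go x a (inj₂ p) = p
    ... | inj₂ b0 with anyᵇ-elim {suc (W (fst e))} (subst T (if-false b0) h)
    ...   | x , s≤s x≤ , q = let a , p = ∧-elim {atk x (fst e)} q in
            reject (λ e1 → b0 (≡⇒≡ᵇ _ _ e1)) x x≤ a (has-sound c (pair x 1) p)

    entry-complete : ∀ c e → Entry (dec c) e → T (entryᵇ c e)
    entry-complete c e (accept b1 h) = subst T (sym (if-true (≡⇒≡ᵇ _ _ b1))) (allᵇ-intro {suc (W (fst e))} λ x lt → go x lt (T-dec (atk x (fst e))))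
      where go : ∀ x → x < suc (W (fst e)) → T (atk x (fst e)) ⊎ ¬ T (atk x (fst e)) → T (not (atk x (fst e)) ∨ hasᵇ c (pair x 0))
            go x (s≤s lt) (inj₁ a) = ∨-introʳ {not (atk x (fst e))} (has-complete c (pair x 0) (h x lt a))
            go x lt (inj₂ n) = ∨-introˡ (not-intro n)
    entry-complete c e (reject b0 x x≤ a p) = subst T (sym (if-false λ b1 → b0 (≡ᵇ⇒≡ _ _ b1)))
      (anyᵇ-intro {suc (W (fst e))} x (s≤s x≤) (∧-intro a (has-complete c (pair x 1) p)))

    correct-sound : ∀ c → T (correctᵇ c) → Correct (dec c)
    correct-sound c h {e} p = let i , lt , q = ∈-nth p in
      subst (Entry (dec c)) (trans (nthᶜ-dec c i) q) (entry-sound c (nthᶜ c i) (everyᵇ-elim c _ h i lt))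

    correct-complete : ∀ c → Correct (dec c) → T (correctᵇ c)
    correct-complete c h = everyᵇ-intro c _ λ i lt → entry-complete c (nthᶜ c i)
      (subst (Entry (dec c)) (sym (nthᶜ-dec c i)) (h (nth-∈ (dec c) lt)))

    Entry-mono : ∀ {l l′ e} → (∀ {d} → d ∈ l → d ∈ l′) → Entry l e → Entry l′ e
    Entry-mono s (accept b h) = accept b λ x x≤ a → s (h x x≤ a)
    Entry-mono s (reject b x x≤ a p) = reject b x x≤ a (s p)

    Correct-++ : ∀ {l l′} → Correct l → Correct l′ → Correct (l ++ l′)
    Correct-++ {l} c c′ p with ∈-++⁻ l p
    ... | inj₁ q = Entry-mono ∈-++⁺ˡ (c q)
    ... | inj₂ q = Entry-mono (∈-++⁺ʳ l) (c′ q)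

    Correct-∷ : ∀ {l e} → Entry l e → Correct l → Correct (e ∷ l)
    Correct-∷ x c (here refl) = Entry-mono there x
    Correct-∷ x c (there p) = Entry-mono there (c p)

  -- The vertex looked up is the denial of a fact, so acceptance means that the characteristic
  -- function is 0.
  answer : ℕ → ℕ
  answer c = if snd (hd c) ≡ᵇ 1 then 0 else 1

  module TableTruth (𝓡 : Ranked) (atk : ℕ → ℕ → Bool) (W : ℕ → ℕ) where
    open Ranked 𝓡 using (_⊳_)
    open KernelOrders 𝓡
    open TableCheck atk W

    module _ (atk-s : ∀ {x y} → T (atk x y) → x ⊳ y) (atk-c : ∀ {x y} → x ⊳ y → T (atk x y))
      (bounded : ∀ {y x} → x ⊳ y → Tr x → ¬ ¬ Σ ℕ λ x₀ → x₀ ≤ W y × x₀ ⊳ y × Tr x₀) where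

      -- An accepted vertex is checked against attackers up to `W y` only. If it had an attacker in
      -- the kernel, `bounded` would give one in this range, whose entry says the contrary; the
      -- double negation is harmless since the goal is negative.
      table-sound : ∀ {l} → Correct l → ∀ {y} → Acc _⊳_ y → ∀ {β} → pair y β ∈ l → (β ≡ 1 → Tr y) × (β ≢ 1 → ¬ Tr y)
      table-sound {l} c {y} (acc rs) {β} p = go (c p)
        where
        fst≡ : fst (pair y β) ≡ y
        fst≡ = fst-pair y β
        snd≡ : snd (pair y β) ≡ β
        snd≡ = snd-pair y β
        go : Entry l (pair y β) → (β ≡ 1 → Tr y) × (β ≢ 1 → ¬ Tr y)
        go (accept b h) = (λ _ → Tr-intro λ x q t → bounded q t λ (x₀ , x≤ , q₀ , t₀) →
            proj₂ (table-sound c (rs q₀) (h x₀ (subst (λ y → x₀ ≤ W y) (sym fst≡) x≤) (subst (λ y → T (atk x₀ y)) (sym fst≡) (atk-c q₀)))) (λ ()) t₀) ,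
          λ n → ⊥-elim (n (trans (sym snd≡) b))
        go (reject b x x≤ a q) = (λ e → ⊥-elim (b (trans snd≡ e))) ,
          λ _ t → let q′ = atk-s (subst (λ y → T (atk x y)) fst≡ a) in Tr-elim t q′ (proj₁ (table-sound c (rs q′) q) refl)

      Decides : List ℕ → ℕ → Set
      Decides l y = pair y 1 ∈ l ⊎ pair y 0 ∈ l

      -- Tables of the finitely many attackers in range are concatenated, which preserves
      -- correctness because entries only ask for the presence of others; the verdict on `y` is then
      -- read off.
      table : ∀ {y} → Acc _⊳_ y → Σ (List ℕ) λ l → Σ ℕ λ β → (β ≡ 0 ⊎ β ≡ 1) × Correct (pair y β ∷ l)
      table {y} (acc rs) = let l , c , d = tables (suc (W y)) in finish l c (search l (suc (W y)) d)
        where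
        Decided : List ℕ → ℕ → Set
        Decided l n = ∀ x → x < n → T (atk x y) → Decides l x
        tables : ∀ n → Σ (List ℕ) λ l → Correct l × Decided l n
        tables zero = [] , (λ ()) , λ _ ()
        tables (suc n) with tables n | T-dec (atk n y)
        ... | l , c , d | inj₂ na = l , c , λ x lt a → case-< x lt a
          where case-< : ∀ x → x < suc n → T (atk x y) → Decides l x
                case-< x (s≤s lt) a with m≤n⇒m<n∨m≡n lt
                ... | inj₁ lt′ = d x lt′ a
                ... | inj₂ refl = ⊥-elim (na a)
        ... | l , c , d | inj₁ a₀ with table (rs (atk-s a₀))
        ...   | l′ , β , β01 , c′ = (pair n β ∷ l′) ++ l , Correct-++ {pair n β ∷ l′} c′ c , case-<
          where here-n : ∀ {β} → β ≡ 0 ⊎ β ≡ 1 → Decides ((pair n β ∷ l′) ++ l) n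
                here-n (inj₁ refl) = inj₂ (here refl)
                here-n (inj₂ refl) = inj₁ (here refl)
                case-< : ∀ x → x < suc n → T (atk x y) → Decides ((pair n β ∷ l′) ++ l) x
                case-< x (s≤s lt) a with m≤n⇒m<n∨m≡n lt
                ... | inj₂ refl = here-n β01
                ... | inj₁ lt′ with d x lt′ a
                ...   | inj₁ p = inj₁ (∈-++⁺ʳ (pair n β ∷ l′) p)
                ...   | inj₂ p = inj₂ (∈-++⁺ʳ (pair n β ∷ l′) p)
        Found : List ℕ → ℕ → Set
        Found l n = (Σ ℕ λ x → x < n × T (atk x y) × pair x 1 ∈ l) ⊎ (∀ x → x < n → T (atk x y) → pair x 0 ∈ l)
        search : ∀ l n → Decided l n → Found l n
        search l zero d = inj₂ λ _ ()
        search l (suc n) d with search l n (λ x lt → d x (m≤n⇒m≤1+n lt)) | T-dec (atk n y)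
        ... | inj₁ (x , lt , a , p) | _ = inj₁ (x , m≤n⇒m≤1+n lt , a , p)
        ... | inj₂ h | inj₂ na = inj₂ λ x lt a → go x lt a
          where go : ∀ x → x < suc n → T (atk x y) → pair x 0 ∈ l
                go x (s≤s lt) a with m≤n⇒m<n∨m≡n lt
                ... | inj₁ lt′ = h x lt′ a
                ... | inj₂ refl = ⊥-elim (na a)
        ... | inj₂ h | inj₁ a₀ with d n ≤-refl a₀
        ...   | inj₁ p = inj₁ (n , ≤-refl , a₀ , p)
        ...   | inj₂ p = inj₂ λ x lt a → go x lt a
          where go : ∀ x → x < suc n → T (atk x y) → pair x 0 ∈ l
                go x (s≤s lt) a with m≤n⇒m<n∨m≡n lt
                ... | inj₁ lt′ = h x lt′ a
                ... | inj₂ refl = p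
        finish : ∀ l → Correct l → Found l (suc (W y)) → Σ (List ℕ) λ l → Σ ℕ λ β → (β ≡ 0 ⊎ β ≡ 1) × Correct (pair y β ∷ l)
        finish l c (inj₁ (x , s≤s lt , a , p)) = l , 0 , inj₁ refl , Correct-∷
          (reject (λ e → 0≢1+n (trans (sym (snd-pair y 0)) e)) x (subst (λ y → x ≤ W y) (sym (fst-pair y 0)) lt)
            (subst (λ y → T (atk x y)) (sym (fst-pair y 0)) a) p) c
        finish l c (inj₂ h) = l , 1 , inj₂ refl , Correct-∷
          (accept (snd-pair y 1) λ x x≤ a → h x (s≤s (subst (λ y → x ≤ W y) (fst-pair y 1) x≤)) (subst (λ y → T (atk x y)) (fst-pair y 1) a)) c

      decide : ∀ y → Tr y ⊎ Σ ℕ λ x → x ⊳ y × Tr x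
      decide y with table (⊳-wf y)
      ... | l , β , _ , c with c (here refl)
      ...   | accept b _ = inj₁ (proj₁ (table-sound c (⊳-wf y) (here refl)) (trans (sym (snd-pair y β)) b))
      ...   | reject _ x _ a p = inj₂ (x , q , proj₁ (table-sound c (⊳-wf x) p) refl)
        where q : x ⊳ y
              q = atk-s (subst (λ y → T (atk x y)) (fst-pair y β) a)

      for-exists : ∀ y → Σ ℕ λ c → T (forᵇ c y)
      for-exists y = let l , β , _ , h = table (⊳-wf y) ; c = enc (pair y β ∷ l) in
        c , ∧-intro (correct-complete c (λ {e} → subst (λ l → ∀ {e} → e ∈ l → Entry l e) (sym (dec-enc (pair y β ∷ l))) h {e}))
              (≡⇒≡ᵇ _ _ (trans (cong fst (hd-cons (pair y β) (enc l))) (fst-pair y β)))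

      for-sound : ∀ c y → T (forᵇ c y) → (snd (hd c) ≡ 1 → Tr y) × (snd (hd c) ≢ 1 → ¬ Tr y)
      for-sound (suc m) y h = table-sound (correct-sound (suc m) (proj₁ (∧-elim h))) (⊳-wf y) here′
        where
        e≡ : pair y (snd (fst m)) ≡ fst m
        e≡ = trans (cong (λ k → pair k (snd (fst m))) (sym (≡ᵇ⇒≡ (fst (fst m)) y (proj₂ (∧-elim {correctᵇ (suc m)} h))))) (pair-unpair (fst m))
        here′ : pair y (snd (fst m)) ∈ dec (suc m)
        here′ = subst (pair y (snd (fst m)) ∈_) (sym (dec-suc m)) (here e≡)
      for-sound zero y h = ⊥-elim (proj₂ (∧-elim {correctᵇ 0} h))

      answer-sound : ∀ c y → T (forᵇ c y) → (answer c ≡ 0 × Tr y) ⊎ (answer c ≡ 1 × ¬ Tr y)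
      answer-sound c y h with T-dec (snd (hd c) ≡ᵇ 1)
      ... | inj₁ b1 = inj₁ (if-true b1 , proj₁ (for-sound c y h) (≡ᵇ⇒≡ _ _ b1))
      ... | inj₂ b0 = inj₂ (if-false b0 , proj₂ (for-sound c y h) λ b1 → b0 (≡⇒≡ᵇ _ _ b1))

  -- `ev-mu` concerns the first table, which need not be the one constructed; `answer-sound` covers
  -- every table for the vertex.
  least : ∀ (P : ℕ → Bool) n → T (P n) → Σ ℕ λ m → T (P m) × (∀ z → z < m → ¬ T (P z))
  least P n h = go n n ≤-refl h
    where
    below? : ∀ n → (Σ ℕ λ m → m < n × T (P m)) ⊎ (∀ z → z < n → ¬ T (P z))
    below? zero = inj₂ λ _ ()
    below? (suc n) with below? n | T-dec (P n)
    ... | inj₁ (m , lt , p) | _ = inj₁ (m , m≤n⇒m≤1+n lt , p)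
    ... | inj₂ _ | inj₁ p = inj₁ (n , ≤-refl , p)
    ... | inj₂ h | inj₂ np = inj₂ λ z lt → no-< z lt
      where no-< : ∀ z → z < suc n → ¬ T (P z)
            no-< z (s≤s lt) with m≤n⇒m<n∨m≡n lt
            ... | inj₁ lt′ = h z lt′
            ... | inj₂ refl = np
    go : ∀ b n → n ≤ b → T (P n) → Σ ℕ λ m → T (P m) × (∀ z → z < m → ¬ T (P z))
    go b n n≤b h with below? n
    ... | inj₂ h′ = n , h , h′
    go zero zero _ h | inj₁ (m , () , p)
    go (suc b) n n≤b h | inj₁ (m , lt , p) = go b m (≤-pred (≤-trans lt n≤b)) p

  module TableCheckᵗ (A : Tm 2 bool) (Wᵗ : Tm 1 nat) where

    atkᵗ : ∀ {n} → Tm n nat → Tm n nat → Tm n bool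
    atkᵗ x y = app A (x ∷ y ∷ [])

    modᵗ : ∀ {n} → Tm n nat → Tm n nat
    modᵗ y = app Wᵗ (y ∷ [])

    hasᵗ entryᵗ forᵗ : ∀ {n} → Tm n nat → Tm n nat → Tm n bool
    hasᵗ c e = app (any′ v0 (atᵗ v1 v0 ≟ᵗ suc′ v2)) (c ∷ e ∷ [])
    entryᵗ c e = app (if′ (sndᵗ v1 ≟ᵗ lit 1)
      (all′ (suc′ (modᵗ (fstᵗ v1))) (not′ (atkᵗ v0 (fstᵗ v2)) ∨′ hasᵗ v1 (pairᵗ v0 (lit 0))))
      (any′ (suc′ (modᵗ (fstᵗ v1))) (atkᵗ v0 (fstᵗ v2) ∧′ hasᵗ v1 (pairᵗ v0 (lit 1))))) (c ∷ e ∷ [])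
    forᵗ c y = app (all′ v0 (not′ (pos′ (atᵗ v1 v0)) ∨′ entryᵗ v1 (nthᵗ v1 v0)) ∧′ pos′ v0 ∧′ (fstᵗ (hdᵗ v0) ≟ᵗ v1)) (c ∷ y ∷ [])

    targetᵗ : Tm 1 nat
    targetᵗ = pairᵗ (lit 0) (factᵗ (fstᵗ v0) (lit 0) (sndᵗ v0) (lit 0) (lit 0))

    testᵗ : Tm 2 nat
    testᵗ = if′ (forᵗ v0 (app targetᵗ (v1 ∷ []))) (lit 0) (lit 1)

    answerᵗ : Tm 1 nat
    answerᵗ = if′ (sndᵗ (hdᵗ v0) ≟ᵗ lit 1) (lit 0) (lit 1)

    program : PR 1
    program = comp (compile answerᵗ) (mu (compile testᵗ) ∷ [])

    module _ (f : Baire) where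
      open TableCheck (λ x y → ⟦ A ⟧ f (x ∷ y ∷ [])) (λ y → ⟦ Wᵗ ⟧ f (y ∷ []))

      target : ℕ → ℕ
      target m = ⟦ targetᵗ ⟧ f (m ∷ [])

      program-ok : ∀ m c → T (forᵇ c (target m)) → Σ ℕ λ c′ → T (forᵇ c′ (target m)) × Eval f program (m ∷ []) (answer c′)
      program-ok m c h with least (λ c → forᵇ c (target m)) c h
      ... | c′ , p , np = c′ , p , ev-comp (evv-∷ (ev-mu (subst (Eval f (compile testᵗ) (c′ ∷ m ∷ [])) (if-true p) (compile-ok f testᵗ (c′ ∷ m ∷ [])))
          (λ z lt → 0 , subst (Eval f (compile testᵗ) (z ∷ m ∷ [])) (if-false (np z lt)) (compile-ok f testᵗ (z ∷ m ∷ [])))) evv-[])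
          (compile-ok f answerᵗ (c′ ∷ []))

-- The two functionals and the correctness of the reduction

module Reduction where

  open Pairing
  open Prog
  open Trees
  open Kernel
  open Codes
  open Orders
  open Facts
  open Ranks
  open Checks
  open Specs
  open Semantics
  open Tables
  open import Data.Vec as Vec using ([]; _∷_)
  open import Data.List using ([]; _∷_; drop)
  open import Function using (_∘_)

  opaque
    attack₂ lt₂ : Tm 2 bool
    attack₂ = attackᵗ v0 v1
    lt₂ = lt³ᵗ v0 v1

    fld₁ : Tm 1 bool
    fld₁ = fldᴮᵗ (fstᵗ (fstᵗ (fstᵗ v0)))

    attack₂-ok : ∀ f x y → ⟦ attack₂ ⟧ f (x ∷ y ∷ []) ≡ attackᵇ f x y
    attack₂-ok = attackᵗ-ok

    lt₂-ok : ∀ f a b → ⟦ lt₂ ⟧ f (a ∷ b ∷ []) ≡ lt³ f a b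
    lt₂-ok = lt³ᵗ-ok

    fld₁-ok : ∀ f a → ⟦ fld₁ ⟧ f (a ∷ []) ≡ fldᴮ f (fst (fst (fst a)))
    fld₁-ok f a = refl

    -- The solution sits at the odd positions of the oracle, and its value at 0 names the direction
    -- of the embedding; hence the additional `suc′` around the code of the list.
    modulusᵗ : Tm 1 nat
    modulusᵗ = hdᵗ (tlᵗ (app (orc (suc′ (v0 +ᵗ v0))) (suc′ (consᵗ (suc′ v0) (lit 0)) ∷ [])))

    modulusᵗ-ok : ∀ f y → ⟦ modulusᵗ ⟧ f (y ∷ []) ≡ hd (tl (right f (suc (enc (suc y ∷ [])))))
    modulusᵗ-ok f y = refl

  module Inst = Testsᵗ attack₂ lt₂ fld₁

  instanceᵗ : Tm 1 nat
  instanceᵗ = interleaveᵗ (leqᵗ Inst.in𝓜ᵗ) (leqᵗ Inst.in𝓝ᵗ)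

  module Search = TableCheckᵗ (atLeft attack₂) modulusᵗ

  left-join : ∀ p q x → left (join p q) x ≡ p x
  left-join p q zero = refl
  left-join p q (suc x) rewrite +-suc x x = left-join (p ∘ suc) (q ∘ suc) x

  right-join : ∀ p q x → right (join p q) x ≡ q x
  right-join p q zero = refl
  right-join p q (suc x) rewrite +-suc x x = right-join (p ∘ suc) (q ∘ suc) x

  head₀-dec : ∀ c → head₀ (dec c) ≡ hd c
  head₀-dec zero = refl
  head₀-dec (suc m) = refl

  drop-dec : ∀ c → drop 1 (dec c) ≡ dec (tl c)
  drop-dec zero = refl
  drop-dec (suc m) = cong (drop 1) (dec-suc m)

  module Construction (p : Baire) (W : IsWellOrder (left p)) where
    open LevelOrder p W
    open GraphRanks p W
    open KernelOrders graph

    atk lt : ℕ → ℕ → Bool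
    atk x y = ⟦ attack₂ ⟧ p (x ∷ y ∷ [])
    lt x y = ⟦ lt₂ ⟧ p (x ∷ y ∷ [])

    fd : ℕ → Bool
    fd x = ⟦ fld₁ ⟧ p (x ∷ [])

    atk-s : ∀ {x y} → T (atk x y) → x ▹ y
    atk-s {x} {y} h = attack-sound p x y (subst T (attack₂-ok p x y) h)

    atk-c : ∀ {x y} → x ▹ y → T (atk x y)
    atk-c {x} {y} h = subst T (sym (attack₂-ok p x y)) (attack-complete p h)

    open Tests atk lt fd using (in𝓜; in𝓝)

    start≡ : ∀ x → start x ≡ pair (pair (pair 0 x) 0) 0
    start≡ x = cong (λ h → pair h 0) (triple-def 0 x 0)

    end≡ : end ≡ pair (pair (pair 1 0) 0) 0
    end≡ = cong (λ h → pair h 0) (triple-def 1 0 0)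

    lt-s : ∀ {a b} → T (lt a b) → Order._⊏_ E a b
    lt-s {a} {b} h = lt³-sound {a} {b} (subst T (lt₂-ok p a b) h)

    lt-c : ∀ {a b} → Order._⊏_ E a b → T (lt a b)
    lt-c {a} {b} h = subst T (sym (lt₂-ok p a b)) (lt³-complete {a} {b} h)

    fd-s : ∀ {a} → T (fd a) → Order.fld E a
    fd-s {a} h = fldᴮ-sound {fst (fst (fst a))} (subst T (fld₁-ok p a) h)

    fd-c : ∀ {a} → Order.fld E a → T (fd a)
    fd-c {a} h = subst T (sym (fld₁-ok p a)) (fldᴮ-complete {fst (fst (fst a))} h)

    module Spec = TestsSpec.Correctness graph atk lt fd atk-s atk-c (λ {a} {b} → lt-s {a} {b}) (λ {a} {b} → lt-c {a} {b})
      (λ {a} → fd-s {a}) (λ {a} → fd-c {a}) start≡ end≡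

    p′ : Baire
    p′ n = ⟦ instanceᵗ ⟧ p (n ∷ [])

    module CM = CodedTree in𝓜 𝓜 Spec.in𝓜-sound Spec.in𝓜-complete
      (left p′) (λ m → trans (interleave-left (leqᵗ Inst.in𝓜ᵗ) (leqᵗ Inst.in𝓝ᵗ) p m) (cong bit (Inst.leq𝓜-ok p m)))

    module CN = CodedTree in𝓝 𝓝 Spec.in𝓝-sound Spec.in𝓝-complete
      (right p′) (λ m → trans (interleave-right (leqᵗ Inst.in𝓜ᵗ) (leqᵗ Inst.in𝓝ᵗ) p m) (cong bit (Inst.leq𝓝-ok p m)))

    isInstance : IsWellOrder (left p′) × IsWellOrder (right p′)
    isInstance = CM.isWellOrder 𝓜-wf , CN.isWellOrder 𝓝-wf

    module _ {U V : Tree} {u v : Baire} (us : ∀ {a} → U (dec a) → Field u a) (uf : ∀ {a b} → within U (dec a) (dec b) → a <[ u ] b)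
      (vs : ∀ {a} → Field v a → V (dec a)) (vf : ∀ {a b} → a <[ v ] b → within V (dec a) (dec b)) where

      embeds : ∀ g → IsEmbedding u v g → Embeds U V
      embeds g (g∈ , g<) = record
        { f = λ τ → dec (g (enc τ))
        ; f∈ = λ {τ} x → vs (g∈ (enc τ) (us (subst U (sym (dec-enc τ)) x)))
        ; f-mono = λ {τ} {τ′} x y lt → proj₂ (proj₂ (vf (g< (enc τ) (enc τ′)
            (uf (subst U (sym (dec-enc τ)) x , subst U (sym (dec-enc τ′)) y , subst₂ _≺_ (sym (dec-enc τ)) (sym (dec-enc τ′)) lt))))) }

    no-reverse : ∀ g → ¬ IsEmbedding (right p′) (left p′) g
    no-reverse g e = no-embedding (embeds {𝓝} {𝓜} {right p′} {left p′}
      (λ {a} → CN.field-complete {a}) (λ {a} {b} → CN.<-complete {a} {b}) (λ {a} → CM.field-sound {a}) (λ {a} {b} → CM.<-sound {a} {b}) g e)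

    module Solve (q : Baire) (q-emb : IsEmbedding (left p′) (right p′) (q ∘ suc)) where

      h : Baire
      h = join p q

      e : Embeds 𝓜 𝓝
      e = embeds {𝓜} {𝓝} {left p′} {right p′}
        (λ {a} → CM.field-complete {a}) (λ {a} {b} → CM.<-complete {a} {b}) (λ {a} → CN.field-sound {a}) (λ {a} {b} → CN.<-sound {a} {b}) (q ∘ suc) q-emb

      open Modulus e

      bound : ℕ → ℕ
      bound y = ⟦ modulusᵗ ⟧ h (y ∷ [])

      modulus≡ : ∀ y → modulus y ≡ bound y
      modulus≡ y = trans (cong head₀ (drop-dec c)) (trans (head₀-dec (tl c))
          (trans (cong (λ c → hd (tl c)) (sym (right-join p q (suc (enc (suc y ∷ [])))))) (sym (modulusᵗ-ok h y))))
        where c : ℕ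
              c = q (suc (enc (suc y ∷ [])))

      atk′ : ℕ → ℕ → Bool
      atk′ x y = ⟦ atLeft attack₂ ⟧ h (x ∷ y ∷ [])

      atk′-s : ∀ {x y} → T (atk′ x y) → x ▹ y
      atk′-s {x} {y} t = atk-s {x} {y} (subst T (atLeft-ok (left-join p q) attack₂ (x ∷ y ∷ [])) t)

      atk′-c : ∀ {x y} → x ▹ y → T (atk′ x y)
      atk′-c {x} {y} t = subst T (sym (atLeft-ok (left-join p q) attack₂ (x ∷ y ∷ []))) (atk-c {x} {y} t)

      bounded : ∀ {y x} → x ▹ y → Tr x → ¬ ¬ Σ ℕ λ x₀ → x₀ ≤ bound y × x₀ ▹ y × Tr x₀
      bounded {y} {x} a t k = attacked-below-modulus {y} {x} a t λ (x₀ , le , r) → k (x₀ , subst (x₀ ≤_) (modulus≡ y) le , r)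

      module TT = TableTruth graph atk′ bound
      open TableCheck atk′ bound using (forᵇ)

      target≡ : ∀ m → Search.target h m ≡ pair 0 (fact (fst m) 0 (snd m) 0 0)
      target≡ m = cong (pair 0) (factᵗ-ok (fstᵗ v0) (lit 0) (sndᵗ v0) (lit 0) (lit 0) h (m ∷ []))

      fact-of : ℕ → ℕ
      fact-of m = fact (fst m) 0 (snd m) 0 0

      Outcome : ℕ → ℕ → Set
      Outcome y v = (v ≡ 0 × Tr y) ⊎ (v ≡ 1 × ¬ Tr y)

      opaque
        found : ∀ m → Σ ℕ λ v → Eval h Search.program (m ∷ []) v × Outcome (Search.target h m) v
        found m = let c , t = TT.for-exists atk′-s atk′-c bounded (Search.target h m)
                      c′ , t′ , ev = Search.program-ok h m c t
          in answer c′ , ev , TT.answer-sound atk′-s atk′-c bounded c′ (Search.target h m) t′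

      s : Baire
      s m = proj₁ (found m)

      s-computed : Computes Search.program h s
      s-computed m = proj₁ (proj₂ (found m))

      open Truth p W
      open Decided (TT.decide atk′-s atk′-c bounded)

      Decides-fact : ℕ → ℕ → Set
      Decides-fact φ v = (v ≡ 0 × ¬ Holds φ) ⊎ (v ≡ 1 × Holds φ)

      outcome-spec : ∀ {φ v} → Outcome (pair 0 φ) v → Decides-fact φ v
      outcome-spec (inj₁ (eq , t)) = inj₁ (eq , λ H → Holds.untrue H t)
      outcome-spec (inj₂ (eq , t)) = inj₂ (eq , holding t)

      s-spec : ∀ m → Decides-fact (fact-of m) (s m)
      s-spec m = outcome-spec (subst (λ y → Outcome y (s m)) (target≡ m) (proj₂ (proj₂ (found m))))

      spec-1 : ∀ {φ v} → Decides-fact φ v → v ≡ 1 → Holds φ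
      spec-1 (inj₁ (refl , _)) ()
      spec-1 (inj₂ (_ , H)) _ = H

      spec-0 : ∀ {φ v} → Decides-fact φ v → v ≡ 0 → ¬ Holds φ
      spec-0 (inj₁ (_ , N)) _ = N
      spec-0 (inj₂ (refl , _)) ()

      1-spec : ∀ {φ v} → Decides-fact φ v → Holds φ → v ≡ 1
      1-spec (inj₁ (_ , N)) H = ⊥-elim (N H)
      1-spec (inj₂ (eq , _)) _ = eq

      spec-set : ∀ {φ v} → Decides-fact φ v → v ≡ 0 ⊎ v ≡ 1
      spec-set (inj₁ (eq , _)) = inj₁ eq
      spec-set (inj₂ (eq , _)) = inj₂ eq

      s-1 : ∀ {m} → s m ≡ 1 → Holds (fact-of m)
      s-1 {m} = spec-1 (s-spec m)

      s-0 : ∀ {m} → s m ≡ 0 → ¬ Holds (fact-of m)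
      s-0 {m} = spec-0 (s-spec m)

      1-s : ∀ {m} → Holds (fact-of m) → s m ≡ 1
      1-s {m} = 1-spec (s-spec m)

      s-set : IsSet s
      s-set m = spec-set (s-spec m)

      fact-of-pair : ∀ b n → fact-of (pair b n) ≡ fact b 0 n 0 0
      fact-of-pair b n = cong₂ (λ b n → fact b 0 n 0 0) (fst-pair b n) (snd-pair b n)

      -- Every valid rule instance has its `b` in the field, so columns outside `L` come out empty.
      holds-field : ∀ {b n} → Holds (fact b 0 n 0 0) → Field r b
      holds-field {b} {n} H = let ρ , eq , va , _ = Holds-rule H in
        subst (Field r) (trans (cong fst eq) (fst-fact b 0 n 0 0)) (valid-field ρ va)

      module At (b : ℕ) (fb : Field r b) where
        open AtLevel b

        fbᵇ : T (fldᴸ p b)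
        fbᵇ = ≡⇒≡ᵇ _ _ fb

        o : Baire
        o = below r s b

        o-set : ∀ c m → (if c then s m else 0) ≡ 0 ⊎ (if c then s m else 0) ≡ 1
        o-set true m = s-set m
        o-set false m = inj₁ refl

        o-1 : ∀ c m → (if c then s m else 0) ≡ 1 → T c × Holds (fact-of m)
        o-1 true m eq = tt , s-1 eq

        open Evaluation fbᵇ o
          (λ m → o-set (ltᴸ p (fst m) b) m)
          (λ m → o-1 (ltᴸ p (fst m) b) m)
          (λ m eq lt → s-0 (trans (sym (if-true lt)) eq)) public

      module _ (χ-set : IsSet (right p)) where

        hierarchy : IsJumpHierarchy (left p) (right p) s
        hierarchy = s-set , outside , bottom , successor
          where
          to-1 : ∀ {b n} → Holds (fact b 0 n 0 0) → s (pair b n) ≡ 1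
          to-1 {b} {n} H = 1-s (subst Holds (sym (fact-of-pair b n)) H)

          from-1 : ∀ {b n} → s (pair b n) ≡ 1 → Holds (fact b 0 n 0 0)
          from-1 {b} {n} eq = subst Holds (fact-of-pair b n) (s-1 eq)

          outside : ∀ a n → ¬ Field r a → s (pair a n) ≡ 0
          outside a n nf = go (s-set (pair a n))
            where
            go : s (pair a n) ≡ 0 ⊎ s (pair a n) ≡ 1 → s (pair a n) ≡ 0
            go (inj₁ eq) = eq
            go (inj₂ eq) = ⊥-elim (nf (holds-field {a} {n} (from-1 {a} {n} eq)))

          least-minimal : ∀ {b} → IsLeast r b → ∀ z → ¬ T (ltᴸ p z b)
          least-minimal {b} (_ , lb) z z<b = go (ltᴸ-sound {z} {b} z<b)
            where
            open IsLinOrder (proj₁ W)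
            go : ¬ (z <[ r ] b)
            go (z≤b , z≢b) = z≢b (antisym z b z≤b (lb z (proj₁ (inField z b z≤b))))

          bottom : ∀ b → IsLeast r b → ∀ n → s (pair b n) ≡ right p n
          bottom b lb n = go (s-set (pair b n)) (χ-set n)
            where
            open At b (proj₁ lb)
            -- At the least element the jump rule has no smaller z to offer.
            χ-1 : (T (p (suc (n + n)) ≡ᵇ 1) × (∀ z → ¬ T (ltᴸ p z b))) ⊎ (Σ ℕ λ z → T (ltᴸ p z b) × Jump o n) → right p n ≡ 1
            χ-1 (inj₁ (χ1 , _)) = ≡ᵇ⇒≡ _ _ χ1
            χ-1 (inj₂ (z , z<b , _)) = ⊥-elim (least-minimal lb z z<b)
            go : s (pair b n) ≡ 0 ⊎ s (pair b n) ≡ 1 → right p n ≡ 0 ⊎ right p n ≡ 1 → s (pair b n) ≡ right p n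
            go (inj₁ eq) (inj₁ eq′) = trans eq (sym eq′)
            go (inj₂ eq) _ = trans eq (sym (χ-1 (jump-sound n (from-1 {b} {n} eq))))
            go (inj₁ eq) (inj₂ eq′) = trans (to-1 (AtLevel.initial-complete b n fbᵇ (≡⇒≡ᵇ _ _ eq′) (least-minimal lb))) (sym eq′)

          successor : ∀ z b → IsLeast r z → z <[ r ] b → ∀ n →
            (s (pair b n) ≡ 1 → Jump (below r s b) n) × (Jump (below r s b) n → s (pair b n) ≡ 1)
          successor z b lz z<b n = (λ eq → sound (jump-sound n (from-1 {b} {n} eq))) , λ J → to-1 (jump-complete z n (ltᴸ-complete z<b) J)
            where
            open At b (proj₂ (IsLinOrder.inField (proj₁ W) z b (proj₁ z<b)))
            -- Above the least element `z` the copying rule is defeated by `z` itself.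
            sound : (T (p (suc (n + n)) ≡ᵇ 1) × (∀ z → ¬ T (ltᴸ p z b))) ⊎ (Σ ℕ λ z → T (ltᴸ p z b) × Jump o n) → Jump o n
            sound (inj₁ (_ , l)) = ⊥-elim (l z (ltᴸ-complete z<b))
            sound (inj₂ (_ , _ , J)) = J

open Prog using (compile; compile-ok)
open Reduction using (instanceᵗ; module Search; module Construction)
open import Data.Vec using ([]; _∷_)
open import Function using (_∘_)

theorem6p3 : ATR ≤W WCWO
theorem6p3 = compile instanceᵗ , Search.program , reduce
  where
  reduce : ∀ p → Problem.Inst ATR p → Σ Baire λ p′ → Computes (compile instanceᵗ) p p′ × Problem.Inst WCWO p′ ×
    (∀ q → Problem.Sol WCWO p′ q → Σ Baire λ s → Computes Search.program (join p q) s × Problem.Sol ATR p s)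
  reduce p (W , χ-set) = p′ , (λ n → compile-ok p instanceᵗ (n ∷ [])) , isInstance , solve
    where
    open Construction p W
    solve : ∀ q → Problem.Sol WCWO p′ q → Σ Baire λ s → Computes Search.program (join p q) s × Problem.Sol ATR p s
    solve q (inj₁ (_ , emb)) = Solve.s q emb , Solve.s-computed q emb , Solve.hierarchy q emb χ-set
    solve q (inj₂ (_ , emb)) = ⊥-elim (no-reverse (q ∘ suc) emb)
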